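{- Let $d,k\in\mathbb N^+$ and let $A=A(Q_d)$ be the adjacency matrix of the hypercube $Q_d$. Then $A^k$ has PST between every antipodal pair $x,\bar x$ if and only if $d$ is even or $k$ is odd. More precisely: (i) if $d$ is even, then for every $k\in\mathbb N^+$ the matrix $A^k$ has PST between every antipodal pair, with minimum positive transfer time $\pi/2^k$; (ii) if $d$ is odd, then exactly the odd exponents $k$ have PST between antipodal pairs, with minimum positive transfer time $\pi/2$.
   Context: $\mathbb N^+=\{1,2,3,\ldots\}$. $\mathbb F_2=\mathbb Z/2\mathbb Z$. $Q_d$ is the graph on $\mathbb F_2^d$ in which two words are adjacent when they differ in exactly one coordinate. For $x\in\mathbb F_2^d$, its antipode is $\bar x=x+(1,\ldots,1)$. A real symmetric matrix $K$ indexed by a finite vertex set has perfect state transfer (PST) from vertex $a$ to vertex $b$ at time $\tau>0$ (a transfer time) if $\exp(-\mathrm i\tau K)e_a=\gamma e_b$ for some $\gamma\in\mathbb C$ with $|\gamma|=1$, where $e_v$ is the standard basis vector indexed by $v$; it has PST from $a$ to $b$ if this holds for some $\tau>0$. -}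

module Defs where

open import Level using (0ℓ)
open import Algebra.Bundles.Raw using (RawRing)
import Algebra.Definitions.RawMonoid as RawMonoidDefs
import Algebra.Definitions.RawSemiring as RawSemiringDefs
open import Data.Bool using (if_then_else_)
open import Data.Fin using (toℕ)
import Data.Integer as ℤ
open import Data.List using (List; []; _∷_; foldr; map; cartesianProductWith)
open import Data.List.Membership.Propositional using (_∈_)
open import Data.List.Membership.Propositional.Properties using (∈-cartesianProductWith⁺)
import Data.List.Relation.Unary.All as All
open import Data.List.Relation.Unary.Any using (here; there)
open import Data.List.Relation.Unary.AllPairs using ([]; _∷_)
open import Data.List.Relation.Unary.Unique.Propositional using (Unique)
import Data.List.Relation.Unary.Unique.Propositional.Properties as Uniqueₚ
open import Data.Nat as ℕ using (ℕ; zero; suc; _!; _⊔_)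
open import Data.Nat.Divisibility using (_∣_)
import Data.Nat.Properties as ℕₚ
open import Data.Parity using (Parity; 0ℙ; 1ℙ)
import Data.Parity as ℙ
open import Data.Product using (∃-syntax; _×_; _,_; proj₁; proj₂)
open import Data.Rational as ℚ using (ℚ; 0ℚ; 1ℚ; ½)
import Data.Rational.Properties as ℚₚ
open import Data.Rational.Solver using (module +-*-Solver)
open import Data.Vec using (Vec; []; _∷_; count; zip; zipWith; replicate)
open import Data.Vec.Properties using (≡-dec; ∷-injective)
open import Relation.Binary.Definitions using (DecidableEquality)
open import Relation.Binary.PropositionalEquality
  using (_≡_; refl; sym; trans; cong; cong₂; subst; subst₂)
open import Relation.Nullary using (¬_; Dec; does; ¬?)

IsCauchy : (ℕ → ℚ) → Set
IsCauchy s = ∀ ε → 0ℚ ℚ.< ε →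
  ∃[ N ] (∀ m n → N ℕ.≤ m → N ℕ.≤ n → ℚ.∣ s m ℚ.- s n ∣ ℚ.< ε)

private
  half-sum : ∀ ε → ε ℚ.* ½ ℚ.+ ε ℚ.* ½ ≡ ε
  half-sum ε = trans (sym (ℚₚ.*-distribˡ-+ ε ½ ½)) (ℚₚ.*-identityʳ ε)

  half-pos : ∀ {ε} → 0ℚ ℚ.< ε → 0ℚ ℚ.< ε ℚ.* ½
  half-pos {ε} ε>0 =
    subst (ℚ._< ε ℚ.* ½) (ℚₚ.*-zeroˡ ½) (ℚₚ.*-monoˡ-<-pos ½ ε>0)

  add-bounds : ∀ {a b ε} → ℚ.∣ a ∣ ℚ.< ε ℚ.* ½ → ℚ.∣ b ∣ ℚ.< ε ℚ.* ½ →
               ℚ.∣ a ℚ.+ b ∣ ℚ.< ε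
  add-bounds {a} {b} {ε} a< b< = ℚₚ.≤-<-trans (ℚₚ.∣p+q∣≤∣p∣+∣q∣ a b)
    (subst (ℚ.∣ a ∣ ℚ.+ ℚ.∣ b ∣ ℚ.<_) (half-sum ε) (ℚₚ.+-mono-< a< b<))

  mul-bounds : ∀ {a b B δ} .{{_ : ℚ.Positive B}} →
               ℚ.∣ a ∣ ℚ.≤ B → ℚ.∣ b ∣ ℚ.< δ → ℚ.∣ a ℚ.* b ∣ ℚ.< B ℚ.* δ
  mul-bounds {a} {b} {B} {δ} a≤ b< = subst (ℚ._< B ℚ.* δ) (sym (ℚₚ.∣p*q∣≡∣p∣*∣q∣ a b))
    (ℚₚ.≤-<-trans (ℚₚ.*-monoʳ-≤-nonNeg ℚ.∣ b ∣ {{ℚₚ.∣-∣-nonNeg b}} a≤)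
                  (ℚₚ.*-monoʳ-<-pos B b<))

  quotient : ∀ B .{{_ : ℚ.Positive B}} → ∀ ε → 0ℚ ℚ.< ε →
             ∃[ δ ] (0ℚ ℚ.< δ × B ℚ.* δ ≡ ε)
  quotient B ε ε>0 = B⁻¹ ℚ.* ε , δ>0 ,
      trans (sym (ℚₚ.*-assoc B B⁻¹ ε))
        (trans (cong (ℚ._* ε) (ℚₚ.*-inverseʳ B {{B≢0}})) (ℚₚ.*-identityˡ ε))
    where
    B≢0 : ℚ.NonZero B
    B≢0 = ℚₚ.pos⇒nonZero B
    B⁻¹ : ℚ
    B⁻¹ = (ℚ.1/ B) {{B≢0}}
    δ>0 : 0ℚ ℚ.< B⁻¹ ℚ.* ε
    δ>0 = subst (ℚ._< B⁻¹ ℚ.* ε) (ℚₚ.*-zeroʳ B⁻¹)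
            (ℚₚ.*-monoʳ-<-pos B⁻¹ {{ℚₚ.1/pos⇒pos B}} ε>0)

  eventually-bounded : ∀ {s} → IsCauchy s →
    ∃[ B ] (ℚ.Positive B × ∃[ N ] (∀ n → N ℕ.≤ n → ℚ.∣ s n ∣ ℚ.≤ B))
  eventually-bounded {s} cs with cs 1ℚ (ℚₚ.positive⁻¹ 1ℚ)
  ... | N , close = 1ℚ ℚ.+ ℚ.∣ s N ∣
                  , ℚₚ.pos+nonNeg⇒pos 1ℚ ℚ.∣ s N ∣ {{ℚₚ.∣-∣-nonNeg (s N)}}
                  , N , bound
    where
    open +-*-Solver
    split : ∀ p q → p ≡ (p ℚ.- q) ℚ.+ q
    split = solve 2 (λ p q → p := (p :- q) :+ q) refl
    bound : ∀ n → N ℕ.≤ n → ℚ.∣ s n ∣ ℚ.≤ 1ℚ ℚ.+ ℚ.∣ s N ∣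
    bound n N≤n = subst (λ z → ℚ.∣ z ∣ ℚ.≤ 1ℚ ℚ.+ ℚ.∣ s N ∣) (sym (split (s n) (s N)))
      (ℚₚ.≤-trans (ℚₚ.∣p+q∣≤∣p∣+∣q∣ (s n ℚ.- s N) (s N))
        (ℚₚ.+-monoˡ-≤ ℚ.∣ s N ∣ (ℚₚ.<⇒≤ (close n N N≤n ℕₚ.≤-refl))))

const-cauchy : ∀ q → IsCauchy (λ _ → q)
const-cauchy q ε ε>0 = 0 , λ _ _ _ _ →
  subst (λ z → ℚ.∣ z ∣ ℚ.< ε) (sym (ℚₚ.+-inverseʳ q)) ε>0

neg-cauchy : ∀ {s} → IsCauchy s → IsCauchy (λ n → ℚ.- s n)
neg-cauchy {s} cs ε ε>0 with cs ε ε>0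
... | N , close = N , λ m n N≤m N≤n →
    subst (ℚ._< ε)
      (trans (sym (ℚₚ.∣-p∣≡∣p∣ (s m ℚ.- s n)))
             (cong ℚ.∣_∣ (ℚₚ.neg-distrib-+ (s m) (ℚ.- s n))))
      (close m n N≤m N≤n)

+-cauchy : ∀ {s t} → IsCauchy s → IsCauchy t → IsCauchy (λ n → s n ℚ.+ t n)
+-cauchy {s} {t} cs ct ε ε>0 with cs (ε ℚ.* ½) (half-pos ε>0) | ct (ε ℚ.* ½) (half-pos ε>0)
... | M , closeₛ | N , closeₜ = M ⊔ N , λ m n ≤m ≤n →
    subst (λ z → ℚ.∣ z ∣ ℚ.< ε) (sym (regroup (s m) (t m) (s n) (t n)))
      (add-bounds
        (closeₛ m n (ℕₚ.m⊔n≤o⇒m≤o M N ≤m) (ℕₚ.m⊔n≤o⇒m≤o M N ≤n))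
        (closeₜ m n (ℕₚ.m⊔n≤o⇒n≤o M N ≤m) (ℕₚ.m⊔n≤o⇒n≤o M N ≤n)))
  where
  open +-*-Solver
  regroup : ∀ a b c d → (a ℚ.+ b) ℚ.- (c ℚ.+ d) ≡ (a ℚ.- c) ℚ.+ (b ℚ.- d)
  regroup = solve 4 (λ a b c d → (a :+ b) :- (c :+ d) := (a :- c) :+ (b :- d)) refl

private
  product-close : ∀ {B C δ η ε} (a b c d : ℚ) → ℚ.Positive B → ℚ.Positive C →
    B ℚ.* δ ≡ ε ℚ.* ½ → C ℚ.* η ≡ ε ℚ.* ½ →
    ℚ.∣ a ∣ ℚ.≤ B → ℚ.∣ d ∣ ℚ.≤ C → ℚ.∣ b ℚ.- d ∣ ℚ.< δ → ℚ.∣ a ℚ.- c ∣ ℚ.< η →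
    ℚ.∣ a ℚ.* b ℚ.- c ℚ.* d ∣ ℚ.< ε
  product-close {B} {C} {δ} {η} {ε} a b c d B>0 C>0 Bδ Cη a≤ d≤ bd< ac< =
    subst (λ z → ℚ.∣ z ∣ ℚ.< ε) (sym (regroup a b c d))
      (add-bounds {a ℚ.* (b ℚ.- d)} {d ℚ.* (a ℚ.- c)} {ε}
        (subst (ℚ.∣ a ℚ.* (b ℚ.- d) ∣ ℚ.<_) Bδ
          (mul-bounds {a} {b ℚ.- d} {B} {δ} {{B>0}} a≤ bd<))
        (subst (ℚ.∣ d ℚ.* (a ℚ.- c) ∣ ℚ.<_) Cη
          (mul-bounds {d} {a ℚ.- c} {C} {η} {{C>0}} d≤ ac<)))
    where
    open +-*-Solver
    regroup : ∀ a b c d → (a ℚ.* b) ℚ.- (c ℚ.* d) ≡ a ℚ.* (b ℚ.- d) ℚ.+ d ℚ.* (a ℚ.- c)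
    regroup = solve 4 (λ a b c d → (a :* b) :- (c :* d) := a :* (b :- d) :+ d :* (a :- c)) refl

*-cauchy : ∀ {s t} → IsCauchy s → IsCauchy t → IsCauchy (λ n → s n ℚ.* t n)
*-cauchy {s} {t} cs ct ε ε>0 =
  let B , B>0 , M , s≤B = eventually-bounded {s} cs
      C , C>0 , N , t≤C = eventually-bounded {t} ct
      δ , δ>0 , Bδ      = quotient B {{B>0}} (ε ℚ.* ½) (half-pos ε>0)
      η , η>0 , Cη      = quotient C {{C>0}} (ε ℚ.* ½) (half-pos ε>0)
      P , closeₜ        = ct δ δ>0
      Q , closeₛ        = cs η η>0
      L = (M ⊔ N) ⊔ (P ⊔ Q)
      MN≤ : ∀ {n} → L ℕ.≤ n → M ⊔ N ℕ.≤ n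
      MN≤ = ℕₚ.m⊔n≤o⇒m≤o (M ⊔ N) (P ⊔ Q)
      PQ≤ : ∀ {n} → L ℕ.≤ n → P ⊔ Q ℕ.≤ n
      PQ≤ = ℕₚ.m⊔n≤o⇒n≤o (M ⊔ N) (P ⊔ Q)
  in L , λ m n ≤m ≤n →
    product-close {B} {C} {δ} {η} {ε} (s m) (t m) (s n) (t n) B>0 C>0 Bδ Cη
      (s≤B m (ℕₚ.m⊔n≤o⇒m≤o M N (MN≤ ≤m)))
      (t≤C n (ℕₚ.m⊔n≤o⇒n≤o M N (MN≤ ≤n)))
      (closeₜ m n (ℕₚ.m⊔n≤o⇒m≤o P Q (PQ≤ ≤m)) (ℕₚ.m⊔n≤o⇒m≤o P Q (PQ≤ ≤n)))
      (closeₛ m n (ℕₚ.m⊔n≤o⇒n≤o P Q (PQ≤ ≤m)) (ℕₚ.m⊔n≤o⇒n≤o P Q (PQ≤ ≤n)))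

-- The library has no real numbers. A real is a Cauchy sequence of rationals;
-- the equality of reals is _≈_ below, not _≡_.
record ℝ : Set where
  constructor mkℝ
  field
    seq    : ℕ → ℚ
    cauchy : IsCauchy seq

open ℝ public

infix  4 _≈_ _<_ _≤_
infixl 6 _+_ _-_
infixl 7 _*_
infix  8 -_

record _≈_ (x y : ℝ) : Set where
  constructor mk≈
  field
    close : ∀ ε → 0ℚ ℚ.< ε →
      ∃[ N ] (∀ n → N ℕ.≤ n → ℚ.∣ seq x n ℚ.- seq y n ∣ ℚ.< ε)

_<_ : ℝ → ℝ → Set
x < y = ∃[ ε ] (0ℚ ℚ.< ε × ∃[ N ] (∀ n → N ℕ.≤ n → seq x n ℚ.+ ε ℚ.< seq y n))

_≤_ : ℝ → ℝ → Set
x ≤ y = ¬ (y < x)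

fromℚ : ℚ → ℝ
fromℚ q = mkℝ (λ _ → q) (const-cauchy q)

0ℝ 1ℝ : ℝ
0ℝ = fromℚ 0ℚ
1ℝ = fromℚ 1ℚ

_+_ _*_ : ℝ → ℝ → ℝ
x + y = mkℝ (λ n → seq x n ℚ.+ seq y n) (+-cauchy {seq x} {seq y} (cauchy x) (cauchy y))
x * y = mkℝ (λ n → seq x n ℚ.* seq y n) (*-cauchy {seq x} {seq y} (cauchy x) (cauchy y))

-_ : ℝ → ℝ
- x = mkℝ (λ n → ℚ.- seq x n) (neg-cauchy {seq x} (cauchy x))

_-_ : ℝ → ℝ → ℝ
x - y = x + (- y)

infixl 7 _/2^_

_/2^_ : ℝ → ℕ → ℝ
x /2^ k = x * fromℚ ((ℤ.+ 1 ℚ./ (2 ℕ.^ k)) {{ℕₚ.m^n≢0 2 k}})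

1/_! : ℕ → ℚ
1/ n ! = (ℤ.+ 1 ℚ./ (n !)) {{n ℕₚ.!≢0}}

ℝ-rawRing : RawRing 0ℓ 0ℓ
ℝ-rawRing = record
  { Carrier = ℝ ; _≈_ = _≈_ ; _+_ = _+_ ; _*_ = _*_ ; -_ = -_ ; 0# = 0ℝ ; 1# = 1ℝ }

record ℂ : Set where
  constructor _+i_
  field
    re im : ℝ

open ℂ public

infix 5 _+i_

ℂ-rawRing : RawRing 0ℓ 0ℓ
ℂ-rawRing = record
  { Carrier = ℂ
  ; _≈_ = λ z w → re z ≈ re w × im z ≈ im w
  ; _+_ = λ z w → (re z + re w) +i (im z + im w)
  ; _*_ = λ z w → (re z * re w - im z * im w) +i (re z * im w + im z * re w)
  ; -_  = λ z → (- re z) +i (- im z)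
  ; 0#  = 0ℝ +i 0ℝ
  ; 1#  = 1ℝ +i 0ℝ
  }

module ℂR = RawRing ℂ-rawRing

fromℝ : ℝ → ℂ
fromℝ x = x +i 0ℝ

𝕚 : ℂ
𝕚 = 0ℝ +i 1ℝ

-- Modulus z r says r = |z|, i.e. r is the nonnegative square root of re² + im².
Modulus : ℂ → ℝ → Set
Modulus z r = 0ℝ ≤ r × r * r ≈ re z * re z + im z * im z

-- It suffices to test convergence against rational ε.
_⟶_ : (ℕ → ℝ) → ℝ → Set
s ⟶ ℓ = ∀ ε → 0ℚ ℚ.< ε →
  ∃[ N ] (∀ n → N ℕ.≤ n → ℓ - fromℚ ε < s n × s n < ℓ + fromℚ ε)

_⟶ᶜ_ : (ℕ → ℂ) → ℂ → Set
s ⟶ᶜ ℓ = (λ n → re (s n)) ⟶ re ℓ × (λ n → im (s n)) ⟶ im ℓ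

infix 4 _⟶_ _⟶ᶜ_

-- partialSum R t n = t 0 + ⋯ + t (n - 1)
partialSum : (R : RawRing 0ℓ 0ℓ) → (ℕ → RawRing.Carrier R) → ℕ → RawRing.Carrier R
partialSum R t n = RawMonoidDefs.sum (RawRing.+-rawMonoid R) {n} (λ i → t (toℕ i))

sinTerm : ℝ → ℕ → ℝ
sinTerm x j = (- 1ℝ) ^ j * (fromℚ (1/ suc (2 ℕ.* j) !) * x ^ suc (2 ℕ.* j))
  where open RawSemiringDefs (RawRing.rawSemiring ℝ-rawRing) using (_^_)

-- IsSin x s says s = sin x, as the sum of the everywhere convergent sine series.
IsSin : ℝ → ℝ → Set
IsSin x s = partialSum ℝ-rawRing (sinTerm x) ⟶ s

-- π is the least positive zero of sine.
IsPi : ℝ → Set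
IsPi p = 0ℝ < p × IsSin p 0ℝ × (∀ y → 0ℝ < y → IsSin y 0ℝ → p ≤ y)

record FiniteSet : Set₁ where
  field
    Carrier  : Set
    _≟_      : DecidableEquality Carrier
    elements : List Carrier
    complete : ∀ x → x ∈ elements
    unique   : Unique elements

module LinearAlgebra (R : RawRing 0ℓ 0ℓ) (V : FiniteSet) where
  private
    module R = RawRing R
  open FiniteSet V

  Vector Matrix : Set
  Vector = Carrier → R.Carrier
  Matrix = Carrier → Carrier → R.Carrier

  ∑ : Vector → R.Carrier
  ∑ f = foldr R._+_ R.0# (map f elements)

  infix  4 _≈ᵛ_
  infixl 7 _·_ _*ᵥ_
  infixl 7 _*ᵛ_
  infixr 8 _^ᴹ_

  _≈ᵛ_ : Vector → Vector → Set
  f ≈ᵛ g = ∀ v → f v R.≈ g v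

  𝟙 : Matrix
  𝟙 u v = if does (u ≟ v) then R.1# else R.0#

  e : Carrier → Vector
  e a v = if does (a ≟ v) then R.1# else R.0#

  _·_ : Matrix → Matrix → Matrix
  (M · N) u w = ∑ (λ v → M u v R.* N v w)

  _*ᵥ_ : Matrix → Vector → Vector
  (M *ᵥ f) u = ∑ (λ v → M u v R.* f v)

  _*ᵛ_ : R.Carrier → Vector → Vector
  (c *ᵛ f) v = c R.* f v

  _^ᴹ_ : Matrix → ℕ → Matrix
  M ^ᴹ zero  = 𝟙
  M ^ᴹ suc k = M · M ^ᴹ k

module PerfectStateTransfer (V : FiniteSet) where
  open FiniteSet V using (Carrier)
  open LinearAlgebra ℂ-rawRing V

  RealMatrix : Set
  RealMatrix = LinearAlgebra.Matrix ℝ-rawRing V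

  -- IsExp M E says E = exp M: entrywise, the partial sums of ∑ⱼ Mʲ / j!
  -- (a series converging for every M) tend to E.
  IsExp : Matrix → Matrix → Set
  IsExp M E = ∀ u v →
    partialSum ℂ-rawRing (λ j → fromℝ (fromℚ (1/ j !)) ℂR.* (M ^ᴹ j) u v) ⟶ᶜ E u v

  -iτ_·_ : ℝ → RealMatrix → Matrix
  (-iτ τ · K) u v = (ℂR.- (𝕚 ℂR.* fromℝ τ)) ℂR.* fromℝ (K u v)

  -- exp(-iτK) eₐ = γ e_b with |γ| = 1 and τ > 0. Used only for symmetric K,
  -- though symmetry plays no role in the condition itself.
  IsTransferTime : RealMatrix → Carrier → Carrier → ℝ → Set
  IsTransferTime K a b τ = 0ℝ < τ ×
    ∃[ U ] (IsExp (-iτ τ · K) U ×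
      ∃[ γ ] (Modulus γ 1ℝ × U *ᵥ e a ≈ᵛ γ *ᵛ e b))

  HasPST : RealMatrix → Carrier → Carrier → Set
  HasPST K a b = ∃[ τ ] IsTransferTime K a b τ

  IsMinTransferTime : RealMatrix → Carrier → Carrier → ℝ → Set
  IsMinTransferTime K a b τ =
    IsTransferTime K a b τ × (∀ σ → IsTransferTime K a b σ → τ ≤ σ)

-- The library's Parity is the field ℤ/2ℤ.
Word : ℕ → Set
Word d = Vec Parity d

_≟ᵂ_ : ∀ {d} → DecidableEquality (Word d)
_≟ᵂ_ = ≡-dec ℙ._≟_

private
  bits : List Parity
  bits = 0ℙ ∷ 1ℙ ∷ []

  bits-complete : ∀ b → b ∈ bits
  bits-complete 0ℙ = here refl
  bits-complete 1ℙ = there (here refl)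

  bits-unique : Unique bits
  bits-unique = ((λ ()) All.∷ All.[]) ∷ All.[] ∷ []

words : ∀ d → List (Word d)
words zero    = [] ∷ []
words (suc d) = cartesianProductWith _∷_ bits (words d)

words-complete : ∀ {d} (x : Word d) → x ∈ words d
words-complete []      = here refl
words-complete (b ∷ x) = ∈-cartesianProductWith⁺ _∷_ (bits-complete b) (words-complete x)

words-unique : ∀ d → Unique (words d)
words-unique zero    = All.[] ∷ []
words-unique (suc d) =
  Uniqueₚ.cartesianProductWith⁺ _∷_ ∷-injective bits-unique (words-unique d)

𝔽₂^ : ℕ → FiniteSet
𝔽₂^ d = record
  { Carrier  = Word d
  ; _≟_      = _≟ᵂ_
  ; elements = words d
  ; complete = words-complete
  ; unique   = words-unique d
  }

antipode : ∀ {d} → Word d → Word d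
antipode {d} x = zipWith ℙ._+_ x (replicate d 1ℙ)

differences : ∀ {d} → Word d → Word d → ℕ
differences x y = count (λ (a , b) → ¬? (a ℙ.≟ b)) (zip x y)

Adjacent : ∀ {d} → Word d → Word d → Set
Adjacent x y = differences x y ≡ 1

adjacent? : ∀ {d} (x y : Word d) → Dec (Adjacent x y)
adjacent? x y = differences x y ℕ.≟ 1

module Hypercube (d : ℕ) where
  open LinearAlgebra ℝ-rawRing (𝔽₂^ d) public using (Matrix; _^ᴹ_)
  open PerfectStateTransfer (𝔽₂^ d) public using (HasPST; IsMinTransferTime)

  A : Matrix
  A x y = if does (adjacent? x y) then 1ℝ else 0ℝ

Even Odd : ℕ → Set
Even n = 2 ∣ n
Odd  n = ¬ Even n

{-# OPTIONS --safe #-}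

-- The characters χ_S of F₂^d diagonalise A with eigenvalues λ_S = d - 2|S|, and χ_S takes the antipode of x
-- to (-1)^|S| χ_S(x). Hence A^k has PST from x to its antipode at time τ exactly when
-- exp(-iτ λ_S^k) = γ (-1)^|S| for one γ and all S. At τ = π/2^k (d even) and τ = π/2 (d, k odd) the
-- angle is a multiple y π/2 with y ≡ λ_S mod 4, so γ = exp(-i d π/2) works. Conversely two words S of
-- opposite signs force exp(-iτ 2^k) = -1 (eigenvalues 0 and 2) or exp(-iτ (-1)^k) = -exp(-iτ)
-- (eigenvalues 1 and -1). The number π/2 is the limit of roots found by bisecting cosine polynomials;
-- that it is the least positive zero of cosine follows from cos y = 2 sin((π/2 + y)/2) sin((π/2 - y)/2).
module Submission where

-- The order of Cauchy reals is undecidable, so cosine itself cannot be bisected, but its rational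
-- truncations can: `cosRoot m` bisects the cosine polynomial with `m` terms `m` times. Roots of
-- different polynomials are close because cosine has a quantitative inverse on [1, 2]:
-- `cos p - cos q` is `2 sin a sin b` with the mean `a` in [1, 2], where sine is at least 1/3. The
-- reals `cos x` and `sin x` are diagonal sequences, the truncation at `2m` applied to the `m`-th
-- approximation of `x`, so the limit of the roots is a zero of cosine by construction. Parity then
-- holds exactly at each index, the addition theorems only up to an error: truncations multiply to a
-- square of products, of which only a triangle belongs to the sum. The base 8 in `termBound`
-- absorbs it: of three factors `½ⁿ`, two pay for at most `n²` surplus products and one makes the
-- error vanish. The spectral half works over abstract commutative rings with an abstract notion of
-- limit, since unfolding concrete reals would bring in their Cauchy proofs; sums are exchanged only
-- inside finite partial sums.

-- Rational inequalities, powers of one half and geometric bounds for finite sums.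

module RationalArithmetic where
  open import Algebra.Bundles.Raw using (RawRing)
  import Algebra.Definitions.RawSemiring as RawSemiringDefs
  open import Data.Integer as ℤ using (ℤ)
  import Data.Integer.Properties as ℤₚ
  open import Data.Nat as ℕ using (ℕ; zero; suc; _!)
  import Data.Nat.Properties as ℕₚ
  open import Data.Product using (∃-syntax; _×_; _,_; proj₁; proj₂)
  open import Data.Rational hiding (truncate; floor)
  open import Data.Rational.Properties
  open import Data.Rational.Solver using (module +-*-Solver)
  import Data.Rational.Unnormalised as ℚᵘ
  import Data.Rational.Unnormalised.Properties as ℚᵘₚ
  open import Data.Sum using (inj₁; inj₂)
  open import Relation.Binary.PropositionalEquality
  open import Relation.Nullary using (yes; no)
  open import Relation.Nullary.Negation using (contradiction)
  open import Defs using (1/_!; partialSum)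
  open +-*-Solver

  open RawSemiringDefs (RawRing.rawSemiring +-*-rawRing) public using (_^_)

  Σℚ : (ℕ → ℚ) → ℕ → ℚ
  Σℚ = partialSum +-*-rawRing

  ι : ℤ → ℚ
  ι z = z / 1

  ιₙ : ℕ → ℚ
  ιₙ n = ι (ℤ.+ n)

  toℚᵘ-ι : ∀ z → toℚᵘ (ι z) ℚᵘ.≃ ℚᵘ.mkℚᵘ z 0
  toℚᵘ-ι z = toℚᵘ-fromℚᵘ (ℚᵘ.mkℚᵘ z 0)

  ι-+ : ∀ a b → ι (a ℤ.+ b) ≡ ι a + ι b
  ι-+ a b = toℚᵘ-injective (ℚᵘₚ.≃-trans (toℚᵘ-ι (a ℤ.+ b))
    (ℚᵘₚ.≃-trans (ℚᵘ.*≡* (cong (ℤ._* ℤ.1ℤ) (sym (cong₂ ℤ._+_ (ℤₚ.*-identityʳ a) (ℤₚ.*-identityʳ b)))))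
    (ℚᵘₚ.≃-sym (ℚᵘₚ.≃-trans (toℚᵘ-homo-+ (ι a) (ι b)) (ℚᵘₚ.+-cong (toℚᵘ-ι a) (toℚᵘ-ι b))))))

  ι-* : ∀ a b → ι (a ℤ.* b) ≡ ι a * ι b
  ι-* a b = toℚᵘ-injective (ℚᵘₚ.≃-trans (toℚᵘ-ι (a ℤ.* b))
    (ℚᵘₚ.≃-sym (ℚᵘₚ.≃-trans (toℚᵘ-homo-* (ι a) (ι b)) (ℚᵘₚ.*-cong (toℚᵘ-ι a) (toℚᵘ-ι b)))))

  ιₙ-* : ∀ m n → ιₙ (m ℕ.* n) ≡ ιₙ m * ιₙ n
  ιₙ-* m n = trans (cong ι (ℤₚ.pos-* m n)) (ι-* (ℤ.+ m) (ℤ.+ n))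

  ιₙ-suc : ∀ n → ιₙ (suc n) ≡ 1ℚ + ιₙ n
  ιₙ-suc n = ι-+ (ℤ.+ 1) (ℤ.+ n)

  ιₙ-+ : ∀ m n → ιₙ (m ℕ.+ n) ≡ ιₙ m + ιₙ n
  ιₙ-+ m n = ι-+ (ℤ.+ m) (ℤ.+ n)

  ιₙ-mono : ∀ {m n} → m ℕ.≤ n → ιₙ m ≤ ιₙ n
  ιₙ-mono {m} {n} m≤n = toℚᵘ-cancel-≤
    (ℚᵘₚ.≤-respˡ-≃ (ℚᵘₚ.≃-sym (toℚᵘ-ι (ℤ.+ m))) (ℚᵘₚ.≤-respʳ-≃ (ℚᵘₚ.≃-sym (toℚᵘ-ι (ℤ.+ n)))
      (ℚᵘ.*≤* (ℤₚ.*-monoʳ-≤-nonNeg ℤ.1ℤ (ℤ.+≤+ m≤n)))))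

  ιₙ-nonNeg : ∀ n → NonNegative (ιₙ n)
  ιₙ-nonNeg n = nonNegative (ιₙ-mono {0} {n} ℕ.z≤n)

  1/-* : ∀ n .{{_ : ℕ.NonZero n}} → (ℤ.+ 1 / n) * ιₙ n ≡ 1ℚ
  1/-* (suc n) = toℚᵘ-injective (ℚᵘₚ.≃-trans (toℚᵘ-homo-* (ℤ.+ 1 / suc n) (ιₙ (suc n)))
    (ℚᵘₚ.≃-trans (ℚᵘₚ.*-cong (toℚᵘ-fromℚᵘ (ℚᵘ.mkℚᵘ (ℤ.+ 1) n)) (toℚᵘ-ι (ℤ.+ suc n)))
      (ℚᵘ.*≡* (trans (ℤₚ.*-identityʳ _) (sym (trans (ℤₚ.*-identityˡ _) (ℤₚ.*-comm (ℤ.+ suc n) ℤ.1ℤ)))))))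

  -- The denominator is at least 1, so the absolute value of the numerator already serves as the
  -- natural number of the Archimedean property.
  ≤-ι∣↥∣ : ∀ r → r ≤ ιₙ ℤ.∣ ↥ r ∣
  ≤-ι∣↥∣ r = toℚᵘ-cancel-≤ (ℚᵘₚ.≤-respʳ-≃ (ℚᵘₚ.≃-sym (toℚᵘ-ι (ℤ.+ ℤ.∣ ↥ r ∣))) (lemma r))
    where
    num : ∀ z d → z ℤ.* ℤ.1ℤ ℤ.≤ ℤ.+ ℤ.∣ z ∣ ℤ.* (ℤ.+ suc d)
    num (ℤ.+ n) d = ℤₚ.*-monoˡ-≤-nonNeg (ℤ.+ n) (ℤ.+≤+ (ℕ.s≤s ℕ.z≤n))
    num ℤ.-[1+ n ] d = ℤ.-≤+
    lemma : ∀ r → toℚᵘ r ℚᵘ.≤ ℚᵘ.mkℚᵘ (ℤ.+ ℤ.∣ ↥ r ∣) 0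
    lemma (mkℚ z d _) = ℚᵘ.*≤* (num z d)

  ≤-by : ∀ {p q} r → 0ℚ ≤ r → p + r ≡ q → p ≤ q
  ≤-by {p} {q} r 0≤r eq = subst₂ _≤_ (+-identityʳ p) eq (+-monoʳ-≤ p 0≤r)

  <-by : ∀ {p q} r → 0ℚ < r → p + r ≡ q → p < q
  <-by {p} {q} r 0<r eq = subst₂ _<_ (+-identityʳ p) eq (+-monoʳ-< p 0<r)

  *-nonneg : ∀ {p q} → 0ℚ ≤ p → 0ℚ ≤ q → 0ℚ ≤ p * q
  *-nonneg {p} {q} 0≤p 0≤q =
    subst (_≤ p * q) (*-zeroʳ p) (*-monoˡ-≤-nonNeg p {{nonNegative 0≤p}} 0≤q)

  *-pos : ∀ {p q} → 0ℚ < p → 0ℚ < q → 0ℚ < p * q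
  *-pos {p} {q} 0<p 0<q =
    subst (_< p * q) (*-zeroʳ p) (*-monoʳ-<-pos p {{positive 0<p}} 0<q)

  +-nonneg : ∀ {p q} → 0ℚ ≤ p → 0ℚ ≤ q → 0ℚ ≤ p + q
  +-nonneg = +-mono-≤

  *-mono : ∀ {p q r s} → 0ℚ ≤ p → p ≤ q → 0ℚ ≤ r → r ≤ s → p * r ≤ q * s
  *-mono {p} {q} {r} {s} 0≤p p≤q 0≤r r≤s = ≤-trans
    (*-monoˡ-≤-nonNeg p {{nonNegative 0≤p}} r≤s)
    (*-monoʳ-≤-nonNeg s {{nonNegative (≤-trans 0≤r r≤s)}} p≤q)

  0≤q-p : ∀ {p q} → p ≤ q → 0ℚ ≤ q - p
  0≤q-p {p} {q} p≤q = subst (_≤ q - p) (+-inverseʳ p) (+-monoˡ-≤ (- p) p≤q)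

  ∣∣≤ : ∀ {p q} → p ≤ q → - q ≤ p → ∣ p ∣ ≤ q
  ∣∣≤ {p} {q} p≤q -q≤p with ∣p∣≡p∨∣p∣≡-p p
  ... | inj₁ eq = subst (_≤ q) (sym eq) p≤q
  ... | inj₂ eq = subst (_≤ q) (sym eq) (subst (- p ≤_) (solve 1 (λ q → :- (:- q) := q) refl q) (neg-antimono-≤ -q≤p))

  p≤∣p∣ : ∀ p → p ≤ ∣ p ∣
  p≤∣p∣ p with ≤-total 0ℚ p
  ... | inj₁ 0≤p = ≤-reflexive (sym (0≤p⇒∣p∣≡p 0≤p))
  ... | inj₂ p≤0 = ≤-trans p≤0 (0≤∣p∣ p)

  -p≤∣p∣ : ∀ p → - p ≤ ∣ p ∣
  -p≤∣p∣ p = subst (- p ≤_) (∣-p∣≡∣p∣ p) (p≤∣p∣ (- p))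

  ∣-∣-sym : ∀ p q → ∣ p - q ∣ ≡ ∣ q - p ∣
  ∣-∣-sym p q = trans (sym (∣-p∣≡∣p∣ (p - q))) (cong ∣_∣ (solve 2 (λ p q → :- (p :- q) := q :- p) refl p q))

  ∣-∣-triangle : ∀ p q r → ∣ p - r ∣ ≤ ∣ p - q ∣ + ∣ q - r ∣
  ∣-∣-triangle p q r = subst (λ z → ∣ z ∣ ≤ ∣ p - q ∣ + ∣ q - r ∣)
    (solve 3 (λ p q r → (p :- q) :+ (q :- r) := p :- r) refl p q r) (∣p+q∣≤∣p∣+∣q∣ (p - q) (q - r))

  half-pos : ∀ {ε} → 0ℚ < ε → 0ℚ < ½ * ε
  half-pos 0<ε = *-pos (positive⁻¹ ½) 0<ε

  half+half : ∀ ε → ½ * ε + ½ * ε ≡ ε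
  half+half = solve 1 (λ ε → con ½ :* ε :+ con ½ :* ε := ε) refl

  ½^_ : ℕ → ℚ
  ½^ zero  = 1ℚ
  ½^ suc n = ½ * ½^ n

  ½^-pos : ∀ n → 0ℚ < ½^ n
  ½^-pos zero    = positive⁻¹ 1ℚ
  ½^-pos (suc n) = *-pos (positive⁻¹ ½) (½^-pos n)

  ½^-nonneg : ∀ n → 0ℚ ≤ ½^ n
  ½^-nonneg n = <⇒≤ (½^-pos n)

  ½^-suc≤ : ∀ n → ½^ suc n ≤ ½^ n
  ½^-suc≤ n = ≤-by (½^ suc n) (½^-nonneg (suc n)) (half+half (½^ n))

  ½^-antitone : ∀ {m n} → m ℕ.≤ n → ½^ n ≤ ½^ m
  ½^-antitone {n = zero}  ℕ.z≤n = ≤-refl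
  ½^-antitone {n = suc n} ℕ.z≤n = ≤-trans (½^-suc≤ n) (½^-antitone {n = n} ℕ.z≤n)
  ½^-antitone (ℕ.s≤s m≤n) = *-monoˡ-≤-nonNeg ½ (½^-antitone m≤n)

  ½^-≤1 : ∀ n → ½^ n ≤ 1ℚ
  ½^-≤1 n = ½^-antitone {0} {n} ℕ.z≤n

  -- This is `n + 1 ≤ 2ⁿ`. In the inductive step `(n + 2) / 2` falls short of `n + 1` by `n / 2`,
  -- which is the slack supplied to `≤-by`.
  suc*½^≤1 : ∀ n → ιₙ (suc n) * ½^ n ≤ 1ℚ
  suc*½^≤1 zero    = ≤-refl
  suc*½^≤1 (suc n) = ≤-trans
    (≤-by (½ * (ιₙ n * ½^ n)) (*-nonneg {½} (<⇒≤ (positive⁻¹ ½)) (*-nonneg {ιₙ n} (ιₙ-mono {0} {n} ℕ.z≤n) (½^-nonneg n)))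
      (trans (cong (λ z → z * (½ * ½^ n) + ½ * (ιₙ n * ½^ n)) (trans (ιₙ-suc (suc n)) (cong (1ℚ +_) (ιₙ-suc n))))
        (trans (solve 2 (λ m x → (con 1ℚ :+ (con 1ℚ :+ m)) :* (con ½ :* x) :+ con ½ :* (m :* x) := (con 1ℚ :+ m) :* x) refl (ιₙ n) (½^ n))
          (cong (_* ½^ n) (sym (ιₙ-suc n))))))
    (suc*½^≤1 n)

  n*½^≤1 : ∀ n → ιₙ n * ½^ n ≤ 1ℚ
  n*½^≤1 n = ≤-trans (*-monoʳ-≤-nonNeg (½^ n) {{nonNegative (½^-nonneg n)}} (ιₙ-mono (ℕₚ.n≤1+n n))) (suc*½^≤1 n)

  -- With `N` an Archimedean bound for `K / ε`, every `n ≥ N` satisfies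
  -- `K ≤ n ε < (n + 1) ε ≤ 2ⁿ ε`.
  geometric-vanishes : ∀ K ε → 0ℚ < ε → ∃[ N ] (∀ n → N ℕ.≤ n → K * ½^ n < ε)
  geometric-vanishes K ε 0<ε = N , small
    where
    instance ε≢0 = pos⇒nonZero ε {{positive 0<ε}}
    N : ℕ
    N = ℤ.∣ ↥ (K * 1/ ε) ∣
    K≤ : ∀ n → N ℕ.≤ n → K ≤ ιₙ n * ε
    K≤ n N≤n = subst (_≤ ιₙ n * ε)
      (trans (*-assoc K (1/ ε) ε) (trans (cong (K *_) (*-inverseˡ ε)) (*-identityʳ K)))
      (*-monoʳ-≤-nonNeg ε {{nonNegative (<⇒≤ 0<ε)}} (≤-trans (≤-ι∣↥∣ (K * 1/ ε)) (ιₙ-mono N≤n)))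
    small : ∀ n → N ℕ.≤ n → K * ½^ n < ε
    small n N≤n = <-≤-trans
      (*-monoˡ-<-pos (½^ n) {{positive (½^-pos n)}} {K} {ιₙ (suc n) * ε}
        (≤-<-trans (K≤ n N≤n) (*-monoˡ-<-pos ε {{positive 0<ε}} ιn<)))
      (subst₂ _≤_ (solve 3 (λ a b c → a :* b :* c := a :* c :* b) refl (ιₙ (suc n)) (½^ n) ε) (*-identityˡ ε)
        (*-monoʳ-≤-nonNeg ε {{nonNegative (<⇒≤ 0<ε)}} (suc*½^≤1 n)))
      where
      ιn< : ιₙ n < ιₙ (suc n)
      ιn< = <-by 1ℚ (positive⁻¹ 1ℚ) (trans (+-comm (ιₙ n) 1ℚ) (sym (ιₙ-suc n)))

  Σ-cong : ∀ {a b} → (∀ n → a n ≡ b n) → ∀ N → Σℚ a N ≡ Σℚ b N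
  Σ-cong a≡b zero    = refl
  Σ-cong a≡b (suc N) = cong₂ _+_ (a≡b 0) (Σ-cong (λ n → a≡b (suc n)) N)

  Σ-+ : ∀ a b N → Σℚ (λ n → a n + b n) N ≡ Σℚ a N + Σℚ b N
  Σ-+ a b zero    = refl
  Σ-+ a b (suc N) = trans (cong (a 0 + b 0 +_) (Σ-+ (λ n → a (suc n)) (λ n → b (suc n)) N))
    (solve 4 (λ x y u v → (x :+ y) :+ (u :+ v) := (x :+ u) :+ (y :+ v)) refl (a 0) (b 0) _ _)

  Σ-*ˡ : ∀ c a N → Σℚ (λ n → c * a n) N ≡ c * Σℚ a N
  Σ-*ˡ c a zero    = sym (*-zeroʳ c)
  Σ-*ˡ c a (suc N) = trans (cong (c * a 0 +_) (Σ-*ˡ c (λ n → a (suc n)) N)) (sym (*-distribˡ-+ c (a 0) _))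

  Σ-snoc : ∀ a N → Σℚ a (suc N) ≡ Σℚ a N + a N
  Σ-snoc a zero    = +-comm (a 0) 0ℚ
  Σ-snoc a (suc N) = trans (cong (a 0 +_) (Σ-snoc (λ n → a (suc n)) N)) (sym (+-assoc (a 0) _ _))

  ∣Σ∣≤ : ∀ {a c} → 0ℚ ≤ c → (∀ n → ∣ a n ∣ ≤ c) → ∀ N → ∣ Σℚ a N ∣ ≤ ιₙ N * c
  ∣Σ∣≤ {a} {c} 0≤c a≤c zero = ≤-reflexive (sym (*-zeroˡ c))
  ∣Σ∣≤ {a} {c} 0≤c a≤c (suc N) = ≤-trans (∣p+q∣≤∣p∣+∣q∣ (a 0) (Σℚ (λ n → a (suc n)) N))
    (≤-trans (+-mono-≤ (a≤c 0) (∣Σ∣≤ 0≤c (λ n → a≤c (suc n)) N))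
      (≤-reflexive (sym (trans (cong (_* c) (ιₙ-suc N)) (solve 2 (λ m c → (con 1ℚ :+ m) :* c := c :+ m :* c) refl (ιₙ N) c)))))

  private
    halve-bound : ∀ {a : ℕ → ℚ} {K} → (∀ n → ∣ a n ∣ ≤ K * ½^ n) → ∀ n → ∣ a (suc n) ∣ ≤ ½ * K * ½^ n
    halve-bound {a} {K} a≤ n = subst (∣ a (suc n) ∣ ≤_) (solve 2 (λ k x → k :* (con ½ :* x) := con ½ :* k :* x) refl K (½^ n)) (a≤ (suc n))

  -- The head is at most `K`, and the tail satisfies the same hypothesis with `K / 2`, so it
  -- contributes at most `K` again.
  ∣Σ-geometric∣≤ : ∀ {a K} → 0ℚ ≤ K → (∀ n → ∣ a n ∣ ≤ K * ½^ n) → ∀ N → ∣ Σℚ a N ∣ ≤ K + K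
  ∣Σ-geometric∣≤ 0≤K a≤ zero = +-nonneg 0≤K 0≤K
  ∣Σ-geometric∣≤ {a} {K} 0≤K a≤ (suc N) = ≤-trans (∣p+q∣≤∣p∣+∣q∣ (a 0) (Σℚ (λ n → a (suc n)) N))
    (+-mono-≤ (subst (∣ a 0 ∣ ≤_) (*-identityʳ K) (a≤ 0))
      (subst (_ ≤_) (half+half K) (∣Σ-geometric∣≤ (*-nonneg {½} (<⇒≤ (positive⁻¹ ½)) 0≤K) (halve-bound {a} {K} a≤) N)))

  -- Dropping a common first term lowers `m` by one and halves `K`, which leaves the right-hand side
  -- unchanged; at `m = 0` it is the bound for a whole sum.
  Σ-geometric-tail : ∀ {a K} → 0ℚ ≤ K → (∀ n → ∣ a n ∣ ≤ K * ½^ n) →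
    ∀ m k → ∣ Σℚ a (m ℕ.+ k) - Σℚ a m ∣ ≤ (K + K) * ½^ m
  Σ-geometric-tail {a} {K} 0≤K a≤ zero k = subst₂ _≤_
    (cong ∣_∣ (sym (+-identityʳ (Σℚ a k)))) (sym (*-identityʳ (K + K))) (∣Σ-geometric∣≤ 0≤K a≤ k)
  Σ-geometric-tail {a} {K} 0≤K a≤ (suc m) k = subst₂ _≤_
    (cong ∣_∣ (solve 3 (λ a x y → x :- y := (a :+ x) :- (a :+ y)) refl (a 0) _ _))
    (solve 2 (λ k x → (con ½ :* k :+ con ½ :* k) :* x := (k :+ k) :* (con ½ :* x)) refl K (½^ m))
    (Σ-geometric-tail (*-nonneg {½} (<⇒≤ (positive⁻¹ ½)) 0≤K) (halve-bound {a} {K} a≤) m k)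

  Σ-geometric-cauchy : ∀ {a K} → 0ℚ ≤ K → (∀ n → ∣ a n ∣ ≤ K * ½^ n) →
    ∀ m n → m ℕ.≤ n → ∣ Σℚ a n - Σℚ a m ∣ ≤ (K + K) * ½^ m
  Σ-geometric-cauchy {a} {K} 0≤K a≤ m n m≤n =
    subst (λ z → ∣ Σℚ a z - Σℚ a m ∣ ≤ (K + K) * ½^ m) (ℕₚ.m+[n∸m]≡n m≤n) (Σ-geometric-tail 0≤K a≤ m (n ℕ.∸ m))

-- The terms `qⁿ/n!`: growth, binomial theorem and addition theorems for partial sums.

module ExponentialTerms where
  open import Algebra.Bundles using (CommutativeRing)
  open import Algebra.Bundles.Raw using (RawRing)
  import Algebra.Properties.CommutativeSemiring.Exp as Exp
  open import Data.Integer as ℤ using (ℤ)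
  open import Data.Nat as ℕ using (ℕ; zero; suc; _!)
  import Data.Nat.Properties as ℕₚ
  open import Data.Product using (∃-syntax; _×_; _,_; proj₁; proj₂)
  open import Data.Rational hiding (truncate; floor; 1/_)
  open import Data.Rational.Properties
  open import Data.Rational.Solver using (module +-*-Solver)
  open import Data.Sum using (inj₁; inj₂)
  open import Relation.Binary.PropositionalEquality
  open import Relation.Nullary using (yes; no)
  open import Defs using (1/_!; partialSum)
  open RationalArithmetic
  open +-*-Solver
  open Exp (CommutativeRing.commutativeSemiring +-*-commutativeRing) using (^-distrib-*)

  1/!-* : ∀ n → 1/ n ! * ιₙ (n !) ≡ 1ℚ
  1/!-* n = 1/-* (n !) {{n ℕₚ.!≢0}}

  1/!-nonneg : ∀ n → 0ℚ ≤ 1/ n !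
  1/!-nonneg n = nonNegative⁻¹ _ {{normalize-nonNeg 1 (n !) {{n ℕₚ.!≢0}}}}

  1/!-suc : ∀ n → 1/ n ! ≡ ιₙ (suc n) * 1/ suc n !
  1/!-suc n = begin
    1/ n !                                             ≡⟨ *-identityʳ _ ⟨
    1/ n ! * 1ℚ                                        ≡⟨ cong (1/ n ! *_) (1/!-* (suc n)) ⟨
    1/ n ! * (1/ suc n ! * ιₙ (suc n ℕ.* n !))         ≡⟨ cong (λ z → 1/ n ! * (1/ suc n ! * z)) (ιₙ-* (suc n) (n !)) ⟩
    1/ n ! * (1/ suc n ! * (ιₙ (suc n) * ιₙ (n !)))    ≡⟨ solve 4 (λ a b c d → a :* (b :* (c :* d)) := (a :* d) :* (c :* b)) refl (1/ n !) (1/ suc n !) (ιₙ (suc n)) (ιₙ (n !)) ⟩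
    1/ n ! * ιₙ (n !) * (ιₙ (suc n) * 1/ suc n !)      ≡⟨ cong (_* (ιₙ (suc n) * 1/ suc n !)) (1/!-* n) ⟩
    1ℚ * (ιₙ (suc n) * 1/ suc n !)                     ≡⟨ *-identityˡ _ ⟩
    ιₙ (suc n) * 1/ suc n !                            ∎
    where open ≡-Reasoning

  ^-nonneg : ∀ {q} → 0ℚ ≤ q → ∀ n → 0ℚ ≤ q ^ n
  ^-nonneg 0≤q zero    = <⇒≤ (positive⁻¹ 1ℚ)
  ^-nonneg 0≤q (suc n) = *-nonneg 0≤q (^-nonneg 0≤q n)

  ∣^∣≤ : ∀ {q b} → ∣ q ∣ ≤ b → ∀ n → ∣ q ^ n ∣ ≤ b ^ n
  ∣^∣≤ q≤b zero = ≤-refl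
  ∣^∣≤ {q} {b} q≤b (suc n) = subst (_≤ b ^ suc n) (sym (∣p*q∣≡∣p∣*∣q∣ q (q ^ n)))
    (*-mono (0≤∣p∣ q) q≤b (0≤∣p∣ (q ^ n)) (∣^∣≤ q≤b n))

  ιₙ-^ : ∀ b n → ιₙ (b ℕ.^ n) ≡ ιₙ b ^ n
  ιₙ-^ b zero    = refl
  ιₙ-^ b (suc n) = trans (ιₙ-* b (b ℕ.^ n)) (cong (ιₙ b *_) (ιₙ-^ b n))

  term : ℚ → ℕ → ℚ
  term q n = 1/ n ! * q ^ n

  -- As long as `n ≤ m` the power is at most `mᵐ`; beyond that each new factor `m` is absorbed by
  -- the new factor of the factorial.
  m^n≤m^m*n! : ∀ m n → m ℕ.^ n ℕ.≤ m ℕ.^ m ℕ.* n !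
  m^n≤m^m*n! m zero = subst (1 ℕ.≤_) (sym (ℕₚ.*-identityʳ (m ℕ.^ m))) (1≤m^m m)
    where
    1≤m^m : ∀ m → 1 ℕ.≤ m ℕ.^ m
    1≤m^m zero    = ℕₚ.≤-refl
    1≤m^m (suc m) = ℕₚ.m^n>0 (suc m) (suc m)
  m^n≤m^m*n! m (suc n) with m ℕ.≤? suc n
  ... | yes m≤1+n = ℕₚ.≤-trans (ℕₚ.*-mono-≤ m≤1+n (m^n≤m^m*n! m n)) (ℕₚ.≤-reflexive eq)
    where
    eq : suc n ℕ.* (m ℕ.^ m ℕ.* n !) ≡ m ℕ.^ m ℕ.* (suc n ℕ.* n !)
    eq = trans (sym (ℕₚ.*-assoc (suc n) (m ℕ.^ m) (n !)))
      (trans (cong (ℕ._* n !) (ℕₚ.*-comm (suc n) (m ℕ.^ m))) (ℕₚ.*-assoc (m ℕ.^ m) (suc n) (n !)))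
  m^n≤m^m*n! zero    (suc n) | no _     = ℕ.z≤n
  m^n≤m^m*n! (suc m) (suc n) | no m≰1+n = ℕₚ.≤-trans
    (ℕₚ.^-monoʳ-≤ (suc m) (ℕₚ.<⇒≤ (ℕₚ.≰⇒> m≰1+n)))
    (ℕₚ.m≤m*n (suc m ℕ.^ suc m) (suc n !) {{suc n ℕₚ.!≢0}})

  8^n½^3n : ∀ n → ιₙ 8 ^ n * (½^ n * ½^ n * ½^ n) ≡ 1ℚ
  8^n½^3n zero    = refl
  8^n½^3n (suc n) = trans
    (solve 2 (λ e h → (con (ιₙ 8) :* e) :* ((con ½ :* h) :* (con ½ :* h) :* (con ½ :* h)) := e :* (h :* h :* h)) refl (ιₙ 8 ^ n) (½^ n))
    (8^n½^3n n)

  -- This is `mᵐ` at `m = 8 b`, which gives `bⁿ/n! ≤ (8b)^(8b) / 8ⁿ`. The base 8 = 2³ yields three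
  -- factors `½ⁿ`: two absorb the number of surplus entries in a product of partial sums, the third
  -- gives convergence.
  termBound : ℕ → ℚ
  termBound b = ιₙ ((8 ℕ.* b) ℕ.^ (8 ℕ.* b))

  termBound-nonneg : ∀ b → 0ℚ ≤ termBound b
  termBound-nonneg b = nonNegative⁻¹ _ {{ιₙ-nonNeg ((8 ℕ.* b) ℕ.^ (8 ℕ.* b))}}

  term-ι≤ : ∀ m n → 1/ n ! * ιₙ m ^ n ≤ ιₙ (m ℕ.^ m)
  term-ι≤ m n = begin
    1/ n ! * ιₙ m ^ n                   ≡⟨ cong (1/ n ! *_) (ιₙ-^ m n) ⟨
    1/ n ! * ιₙ (m ℕ.^ n)               ≤⟨ *-monoˡ-≤-nonNeg (1/ n !) {{nonNegative (1/!-nonneg n)}} (ιₙ-mono (m^n≤m^m*n! m n)) ⟩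
    1/ n ! * ιₙ (m ℕ.^ m ℕ.* n !)       ≡⟨ cong (1/ n ! *_) (ιₙ-* (m ℕ.^ m) (n !)) ⟩
    1/ n ! * (ιₙ (m ℕ.^ m) * ιₙ (n !))  ≡⟨ solve 3 (λ a b c → a :* (b :* c) := (a :* c) :* b) refl (1/ n !) (ιₙ (m ℕ.^ m)) (ιₙ (n !)) ⟩
    1/ n ! * ιₙ (n !) * ιₙ (m ℕ.^ m)    ≡⟨ cong (_* ιₙ (m ℕ.^ m)) (1/!-* n) ⟩
    1ℚ * ιₙ (m ℕ.^ m)                   ≡⟨ *-identityˡ _ ⟩
    ιₙ (m ℕ.^ m)                        ∎
    where open ≤-Reasoning

  ∣term∣≤ : ∀ {q} b → ∣ q ∣ ≤ ιₙ b → ∀ n → ∣ term q n ∣ ≤ termBound b * (½^ n * ½^ n * ½^ n)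
  ∣term∣≤ {q} b q≤b n = begin
    ∣ 1/ n ! * q ^ n ∣                            ≡⟨ ∣p*q∣≡∣p∣*∣q∣ (1/ n !) (q ^ n) ⟩
    ∣ 1/ n ! ∣ * ∣ q ^ n ∣                        ≡⟨ cong (_* ∣ q ^ n ∣) (0≤p⇒∣p∣≡p (1/!-nonneg n)) ⟩
    1/ n ! * ∣ q ^ n ∣                            ≤⟨ *-monoˡ-≤-nonNeg (1/ n !) {{nonNegative (1/!-nonneg n)}} (∣^∣≤ q≤b n) ⟩
    1/ n ! * ιₙ b ^ n                             ≡⟨ *-identityˡ _ ⟨
    -- The factor 1 is written as `8ⁿ (½ⁿ)³`, so that `8ⁿ` can merge with `bⁿ` into a power of
    -- `8 b`.
    1ℚ * (1/ n ! * ιₙ b ^ n)                      ≡⟨ cong (_* (1/ n ! * ιₙ b ^ n)) (8^n½^3n n) ⟨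
    ιₙ 8 ^ n * h³ * (1/ n ! * ιₙ b ^ n)           ≡⟨ solve 4 (λ e h f x → e :* h :* (f :* x) := (f :* (e :* x)) :* h) refl (ιₙ 8 ^ n) h³ (1/ n !) (ιₙ b ^ n) ⟩
    1/ n ! * (ιₙ 8 ^ n * ιₙ b ^ n) * h³           ≡⟨ cong (λ z → 1/ n ! * z * h³) (trans (sym (^-distrib-* (ιₙ 8) (ιₙ b) n)) (cong (_^ n) (sym (ιₙ-* 8 b)))) ⟩
    1/ n ! * ιₙ (8 ℕ.* b) ^ n * h³                ≤⟨ *-monoʳ-≤-nonNeg h³ {{nonNegative 0≤h³}} (term-ι≤ (8 ℕ.* b) n) ⟩
    termBound b * h³                              ∎
    where
    open ≤-Reasoning
    h³ : ℚ
    h³ = ½^ n * ½^ n * ½^ n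
    0≤h³ : 0ℚ ≤ h³
    0≤h³ = *-nonneg (*-nonneg (½^-nonneg n) (½^-nonneg n)) (½^-nonneg n)

  -- Double sums over squares and over triangles

  rect : (ℕ → ℕ → ℚ) → ℕ → ℕ → ℚ
  rect f M N = Σℚ (λ j → Σℚ (f j) N) M

  -- f 0 n + f 1 (n - 1) + ⋯ + f n 0
  antidiagonal : (ℕ → ℕ → ℚ) → ℕ → ℚ
  antidiagonal f zero    = f 0 0
  antidiagonal f (suc n) = f 0 (suc n) + antidiagonal (λ j → f (suc j)) n

  antidiagonal-cong : ∀ {f g} → (∀ j l → f j l ≡ g j l) → ∀ n → antidiagonal f n ≡ antidiagonal g n
  antidiagonal-cong f≡g zero    = f≡g 0 0
  antidiagonal-cong f≡g (suc n) = cong₂ _+_ (f≡g 0 (suc n)) (antidiagonal-cong (λ j l → f≡g (suc j) l) n)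

  antidiagonal-+ : ∀ f g n → antidiagonal (λ j l → f j l + g j l) n ≡ antidiagonal f n + antidiagonal g n
  antidiagonal-+ f g zero    = refl
  antidiagonal-+ f g (suc n) = trans (cong (f 0 (suc n) + g 0 (suc n) +_) (antidiagonal-+ (λ j → f (suc j)) (λ j → g (suc j)) n))
    (solve 4 (λ x y u v → (x :+ y) :+ (u :+ v) := (x :+ u) :+ (y :+ v)) refl (f 0 (suc n)) (g 0 (suc n)) _ _)

  -- On an antidiagonal `j + l` is constantly `n`, so a weight depending on `j + l` alone is a
  -- common factor.
  antidiagonal-weighted : ∀ w f n → antidiagonal (λ j l → w (j ℕ.+ l) * f j l) n ≡ w n * antidiagonal f n
  antidiagonal-weighted w f zero    = refl
  antidiagonal-weighted w f (suc n) = trans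
    (cong (w (suc n) * f 0 (suc n) +_) (antidiagonal-weighted (λ k → w (suc k)) (λ j → f (suc j)) n))
    (sym (*-distribˡ-+ (w (suc n)) (f 0 (suc n)) _))

  -- The recursion of `antidiagonal` peels off row 0. Lowering the second index in `term-+` requires
  -- peeling off column 0 instead.
  antidiagonal-snoc : ∀ f n → antidiagonal f (suc n) ≡ antidiagonal (λ j l → f j (suc l)) n + f (suc n) 0
  antidiagonal-snoc f zero    = refl
  antidiagonal-snoc f (suc n) = trans (cong (f 0 (suc (suc n)) +_) (antidiagonal-snoc (λ j → f (suc j)) n))
    (sym (+-assoc (f 0 (suc (suc n))) _ _))

  private
    row-tail : ∀ {a c} → 0ℚ ≤ c → ∀ {M N} → M ℕ.≤ N → (∀ l → M ℕ.≤ l → ∣ a l ∣ ≤ c) → ∣ Σℚ a N - Σℚ a M ∣ ≤ ιₙ N * c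
    row-tail {a} {c} 0≤c {N = N} ℕ.z≤n a≤ = subst (_≤ ιₙ N * c) (cong ∣_∣ (sym (+-identityʳ (Σℚ a N))))
      (∣Σ∣≤ 0≤c (λ n → a≤ n ℕ.z≤n) N)
    row-tail {a} {c} 0≤c {suc M} {suc N} (ℕ.s≤s M≤N) a≤ = ≤-trans
      (subst (_≤ ιₙ N * c) (cong ∣_∣ (solve 3 (λ a x y → x :- y := (a :+ x) :- (a :+ y)) refl (a 0) _ _))
        (row-tail 0≤c M≤N (λ l M≤l → a≤ (suc l) (ℕ.s≤s M≤l))))
      (*-monoʳ-≤-nonNeg c {{nonNegative 0≤c}} (ιₙ-mono (ℕₚ.n≤1+n N)))

  triangle-suc : ∀ f M → Σℚ (antidiagonal f) (suc M) ≡ Σℚ (f 0) (suc M) + Σℚ (antidiagonal (λ j → f (suc j))) M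
  triangle-suc f M = trans (cong (f 0 0 +_) (Σ-+ (λ n → f 0 (suc n)) (antidiagonal (λ j → f (suc j))) M))
    (sym (+-assoc (f 0 0) _ _))

  -- Row 0 has at most `N` entries outside the triangle `j + l < M`, all of size at most `c`. The
  -- remaining rows keep their length while the triangle shrinks, so the induction needs a rectangle
  -- even though only squares are used later.
  rect-triangle : ∀ {f c} → 0ℚ ≤ c → ∀ {M N} → M ℕ.≤ N → (∀ j l → M ℕ.≤ j ℕ.+ l → ∣ f j l ∣ ≤ c) →
    ∣ rect f M N - Σℚ (antidiagonal f) M ∣ ≤ ιₙ M * (ιₙ N * c)
  rect-triangle {c = c} 0≤c {zero} {N} _ f≤ = ≤-reflexive (sym (*-zeroˡ (ιₙ N * c)))
  rect-triangle {f} {c} 0≤c {suc M} {N} M<N f≤ = subst₂ _≤_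
    (cong ∣_∣ (trans (solve 4 (λ a b x y → (a :- b) :+ (x :- y) := (a :+ x) :- (b :+ y)) refl (Σℚ (f 0) N) (Σℚ (f 0) (suc M)) (rect (λ j → f (suc j)) M N) (Σℚ (antidiagonal (λ j → f (suc j))) M))
      (cong (λ z → rect f (suc M) N - z) (sym (triangle-suc f M)))))
    (trans (solve 2 (λ m x → x :+ m :* x := (con 1ℚ :+ m) :* x) refl (ιₙ M) (ιₙ N * c)) (cong (_* (ιₙ N * c)) (sym (ιₙ-suc M))))
    (≤-trans (∣p+q∣≤∣p∣+∣q∣ (Σℚ (f 0) N - Σℚ (f 0) (suc M)) (rect (λ j → f (suc j)) M N - Σℚ (antidiagonal (λ j → f (suc j))) M))
      (+-mono-≤ (row-tail 0≤c M<N (λ l → f≤ 0 l))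
        (rect-triangle 0≤c (ℕₚ.<⇒≤ M<N) (λ j l M≤ → f≤ (suc j) l (ℕ.s≤s M≤)))))

  rect-product : ∀ a b M N → rect (λ j l → a j * b l) M N ≡ Σℚ a M * Σℚ b N
  rect-product a b zero    N = sym (*-zeroˡ (Σℚ b N))
  rect-product a b (suc M) N = trans (cong₂ _+_ (Σ-*ˡ (a 0) b N) (rect-product (λ j → a (suc j)) b M N))
    (sym (*-distribʳ-+ (Σℚ b N) (a 0) _))

  rect-+ : ∀ f g M N → rect (λ j l → f j l + g j l) M N ≡ rect f M N + rect g M N
  rect-+ f g M N = trans (Σ-cong (λ j → Σ-+ (f j) (g j) N) M) (Σ-+ (λ j → Σℚ (f j) N) (λ j → Σℚ (g j) N) M)

  rect-cong : ∀ {f g} → (∀ j l → f j l ≡ g j l) → ∀ M N → rect f M N ≡ rect g M N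
  rect-cong f≡g M N = Σ-cong (λ j → Σ-cong (f≡g j) N) M

  -- (n + 1) q^(n+1)/(n+1)! = q · q^n/n!, which drives the binomial theorem below.
  term-suc : ∀ q n → ιₙ (suc n) * term q (suc n) ≡ q * term q n
  term-suc q n = trans (solve 4 (λ i f q p → i :* (f :* (q :* p)) := q :* ((i :* f) :* p)) refl (ιₙ (suc n)) (1/ suc n !) q (q ^ n))
    (cong (λ z → q * (z * q ^ n)) (sym (1/!-suc n)))

  -- The binomial theorem in divided form, without binomial coefficients. After multiplication by
  -- `n + 1 = j + l`, the summand `j` lowers the index of the first factor and `l` that of the
  -- second, by `term-suc`: a discrete product rule, which yields `(q + r)` times the previous
  -- antidiagonal.
  term-+ : ∀ q r n → antidiagonal (λ j l → term q j * term r l) n ≡ term (q + r) n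
  term-+ q r zero    = refl
  term-+ q r (suc n) = cancel (begin
    ιₙ (suc n) * antidiagonal T (suc n)
      ≡⟨ antidiagonal-weighted ιₙ T (suc n) ⟨
    antidiagonal (λ j l → ιₙ (j ℕ.+ l) * T j l) (suc n)
      ≡⟨ antidiagonal-cong (λ j l → trans (cong (_* T j l) (ιₙ-+ j l)) (solve 4 (λ a b x y → (a :+ b) :* (x :* y) := (a :* x) :* y :+ x :* (b :* y)) refl (ιₙ j) (ιₙ l) (term q j) (term r l))) (suc n) ⟩
    antidiagonal (λ j l → ιₙ j * term q j * term r l + term q j * (ιₙ l * term r l)) (suc n)
      ≡⟨ antidiagonal-+ (λ j l → ιₙ j * term q j * term r l) (λ j l → term q j * (ιₙ l * term r l)) (suc n) ⟩
    antidiagonal (λ j l → ιₙ j * term q j * term r l) (suc n) + antidiagonal (λ j l → term q j * (ιₙ l * term r l)) (suc n)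
      ≡⟨ cong₂ _+_ left right ⟩
    q * antidiagonal T n + r * antidiagonal T n
      ≡⟨ *-distribʳ-+ (antidiagonal T n) q r ⟨
    (q + r) * antidiagonal T n
      ≡⟨ cong ((q + r) *_) (term-+ q r n) ⟩
    (q + r) * term (q + r) n
      ≡⟨ term-suc (q + r) n ⟨
    ιₙ (suc n) * term (q + r) (suc n) ∎)
    where
    open ≡-Reasoning
    T : ℕ → ℕ → ℚ
    T j l = term q j * term r l
    left : antidiagonal (λ j l → ιₙ j * term q j * term r l) (suc n) ≡ q * antidiagonal T n
    left = begin
      0ℚ * term q 0 * term r (suc n) + antidiagonal (λ j l → ιₙ (suc j) * term q (suc j) * term r l) n
        ≡⟨ cong₂ _+_ (solve 2 (λ x y → con 0ℚ :* x :* y := con 0ℚ) refl (term q 0) (term r (suc n)))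
             (antidiagonal-cong (λ j l → trans (cong (_* term r l) (term-suc q j)) (*-assoc q (term q j) (term r l))) n) ⟩
      0ℚ + antidiagonal (λ j l → q * T j l) n  ≡⟨ +-identityˡ _ ⟩
      antidiagonal (λ j l → q * T j l) n       ≡⟨ antidiagonal-weighted (λ _ → q) T n ⟩
      q * antidiagonal T n                     ∎
    right : antidiagonal (λ j l → term q j * (ιₙ l * term r l)) (suc n) ≡ r * antidiagonal T n
    right = begin
      antidiagonal (λ j l → term q j * (ιₙ l * term r l)) (suc n)
        ≡⟨ antidiagonal-snoc (λ j l → term q j * (ιₙ l * term r l)) n ⟩
      antidiagonal (λ j l → term q j * (ιₙ (suc l) * term r (suc l))) n + term q (suc n) * (0ℚ * term r 0)
        ≡⟨ cong₂ _+_ (antidiagonal-cong (λ j l → trans (cong (term q j *_) (term-suc r l)) (solve 3 (λ x r y → x :* (r :* y) := r :* (x :* y)) refl (term q j) r (term r l))) n)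
             (solve 2 (λ x y → x :* (con 0ℚ :* y) := con 0ℚ) refl (term q (suc n)) (term r 0)) ⟩
      antidiagonal (λ j l → r * T j l) n + 0ℚ  ≡⟨ +-identityʳ _ ⟩
      antidiagonal (λ j l → r * T j l) n       ≡⟨ antidiagonal-weighted (λ _ → r) T n ⟩
      r * antidiagonal T n                     ∎
    cancel : ∀ {x y} → ιₙ (suc n) * x ≡ ιₙ (suc n) * y → x ≡ y
    cancel {x} {y} eq = trans (sym (inv x)) (trans (cong ((ℤ.+ 1 / suc n) *_) eq) (inv y))
      where
      inv : ∀ x → (ℤ.+ 1 / suc n) * (ιₙ (suc n) * x) ≡ x
      inv x = trans (sym (*-assoc (ℤ.+ 1 / suc n) (ιₙ (suc n)) x)) (trans (cong (_* x) (1/-* (suc n))) (*-identityˡ x))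

  -- The weight depends only on `j + l`, so the triangle collapses to the terms of `q + r`. The
  -- square has at most `N²` further entries, each at most `K² (½ᴺ)³`, and `N ½ᴺ ≤ 1` is applied
  -- twice.
  weighted-addition : ∀ w → (∀ n → ∣ w n ∣ ≤ 1ℚ) → ∀ {q r} b → ∣ q ∣ ≤ ιₙ b → ∣ r ∣ ≤ ιₙ b → ∀ N →
    ∣ rect (λ j l → w (j ℕ.+ l) * (term q j * term r l)) N N - Σℚ (λ n → w n * term (q + r) n) N ∣
      ≤ termBound b * termBound b * ½^ N
  weighted-addition w w≤1 {q} {r} b q≤b r≤b N = ≤-trans
    (subst (λ z → ∣ rect F N N - z ∣ ≤ ιₙ N * (ιₙ N * c))
      (Σ-cong (λ n → trans (antidiagonal-weighted w (λ j l → term q j * term r l) n) (cong (w n *_) (term-+ q r n))) N)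
      (rect-triangle {F} 0≤c {N} {N} ℕₚ.≤-refl F≤))
    (begin
      ιₙ N * (ιₙ N * (K * K * (½^ N * ½^ N * ½^ N)))
        ≡⟨ solve 3 (λ i k h → i :* (i :* (k :* k :* (h :* h :* h))) := (k :* k :* h) :* ((i :* h) :* (i :* h))) refl (ιₙ N) K (½^ N) ⟩
      K * K * ½^ N * (ιₙ N * ½^ N * (ιₙ N * ½^ N))
        ≤⟨ *-monoˡ-≤-nonNeg (K * K * ½^ N) {{nonNegative (*-nonneg 0≤KK (½^-nonneg N))}} (*-mono 0≤nh (n*½^≤1 N) 0≤nh (n*½^≤1 N)) ⟩
      K * K * ½^ N * (1ℚ * 1ℚ)
        ≡⟨ *-identityʳ (K * K * ½^ N) ⟩
      K * K * ½^ N ∎)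
    where
    open ≤-Reasoning
    K : ℚ
    K = termBound b
    F : ℕ → ℕ → ℚ
    F j l = w (j ℕ.+ l) * (term q j * term r l)
    c : ℚ
    c = K * K * (½^ N * ½^ N * ½^ N)
    0≤KK : 0ℚ ≤ K * K
    0≤KK = *-nonneg (termBound-nonneg b) (termBound-nonneg b)
    0≤c : 0ℚ ≤ c
    0≤c = *-nonneg 0≤KK (*-nonneg (*-nonneg (½^-nonneg N) (½^-nonneg N)) (½^-nonneg N))
    0≤nh : 0ℚ ≤ ιₙ N * ½^ N
    0≤nh = *-nonneg {ιₙ N} (nonNegative⁻¹ _ {{ιₙ-nonNeg N}}) (½^-nonneg N)
    ½^-+ : ∀ m n → ½^ m * ½^ n ≡ ½^ (m ℕ.+ n)
    ½^-+ zero    n = *-identityˡ (½^ n)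
    ½^-+ (suc m) n = trans (*-assoc ½ (½^ m) (½^ n)) (cong (½ *_) (½^-+ m n))
    F≤ : ∀ j l → N ℕ.≤ j ℕ.+ l → ∣ F j l ∣ ≤ c
    F≤ j l N≤ = begin
      ∣ w (j ℕ.+ l) * (term q j * term r l) ∣           ≡⟨ ∣p*q∣≡∣p∣*∣q∣ (w (j ℕ.+ l)) (term q j * term r l) ⟩
      ∣ w (j ℕ.+ l) ∣ * ∣ term q j * term r l ∣         ≤⟨ *-monoʳ-≤-nonNeg ∣ term q j * term r l ∣ {{∣-∣-nonNeg (term q j * term r l)}} (w≤1 (j ℕ.+ l)) ⟩
      1ℚ * ∣ term q j * term r l ∣                      ≡⟨ *-identityˡ _ ⟩
      ∣ term q j * term r l ∣                           ≡⟨ ∣p*q∣≡∣p∣*∣q∣ (term q j) (term r l) ⟩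
      ∣ term q j ∣ * ∣ term r l ∣                       ≤⟨ *-mono (0≤∣p∣ (term q j)) (∣term∣≤ b q≤b j) (0≤∣p∣ (term r l)) (∣term∣≤ b r≤b l) ⟩
      K * (½^ j * ½^ j * ½^ j) * (K * (½^ l * ½^ l * ½^ l))
        ≡⟨ solve 3 (λ k x y → k :* (x :* x :* x) :* (k :* (y :* y :* y)) := k :* k :* ((x :* y) :* (x :* y) :* (x :* y))) refl K (½^ j) (½^ l) ⟩
      K * K * (½^ j * ½^ l * (½^ j * ½^ l) * (½^ j * ½^ l))
        ≤⟨ *-monoˡ-≤-nonNeg (K * K) {{nonNegative 0≤KK}} (*-mono (*-nonneg 0≤h 0≤h) (*-mono 0≤h h≤ 0≤h h≤) 0≤h h≤) ⟩
      c ∎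
      where
      0≤h : 0ℚ ≤ ½^ j * ½^ l
      0≤h = *-nonneg (½^-nonneg j) (½^-nonneg l)
      h≤ : ½^ j * ½^ l ≤ ½^ N
      h≤ = subst (_≤ ½^ N) (sym (½^-+ j l)) (½^-antitone N≤)

  -- κ n + i σ n = iⁿ
  κ σ : ℕ → ℚ
  κ zero    = 1ℚ
  κ (suc n) = - σ n
  σ zero    = 0ℚ
  σ (suc n) = κ n

  ∣κ∣≤1 : ∀ n → ∣ κ n ∣ ≤ 1ℚ
  ∣σ∣≤1 : ∀ n → ∣ σ n ∣ ≤ 1ℚ
  ∣κ∣≤1 zero    = ≤-refl
  ∣κ∣≤1 (suc n) = subst (_≤ 1ℚ) (sym (∣-p∣≡∣p∣ (σ n))) (∣σ∣≤1 n)
  ∣σ∣≤1 zero    = <⇒≤ (positive⁻¹ 1ℚ)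
  ∣σ∣≤1 (suc n) = ∣κ∣≤1 n

  κ-+ : ∀ j l → κ (j ℕ.+ l) ≡ κ j * κ l - σ j * σ l
  σ-+ : ∀ j l → σ (j ℕ.+ l) ≡ σ j * κ l + κ j * σ l
  κ-+ zero l    = solve 2 (λ c s → c := con 1ℚ :* c :- con 0ℚ :* s) refl (κ l) (σ l)
  κ-+ (suc j) l = trans (cong -_ (σ-+ j l))
    (solve 4 (λ s c a b → :- (s :* a :+ c :* b) := (:- s) :* a :- c :* b) refl (σ j) (κ j) (κ l) (σ l))
  σ-+ zero l    = solve 2 (λ c s → s := con 0ℚ :* c :+ con 1ℚ :* s) refl (κ l) (σ l)
  σ-+ (suc j) l = trans (κ-+ j l)
    (solve 4 (λ s c a b → c :* a :- s :* b := c :* a :+ (:- s) :* b) refl (σ j) (κ j) (κ l) (σ l))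

  cosSum sinSum : ℚ → ℕ → ℚ
  cosSum q = Σℚ (λ n → κ n * term q n)
  sinSum q = Σℚ (λ n → σ n * term q n)

  private
    ∣weighted∣≤ : ∀ (w : ℕ → ℚ) → (∀ n → ∣ w n ∣ ≤ 1ℚ) → ∀ {q} b → ∣ q ∣ ≤ ιₙ b → ∀ n → ∣ w n * term q n ∣ ≤ termBound b * ½^ n
    ∣weighted∣≤ w w≤1 {q} b q≤b n = begin
      ∣ w n * term q n ∣       ≡⟨ ∣p*q∣≡∣p∣*∣q∣ (w n) (term q n) ⟩
      ∣ w n ∣ * ∣ term q n ∣   ≤⟨ *-mono (0≤∣p∣ (w n)) (w≤1 n) (0≤∣p∣ (term q n)) (∣term∣≤ b q≤b n) ⟩
      1ℚ * (termBound b * (½^ n * ½^ n * ½^ n)) ≡⟨ *-identityˡ _ ⟩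
      termBound b * (½^ n * ½^ n * ½^ n)
        ≤⟨ *-monoˡ-≤-nonNeg (termBound b) {{nonNegative (termBound-nonneg b)}}
             (*-mono (*-nonneg (½^-nonneg n) (½^-nonneg n))
               (*-mono (½^-nonneg n) (½^-≤1 n) (½^-nonneg n) ≤-refl) (½^-nonneg n) (½^-≤1 n)) ⟩
      termBound b * (1ℚ * ½^ n * 1ℚ)  ≡⟨ cong (termBound b *_) (solve 1 (λ h → con 1ℚ :* h :* con 1ℚ := h) refl (½^ n)) ⟩
      termBound b * ½^ n              ∎
      where open ≤-Reasoning

  -- The bound depends on `b` but not on `q`. This uniformity allows the point of evaluation to vary
  -- along a Cauchy sequence.
  weighted-cauchy : ∀ (w : ℕ → ℚ) → (∀ n → ∣ w n ∣ ≤ 1ℚ) → ∀ {q} b → ∣ q ∣ ≤ ιₙ b → ∀ m n → m ℕ.≤ n →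
    ∣ Σℚ (λ j → w j * term q j) n - Σℚ (λ j → w j * term q j) m ∣ ≤ (termBound b + termBound b) * ½^ m
  weighted-cauchy w w≤1 b q≤b = Σ-geometric-cauchy (termBound-nonneg b) (∣weighted∣≤ w w≤1 b q≤b)

  -- The real part of `iʲ⁺ˡ = iʲ iˡ` splits the weighted square into two products of sums;
  -- `weighted-addition` bounds its distance from the truncation at `q + r`.
  cosSum-+ : ∀ {q r} b → ∣ q ∣ ≤ ιₙ b → ∣ r ∣ ≤ ιₙ b → ∀ N →
    ∣ (cosSum q N * cosSum r N - sinSum q N * sinSum r N) - cosSum (q + r) N ∣ ≤ termBound b * termBound b * ½^ N
  cosSum-+ {q} {r} b q≤b r≤b N = subst (λ z → ∣ z - cosSum (q + r) N ∣ ≤ termBound b * termBound b * ½^ N) split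
    (weighted-addition κ ∣κ∣≤1 b q≤b r≤b N)
    where
    open ≡-Reasoning
    split : rect (λ j l → κ (j ℕ.+ l) * (term q j * term r l)) N N ≡ cosSum q N * cosSum r N - sinSum q N * sinSum r N
    split = begin
      rect (λ j l → κ (j ℕ.+ l) * (term q j * term r l)) N N
        ≡⟨ rect-cong (λ j l → trans (cong (_* (term q j * term r l)) (κ-+ j l))
             (solve 6 (λ a b c d x y → (a :* b :- c :* d) :* (x :* y) := (a :* x) :* (b :* y) :+ (:- (c :* x)) :* (d :* y)) refl
               (κ j) (κ l) (σ j) (σ l) (term q j) (term r l))) N N ⟩
      rect (λ j l → κ j * term q j * (κ l * term r l) + (- (σ j * term q j)) * (σ l * term r l)) N N
        ≡⟨ rect-+ (λ j l → κ j * term q j * (κ l * term r l)) (λ j l → (- (σ j * term q j)) * (σ l * term r l)) N N ⟩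
      rect (λ j l → κ j * term q j * (κ l * term r l)) N N + rect (λ j l → (- (σ j * term q j)) * (σ l * term r l)) N N
        ≡⟨ cong₂ _+_ (rect-product (λ j → κ j * term q j) (λ l → κ l * term r l) N N)
             (trans (rect-product (λ j → - (σ j * term q j)) (λ l → σ l * term r l) N N)
               (cong (_* sinSum r N) (trans (Σ-cong (λ j → solve 1 (λ x → :- x := con (- 1ℚ) :* x) refl (σ j * term q j)) N) (Σ-*ˡ (- 1ℚ) (λ j → σ j * term q j) N)))) ⟩
      cosSum q N * cosSum r N + - 1ℚ * sinSum q N * sinSum r N
        ≡⟨ solve 3 (λ a s t → a :+ con (- 1ℚ) :* s :* t := a :- s :* t) refl (cosSum q N * cosSum r N) (sinSum q N) (sinSum r N) ⟩
      cosSum q N * cosSum r N - sinSum q N * sinSum r N ∎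

  sinSum-+ : ∀ {q r} b → ∣ q ∣ ≤ ιₙ b → ∣ r ∣ ≤ ιₙ b → ∀ N →
    ∣ (sinSum q N * cosSum r N + cosSum q N * sinSum r N) - sinSum (q + r) N ∣ ≤ termBound b * termBound b * ½^ N
  sinSum-+ {q} {r} b q≤b r≤b N = subst (λ z → ∣ z - sinSum (q + r) N ∣ ≤ termBound b * termBound b * ½^ N) split
    (weighted-addition σ ∣σ∣≤1 b q≤b r≤b N)
    where
    open ≡-Reasoning
    split : rect (λ j l → σ (j ℕ.+ l) * (term q j * term r l)) N N ≡ sinSum q N * cosSum r N + cosSum q N * sinSum r N
    split = begin
      rect (λ j l → σ (j ℕ.+ l) * (term q j * term r l)) N N
        ≡⟨ rect-cong (λ j l → trans (cong (_* (term q j * term r l)) (σ-+ j l))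
             (solve 6 (λ a b c d x y → (c :* b :+ a :* d) :* (x :* y) := (c :* x) :* (b :* y) :+ (a :* x) :* (d :* y)) refl
               (κ j) (κ l) (σ j) (σ l) (term q j) (term r l))) N N ⟩
      rect (λ j l → σ j * term q j * (κ l * term r l) + κ j * term q j * (σ l * term r l)) N N
        ≡⟨ rect-+ (λ j l → σ j * term q j * (κ l * term r l)) (λ j l → κ j * term q j * (σ l * term r l)) N N ⟩
      rect (λ j l → σ j * term q j * (κ l * term r l)) N N + rect (λ j l → κ j * term q j * (σ l * term r l)) N N
        ≡⟨ cong₂ _+_ (rect-product (λ j → σ j * term q j) (λ l → κ l * term r l) N N)
             (rect-product (λ j → κ j * term q j) (λ l → σ l * term r l) N N) ⟩
      sinSum q N * cosSum r N + cosSum q N * sinSum r N ∎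

-- Cosine and sine polynomials on [-2, 2] and the roots of the cosine polynomials.

module TrigonometricPolynomials where
  open import Algebra.Bundles using (CommutativeRing)
  import Algebra.Properties.CommutativeSemiring.Exp as Exp
  open import Data.Integer as ℤ using (ℤ)
  open import Data.Nat as ℕ using (ℕ; zero; suc; _!)
  import Data.Nat.Properties as ℕₚ
  open import Data.Product using (∃-syntax; _×_; _,_; proj₁; proj₂)
  open import Data.Rational hiding (truncate; floor; 1/_)
  open import Data.Rational.Properties
  open import Data.Rational.Solver using (module +-*-Solver)
  open import Data.Sum using (inj₁; inj₂)
  open import Relation.Binary.PropositionalEquality
  open import Relation.Nullary using (yes; no)
  open import Defs using (1/_!)
  open RationalArithmetic
  open ExponentialTerms
  open +-*-Solver

  -- Each step exposes two successors, so a sum of length `double (suc m)` unfolds into a pair of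
  -- terms and a shorter sum.
  double : ℕ → ℕ
  double zero    = zero
  double (suc m) = suc (suc (double m))

  n≤double : ∀ n → n ℕ.≤ double n
  n≤double zero    = ℕ.z≤n
  n≤double (suc n) = ℕ.s≤s (ℕₚ.≤-trans (n≤double n) (ℕₚ.n≤1+n _))

  double-mono : ∀ {m n} → m ℕ.≤ n → double m ℕ.≤ double n
  double-mono ℕ.z≤n       = ℕ.z≤n
  double-mono (ℕ.s≤s m≤n) = ℕ.s≤s (ℕ.s≤s (double-mono m≤n))

  -- An even length gives both polynomials exactly `m` terms that survive the weights, and the
  -- common length is what the addition theorems need.
  cosPoly sinPoly : ℕ → ℚ → ℚ
  cosPoly m q = cosSum q (double m)
  sinPoly m q = sinSum q (double m)

  sign : ℕ → ℚ
  sign j = (- 1ℚ) ^ j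

  -- a 0 - a 1 + a 2 - ⋯ ± a (m - 1)
  alternating : (ℕ → ℚ) → ℕ → ℚ
  alternating a zero    = 0ℚ
  alternating a (suc m) = a 0 - alternating (λ j → a (suc j)) m

  -- Leibniz's estimate: by induction the tail lies between 0 and `a 1`, and `a 1 ≤ a 0`.
  alternating-bounds : ∀ {a} → (∀ n → 0ℚ ≤ a n) → (∀ n → a (suc n) ≤ a n) →
    ∀ m → 0ℚ ≤ alternating a m × alternating a m ≤ a 0
  alternating-bounds 0≤a a↓ zero = ≤-refl , 0≤a 0
  alternating-bounds {a} 0≤a a↓ (suc m) =
    let 0≤A , A≤a₁ = alternating-bounds {λ j → a (suc j)} (λ n → 0≤a (suc n)) (λ n → a↓ (suc n)) m
    in 0≤q-p (≤-trans A≤a₁ (a↓ 0))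
     , ≤-by (alternating (λ j → a (suc j)) m) 0≤A (solve 2 (λ a x → (a :- x) :+ x := a) refl (a 0) _)

  alternating-cong : ∀ {a b} → (∀ n → a n ≡ b n) → ∀ m → alternating a m ≡ alternating b m
  alternating-cong a≡b zero    = refl
  alternating-cong a≡b (suc m) = cong₂ _-_ (a≡b 0) (alternating-cong (λ n → a≡b (suc n)) m)

  alternating-*ˡ : ∀ c a m → alternating (λ n → c * a n) m ≡ c * alternating a m
  alternating-*ˡ c a zero    = sym (*-zeroʳ c)
  alternating-*ˡ c a (suc m) = trans (cong (λ z → c * a 0 - z) (alternating-*ˡ c (λ n → a (suc n)) m))
    (solve 3 (λ c a x → c :* a :- c :* x := c :* (a :- x)) refl c (a 0) _)

  Σ-sign : ∀ a m → Σℚ (λ j → sign j * a j) m ≡ alternating a m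
  Σ-sign a zero    = refl
  Σ-sign a (suc m) = cong₂ _+_ (*-identityˡ (a 0)) (begin
    Σℚ (λ j → - 1ℚ * sign j * a (suc j)) m        ≡⟨ Σ-cong (λ j → *-assoc (- 1ℚ) (sign j) (a (suc j))) m ⟩
    Σℚ (λ j → - 1ℚ * (sign j * a (suc j))) m      ≡⟨ Σ-*ˡ (- 1ℚ) (λ j → sign j * a (suc j)) m ⟩
    - 1ℚ * Σℚ (λ j → sign j * a (suc j)) m        ≡⟨ cong (- 1ℚ *_) (Σ-sign (λ j → a (suc j)) m) ⟩
    - 1ℚ * alternating (λ j → a (suc j)) m        ≡⟨ solve 1 (λ x → con (- 1ℚ) :* x := :- x) refl (alternating (λ j → a (suc j)) m) ⟩
    - alternating (λ j → a (suc j)) m             ∎)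
    where open ≡-Reasoning

  Σ-double : ∀ a m → Σℚ a (double m) ≡ Σℚ (λ j → a (double j) + a (suc (double j))) m
  Σ-double a zero    = refl
  Σ-double a (suc m) = trans (sym (+-assoc (a 0) (a 1) _)) (cong (a 0 + a 1 +_) (Σ-double (λ n → a (suc (suc n))) m))

  κ-double : ∀ j → κ (double j) ≡ sign j
  κ-double zero    = refl
  κ-double (suc j) = trans (cong -_ (κ-double j)) (solve 1 (λ x → :- x := con (- 1ℚ) :* x) refl (sign j))

  σ-double : ∀ j → σ (double j) ≡ 0ℚ
  σ-double zero    = refl
  σ-double (suc j) = cong -_ (σ-double j)

  ^-double : ∀ q j → q ^ double j ≡ (q * q) ^ j
  ^-double q zero    = refl
  ^-double q (suc j) = trans (sym (*-assoc q q _)) (cong (q * q *_) (^-double q j))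

  cosPoly-Σ : ∀ m q → cosPoly m q ≡ Σℚ (λ j → sign j * term q (double j)) m
  cosPoly-Σ m q = trans (Σ-double (λ n → κ n * term q n) m)
    (Σ-cong (λ j → trans (cong₂ (λ x y → x * term q (double j) + - y * term q (suc (double j))) (κ-double j) (σ-double j))
      (solve 2 (λ x y → x :+ (:- con 0ℚ) :* y := x) refl (sign j * term q (double j)) (term q (suc (double j))))) m)

  sinPoly-Σ : ∀ m q → sinPoly m q ≡ Σℚ (λ j → sign j * term q (suc (double j))) m
  sinPoly-Σ m q = trans (Σ-double (λ n → σ n * term q n) m)
    (Σ-cong (λ j → trans (cong₂ (λ x y → x * term q (double j) + y * term q (suc (double j))) (σ-double j) (κ-double j))
      (solve 2 (λ x y → con 0ℚ :* x :+ y := y) refl (term q (double j)) (sign j * term q (suc (double j))))) m)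

  -- The variable `u` stands for `q²`. The second family belongs to `sin q / q`, so that a negative
  -- `q` does not disturb the signs of the alternating sum.
  cosCoeff sincCoeff : ℚ → ℕ → ℚ
  cosCoeff  u j = 1/ double j ! * u ^ j
  sincCoeff u j = 1/ suc (double j) ! * u ^ j

  cosPoly-alternating : ∀ m q → cosPoly m q ≡ alternating (cosCoeff (q * q)) m
  cosPoly-alternating m q = trans (cosPoly-Σ m q) (trans (Σ-sign (λ j → term q (double j)) m)
    (alternating-cong (λ j → cong (1/ double j ! *_) (^-double q j)) m))

  sinPoly-alternating : ∀ m q → sinPoly m q ≡ q * alternating (sincCoeff (q * q)) m
  sinPoly-alternating m q = trans (sinPoly-Σ m q) (trans (Σ-sign (λ j → term q (suc (double j))) m)
    (trans (alternating-cong (λ j → trans (cong (λ z → 1/ suc (double j) ! * (q * z)) (^-double q j))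
        (solve 3 (λ a b c → a :* (b :* c) := b :* (a :* c)) refl (1/ suc (double j) !) q ((q * q) ^ j))) m)
      (alternating-*ˡ q (sincCoeff (q * q)) m)))

  private
    square-neg : ∀ q → - q * - q ≡ q * q
    square-neg = solve 1 (λ q → (:- q) :* (:- q) := q :* q) refl

  cosPoly-neg : ∀ m q → cosPoly m (- q) ≡ cosPoly m q
  cosPoly-neg m q = trans (cosPoly-alternating m (- q))
    (trans (cong (λ u → alternating (cosCoeff u) m) (square-neg q)) (sym (cosPoly-alternating m q)))

  sinPoly-neg : ∀ m q → sinPoly m (- q) ≡ - sinPoly m q
  sinPoly-neg m q = trans (sinPoly-alternating m (- q))
    (trans (cong (λ u → - q * alternating (sincCoeff u) m) (square-neg q))
      (trans (sym (neg-distribˡ-* q _)) (cong -_ (sym (sinPoly-alternating m q)))))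

  -- The quotient of the two sides is `u / ((n + 1) (n + 2))`.
  coeff-decreasing : ∀ {u} n k → 0ℚ ≤ u → u ≤ ιₙ (suc n ℕ.* suc (suc n)) →
    1/ suc (suc n) ! * u ^ suc k ≤ 1/ n ! * u ^ k
  coeff-decreasing {u} n k 0≤u u≤ = begin
    c * (u * u ^ k)                                ≡⟨ solve 3 (λ c u x → c :* (u :* x) := u :* (c :* x)) refl c u (u ^ k) ⟩
    u * (c * u ^ k)                                ≤⟨ *-monoʳ-≤-nonNeg (c * u ^ k) {{nonNegative (*-nonneg (1/!-nonneg (suc (suc n))) (^-nonneg 0≤u k))}} u≤ ⟩
    ιₙ (suc n ℕ.* suc (suc n)) * (c * u ^ k)       ≡⟨ cong (_* (c * u ^ k)) (ιₙ-* (suc n) (suc (suc n))) ⟩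
    ιₙ (suc n) * ιₙ (suc (suc n)) * (c * u ^ k)    ≡⟨ solve 4 (λ a b c x → a :* b :* (c :* x) := a :* (b :* c) :* x) refl (ιₙ (suc n)) (ιₙ (suc (suc n))) c (u ^ k) ⟩
    ιₙ (suc n) * (ιₙ (suc (suc n)) * c) * u ^ k    ≡⟨ cong (λ z → ιₙ (suc n) * z * u ^ k) (1/!-suc (suc n)) ⟨
    ιₙ (suc n) * 1/ suc n ! * u ^ k                ≡⟨ cong (_* u ^ k) (1/!-suc n) ⟨
    1/ n ! * u ^ k                                 ∎
    where
    open ≤-Reasoning
    c : ℚ
    c = 1/ suc (suc n) !

  ⅓ : ℚ
  ⅓ = ℤ.+ 1 / 3

  private
    coeff-nonneg : ∀ {u} n k → 0ℚ ≤ u → 0ℚ ≤ 1/ n ! * u ^ k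
    coeff-nonneg n k 0≤u = *-nonneg (1/!-nonneg n) (^-nonneg 0≤u k)

    4≤ : ∀ n → ιₙ 4 ≤ ιₙ (suc (suc n) ℕ.* suc (suc (suc n)))
    4≤ n = ιₙ-mono (ℕₚ.≤-trans (ℕₚ.m≤m+n 4 2) (ℕₚ.*-mono-≤ {2} {suc (suc n)} {3} {suc (suc (suc n))} (ℕ.s≤s (ℕ.s≤s ℕ.z≤n)) (ℕ.s≤s (ℕ.s≤s (ℕ.s≤s ℕ.z≤n)))))

  -- Leibniz's estimate from the second term on: the sum is at most 1 and at least `1 - u/6`, which
  -- is at least `1 - 4/6` for `u ≤ 4`.
  sinc-bounds : ∀ {u} → 0ℚ ≤ u → u ≤ ιₙ 4 → ∀ m →
    ⅓ ≤ alternating (sincCoeff u) (suc m) × alternating (sincCoeff u) (suc m) ≤ 1ℚ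
  sinc-bounds {u} 0≤u u≤4 m =
      ≤-by ((ιₙ 4 - u) * (ℤ.+ 1 / 6) + (sincCoeff u 1 - A))
        (+-nonneg (*-nonneg (0≤q-p u≤4) (<⇒≤ (positive⁻¹ (ℤ.+ 1 / 6)))) (0≤q-p (proj₂ A-bounds)))
        (solve 2 (λ u a → con ⅓ :+ ((con (ιₙ 4) :- u) :* con (ℤ.+ 1 / 6) :+ (con (1/ 3 !) :* (u :* con 1ℚ) :- a)) := con 1ℚ :- a) refl u A)
    , ≤-by A (proj₁ A-bounds) (solve 1 (λ a → con 1ℚ :- a :+ a := con 1ℚ) refl A)
    where
    A : ℚ
    A = alternating (λ j → sincCoeff u (suc j)) m
    A-bounds : 0ℚ ≤ A × A ≤ sincCoeff u 1
    A-bounds = alternating-bounds {λ j → sincCoeff u (suc j)} (λ n → coeff-nonneg (suc (double (suc n))) (suc n) 0≤u)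
      (λ n → coeff-decreasing (suc (double (suc n))) (suc n) 0≤u (≤-trans u≤4 (4≤ (double (suc n))))) m

  square≤4 : ∀ {t} → ∣ t ∣ ≤ ιₙ 2 → 0ℚ ≤ t * t × t * t ≤ ιₙ 4
  square≤4 {t} t≤2 = subst (0ℚ ≤_) eq (*-nonneg (0≤∣p∣ t) (0≤∣p∣ t)) , subst (_≤ ιₙ 4) eq (*-mono (0≤∣p∣ t) t≤2 (0≤∣p∣ t) t≤2)
    where
    eq : ∣ t ∣ * ∣ t ∣ ≡ t * t
    eq with ∣p∣≡p∨∣p∣≡-p t
    ... | inj₁ e = cong₂ _*_ e e
    ... | inj₂ e = trans (cong₂ _*_ e e) (square-neg t)

  -- Upper bounds on sine give a Lipschitz constant of cosine; the lower bounds with factor 1/3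
  -- below give the constant of its inverse. The successor excludes the empty sum, for which the
  -- lower bounds fail.
  ∣sinPoly∣≤ : ∀ m {t} → ∣ t ∣ ≤ ιₙ 2 → ∣ sinPoly (suc m) t ∣ ≤ ∣ t ∣
  ∣sinPoly∣≤ m {t} t≤2 = begin
    ∣ sinPoly (suc m) t ∣  ≡⟨ cong ∣_∣ (sinPoly-alternating (suc m) t) ⟩
    ∣ t * G ∣              ≡⟨ ∣p*q∣≡∣p∣*∣q∣ t G ⟩
    ∣ t ∣ * ∣ G ∣          ≡⟨ cong (∣ t ∣ *_) (0≤p⇒∣p∣≡p (≤-trans (<⇒≤ (positive⁻¹ ⅓)) (proj₁ G-bounds))) ⟩
    ∣ t ∣ * G              ≤⟨ *-monoˡ-≤-nonNeg ∣ t ∣ {{∣-∣-nonNeg t}} (proj₂ G-bounds) ⟩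
    ∣ t ∣ * 1ℚ             ≡⟨ *-identityʳ ∣ t ∣ ⟩
    ∣ t ∣                  ∎
    where
    open ≤-Reasoning
    G : ℚ
    G = alternating (sincCoeff (t * t)) (suc m)
    G-bounds : ⅓ ≤ G × G ≤ 1ℚ
    G-bounds = sinc-bounds (proj₁ (square≤4 t≤2)) (proj₂ (square≤4 t≤2)) m

  ≤sinPoly : ∀ m {t} → 0ℚ ≤ t → t ≤ ιₙ 2 → ⅓ * t ≤ sinPoly (suc m) t
  ≤sinPoly m {t} 0≤t t≤2 = subst (⅓ * t ≤_) (trans (*-comm G t) (sym (sinPoly-alternating (suc m) t)))
    (*-monoʳ-≤-nonNeg t {{nonNegative 0≤t}} (proj₁ (sinc-bounds (proj₁ t²) (proj₂ t²) m)))
    where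
    G : ℚ
    G = alternating (sincCoeff (t * t)) (suc m)
    t² : 0ℚ ≤ t * t × t * t ≤ ιₙ 4
    t² = square≤4 (subst (_≤ ιₙ 2) (sym (0≤p⇒∣p∣≡p 0≤t)) t≤2)

  ≤∣sinPoly∣ : ∀ m {t} → ∣ t ∣ ≤ ιₙ 2 → ⅓ * ∣ t ∣ ≤ ∣ sinPoly (suc m) t ∣
  ≤∣sinPoly∣ m {t} t≤2 with ∣p∣≡p∨∣p∣≡-p t
  ... | inj₁ e = subst (λ z → ⅓ * z ≤ ∣ sinPoly (suc m) t ∣) (sym e)
    (≤-trans (≤sinPoly m (subst (0ℚ ≤_) e (0≤∣p∣ t)) (subst (_≤ ιₙ 2) e t≤2)) (p≤∣p∣ _))
  ... | inj₂ e = subst (λ z → ⅓ * z ≤ ∣ sinPoly (suc m) t ∣) (sym e)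
    (≤-trans (≤sinPoly m (subst (0ℚ ≤_) e (0≤∣p∣ t)) (subst (_≤ ιₙ 2) e t≤2))
      (≤-trans (p≤∣p∣ _) (≤-reflexive (trans (cong ∣_∣ (sinPoly-neg (suc m) t)) (∣-p∣≡∣p∣ _)))))

  cosPoly-0 : ∀ m → cosPoly (suc m) 0ℚ ≡ 1ℚ
  cosPoly-0 m = trans (cosPoly-alternating (suc m) 0ℚ)
    (trans (cong (λ z → 1ℚ + - z) (zeros (λ j → double (suc j)) (λ j → j) m)) refl)
    where
    zeros : ∀ (f g : ℕ → ℕ) m → alternating (λ j → 1/ f j ! * 0ℚ ^ suc (g j)) m ≡ 0ℚ
    zeros f g zero    = refl
    zeros f g (suc m) = trans (cong₂ _-_ (trans (cong (1/ f 0 ! *_) (*-zeroˡ (0ℚ ^ g 0))) (*-zeroʳ (1/ f 0 !)))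
      (zeros (λ j → f (suc j)) (λ j → g (suc j)) m)) refl

  private
    -- Monotonicity starts at the second coefficient: at `u = 4` the first two are 1 and 2.
    cosCoeff-decreasing : ∀ {u} → 0ℚ ≤ u → u ≤ ιₙ 4 → ∀ n → cosCoeff u (suc (suc n)) ≤ cosCoeff u (suc n)
    cosCoeff-decreasing 0≤u u≤4 n =
      coeff-decreasing (double (suc n)) (suc n) 0≤u (≤-trans u≤4 (4≤ (suc (double n))))

  -- The terms after the leading 1 subtract at most the next coefficient, which is 1/2.
  cosPoly-1≥0 : ∀ m → 0ℚ ≤ cosPoly (suc m) 1ℚ
  cosPoly-1≥0 m = subst (0ℚ ≤_) (sym (cosPoly-alternating (suc m) 1ℚ))
    (0≤q-p (≤-trans (proj₂ (alternating-bounds {λ j → cosCoeff 1ℚ (suc j)} (λ n → coeff-nonneg (double (suc n)) (suc n) 0≤1)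
      (cosCoeff-decreasing 0≤1 (ιₙ-mono {1} {4} (ℕ.s≤s ℕ.z≤n))) m)) (<⇒≤ (<-by {½} ½ (positive⁻¹ ½) refl))))
    where
    0≤1 : 0ℚ ≤ 1ℚ
    0≤1 = <⇒≤ (positive⁻¹ 1ℚ)

  -- The value is at most `1 - 2 + 2/3 = -1/3`. Two terms are required to reach the negative one.
  cosPoly-2≤0 : ∀ m → cosPoly (suc (suc m)) (ιₙ 2) ≤ 0ℚ
  cosPoly-2≤0 m = subst (_≤ 0ℚ) (sym (cosPoly-alternating (suc (suc m)) (ιₙ 2)))
    (≤-by (⅓ + (ℤ.+ 2 / 3 - A)) (+-nonneg (<⇒≤ (positive⁻¹ ⅓)) (0≤q-p (proj₂ A-bounds)))
      (solve 1 (λ a → con 1ℚ :- (con (ιₙ 2) :- a) :+ (con ⅓ :+ (con (ℤ.+ 2 / 3) :- a)) := con 0ℚ) refl A))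
    where
    A : ℚ
    A = alternating (λ j → cosCoeff (ιₙ 4) (suc (suc j))) m
    0≤4 : 0ℚ ≤ ιₙ 4
    0≤4 = ιₙ-mono {0} {4} ℕ.z≤n
    A-bounds : 0ℚ ≤ A × A ≤ cosCoeff (ιₙ 4) 2
    A-bounds = alternating-bounds {λ j → cosCoeff (ιₙ 4) (suc (suc j))} (λ n → coeff-nonneg (double (suc (suc n))) (suc (suc n)) 0≤4)
      (λ n → cosCoeff-decreasing 0≤4 ≤-refl (suc n)) m

  -- The error in the identity cos (a - b) - cos (a + b) = 2 sin a sin b for the polynomials.
  E₀ : ℚ
  E₀ = termBound 2 * termBound 2

  E₀-nonneg : 0ℚ ≤ E₀
  E₀-nonneg = *-nonneg (termBound-nonneg 2) (termBound-nonneg 2)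

  addition-error≤ : ∀ m → E₀ * ½^ double m ≤ E₀ * ½^ m
  addition-error≤ m = *-monoˡ-≤-nonNeg E₀ {{nonNegative E₀-nonneg}} (½^-antitone (n≤double m))

  -- The addition theorem is used for `b` and for `- b`. Parity of the polynomials is exact, so the
  -- total error is just the sum of the two addition errors.
  cosPoly-product : ∀ m {a b} → ∣ a ∣ ≤ ιₙ 2 → ∣ b ∣ ≤ ιₙ 2 →
    ∣ (cosPoly m (a - b) - cosPoly m (a + b)) - ιₙ 2 * (sinPoly m a * sinPoly m b) ∣ ≤ ιₙ 2 * (E₀ * ½^ m)
  cosPoly-product m {a} {b} a≤2 b≤2 = begin
    ∣ (cosPoly m (a - b) - cosPoly m (a + b)) - ιₙ 2 * (Sa * Sb) ∣
      ≡⟨ cong ∣_∣ (solve 6 (λ x y c d s t → (x :- y) :- con (ιₙ 2) :* (s :* t) := ((c :* d :- s :* t) :- y) :+ (:- ((c :* d :- s :* (:- t)) :- x))) refl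
           (cosPoly m (a - b)) (cosPoly m (a + b)) (cosPoly m a) (cosPoly m b) Sa Sb) ⟩
    ∣ P + - Q ∣        ≤⟨ ∣p+q∣≤∣p∣+∣q∣ P (- Q) ⟩
    ∣ P ∣ + ∣ - Q ∣    ≡⟨ cong (∣ P ∣ +_) (∣-p∣≡∣p∣ Q) ⟩
    ∣ P ∣ + ∣ Q ∣      ≤⟨ +-mono-≤ (≤-trans (cosSum-+ 2 a≤2 b≤2 (double m)) (addition-error≤ m)) Q≤ ⟩
    E₀ * ½^ m + E₀ * ½^ m  ≡⟨ solve 1 (λ x → x :+ x := con (ιₙ 2) :* x) refl (E₀ * ½^ m) ⟩
    ιₙ 2 * (E₀ * ½^ m)     ∎
    where
    open ≤-Reasoning
    Sa Sb P Q : ℚ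
    Sa = sinPoly m a
    Sb = sinPoly m b
    P = (cosPoly m a * cosPoly m b - Sa * Sb) - cosPoly m (a + b)
    Q = (cosPoly m a * cosPoly m b - Sa * - Sb) - cosPoly m (a - b)
    Q≤ : ∣ Q ∣ ≤ E₀ * ½^ m
    Q≤ = ≤-trans (subst₂ (λ x y → ∣ (cosPoly m a * x - Sa * y) - cosPoly m (a - b) ∣ ≤ E₀ * ½^ double m) (cosPoly-neg m b) (sinPoly-neg m b)
      (cosSum-+ 2 a≤2 (subst (_≤ ιₙ 2) (sym (∣-p∣≡∣p∣ b)) b≤2) (double m))) (addition-error≤ m)

  module _ {p q : ℚ} (1≤p : 1ℚ ≤ p) (p≤2 : p ≤ ιₙ 2) (1≤q : 1ℚ ≤ q) (q≤2 : q ≤ ιₙ 2) (m : ℕ) where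
    private
      -- Since `a - b = p` and `a + b = q`, the difference of cosines becomes `2 sin a sin b`. The
      -- mean `a` stays in [1, 2], away from 0, and `b` carries the distance of `p` and `q`.
      a b : ℚ
      a = ½ * (q + p)
      b = ½ * (q - p)
      0≤½ : 0ℚ ≤ ½
      0≤½ = <⇒≤ (positive⁻¹ ½)
      1≤a : 1ℚ ≤ a
      1≤a = ≤-by (½ * ((q - 1ℚ) + (p - 1ℚ))) (*-nonneg 0≤½ (+-nonneg (0≤q-p 1≤q) (0≤q-p 1≤p)))
        (solve 2 (λ p q → con 1ℚ :+ con ½ :* ((q :- con 1ℚ) :+ (p :- con 1ℚ)) := con ½ :* (q :+ p)) refl p q)
      ∣a∣≡a : ∣ a ∣ ≡ a
      ∣a∣≡a = 0≤p⇒∣p∣≡p (≤-trans (<⇒≤ (positive⁻¹ 1ℚ)) 1≤a)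
      ∣a∣≤2 : ∣ a ∣ ≤ ιₙ 2
      ∣a∣≤2 = subst (_≤ ιₙ 2) (sym ∣a∣≡a) (≤-by (½ * ((ιₙ 2 - q) + (ιₙ 2 - p))) (*-nonneg 0≤½ (+-nonneg (0≤q-p q≤2) (0≤q-p p≤2)))
        (solve 2 (λ p q → con ½ :* (q :+ p) :+ con ½ :* ((con (ιₙ 2) :- q) :+ (con (ιₙ 2) :- p)) := con (ιₙ 2)) refl p q))
      ∣b∣≡ : ∣ b ∣ ≡ ½ * ∣ q - p ∣
      ∣b∣≡ = ∣p*q∣≡∣p∣*∣q∣ ½ (q - p)
      ∣b∣≤2 : ∣ b ∣ ≤ ιₙ 2
      ∣b∣≤2 = ∣∣≤
        (≤-by (½ * (ιₙ 2 - q) + ½ * (p - 1ℚ) + ℤ.+ 3 / 2) (+-nonneg (+-nonneg (*-nonneg 0≤½ (0≤q-p q≤2)) (*-nonneg 0≤½ (0≤q-p 1≤p))) (<⇒≤ (positive⁻¹ (ℤ.+ 3 / 2))))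
          (solve 2 (λ p q → con ½ :* (q :- p) :+ (con ½ :* (con (ιₙ 2) :- q) :+ con ½ :* (p :- con 1ℚ) :+ con (ℤ.+ 3 / 2)) := con (ιₙ 2)) refl p q))
        (≤-by (½ * (ιₙ 2 - p) + ½ * (q - 1ℚ) + ℤ.+ 3 / 2) (+-nonneg (+-nonneg (*-nonneg 0≤½ (0≤q-p p≤2)) (*-nonneg 0≤½ (0≤q-p 1≤q))) (<⇒≤ (positive⁻¹ (ℤ.+ 3 / 2))))
          (solve 2 (λ p q → (:- con (ιₙ 2)) :+ (con ½ :* (con (ιₙ 2) :- p) :+ con ½ :* (q :- con 1ℚ) :+ con (ℤ.+ 3 / 2)) := con ½ :* (q :- p)) refl p q))
      Sa Sb D P : ℚ
      Sa = sinPoly (suc m) a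
      Sb = sinPoly (suc m) b
      D = cosPoly (suc m) p - cosPoly (suc m) q
      P = ιₙ 2 * (Sa * Sb)
      err : ℚ
      err = ιₙ 2 * (E₀ * ½^ suc m)
      D≈P : ∣ D - P ∣ ≤ err
      D≈P = subst₂ (λ x y → ∣ (cosPoly (suc m) x - cosPoly (suc m) y) - P ∣ ≤ err)
        (solve 2 (λ p q → con ½ :* (q :+ p) :- con ½ :* (q :- p) := p) refl p q)
        (solve 2 (λ p q → con ½ :* (q :+ p) :+ con ½ :* (q :- p) := q) refl p q)
        (cosPoly-product (suc m) {a} {b} ∣a∣≤2 ∣b∣≤2)
      ∣P∣≡ : ∣ P ∣ ≡ ιₙ 2 * (∣ Sa ∣ * ∣ Sb ∣)
      ∣P∣≡ = trans (∣p*q∣≡∣p∣*∣q∣ (ιₙ 2) (Sa * Sb)) (cong (ιₙ 2 *_) (∣p*q∣≡∣p∣*∣q∣ Sa Sb))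

    -- From `∣ sin a ∣ ≤ ∣ a ∣ ≤ 2` and `∣ sin b ∣ ≤ ∣ b ∣ = ∣ q - p ∣ / 2`, plus the error of the
    -- product formula.
    cosPoly-lipschitz : ∣ cosPoly (suc m) p - cosPoly (suc m) q ∣ ≤ ιₙ 2 * ∣ q - p ∣ + ιₙ 2 * (E₀ * ½^ suc m)
    cosPoly-lipschitz = begin
      ∣ D ∣                ≡⟨ cong ∣_∣ (solve 2 (λ d p → d := p :+ (d :- p)) refl D P) ⟩
      ∣ P + (D - P) ∣      ≤⟨ ∣p+q∣≤∣p∣+∣q∣ P (D - P) ⟩
      ∣ P ∣ + ∣ D - P ∣    ≤⟨ +-mono-≤ P≤ D≈P ⟩
      ιₙ 2 * ∣ q - p ∣ + err ∎
      where
      open ≤-Reasoning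
      P≤ : ∣ P ∣ ≤ ιₙ 2 * ∣ q - p ∣
      P≤ = begin
        ∣ P ∣                         ≡⟨ ∣P∣≡ ⟩
        ιₙ 2 * (∣ Sa ∣ * ∣ Sb ∣)      ≤⟨ *-monoˡ-≤-nonNeg (ιₙ 2) (*-mono (0≤∣p∣ Sa) (≤-trans (∣sinPoly∣≤ m ∣a∣≤2) ∣a∣≤2) (0≤∣p∣ Sb) (∣sinPoly∣≤ m ∣b∣≤2)) ⟩
        ιₙ 2 * (ιₙ 2 * ∣ b ∣)         ≡⟨ cong (λ z → ιₙ 2 * (ιₙ 2 * z)) ∣b∣≡ ⟩
        ιₙ 2 * (ιₙ 2 * (½ * ∣ q - p ∣)) ≡⟨ solve 1 (λ x → con (ιₙ 2) :* (con (ιₙ 2) :* (con ½ :* x)) := con (ιₙ 2) :* x) refl ∣ q - p ∣ ⟩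
        ιₙ 2 * ∣ q - p ∣              ∎

    -- Quantitative injectivity of cosine on [1, 2], which turns two approximate zeros into two
    -- close points. The constant 9 is 3 · 3: `∣ sin a ∣ ≥ 1/3` because `a ≥ 1`, and
    -- `∣ sin b ∣ ≥ ∣ b ∣ / 3`.
    cosPoly-expanding : ∣ q - p ∣ ≤ ιₙ 9 * (∣ cosPoly (suc m) p - cosPoly (suc m) q ∣ + ιₙ 2 * (E₀ * ½^ suc m))
    cosPoly-expanding = begin
      ∣ q - p ∣                              ≡⟨ solve 1 (λ x → x := con (ιₙ 9) :* (con (ιₙ 2) :* (con ⅓ :* (con ⅓ :* (con ½ :* x))))) refl ∣ q - p ∣ ⟩
      ιₙ 9 * (ιₙ 2 * (⅓ * (⅓ * (½ * ∣ q - p ∣)))) ≡⟨ cong (λ z → ιₙ 9 * (ιₙ 2 * (⅓ * (⅓ * z)))) ∣b∣≡ ⟨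
      ιₙ 9 * (ιₙ 2 * (⅓ * (⅓ * ∣ b ∣)))      ≤⟨ *-monoˡ-≤-nonNeg (ιₙ 9) (*-monoˡ-≤-nonNeg (ιₙ 2)
                                                  (*-mono (<⇒≤ (positive⁻¹ ⅓)) ⅓≤Sa (*-nonneg (<⇒≤ (positive⁻¹ ⅓)) (0≤∣p∣ b)) (≤∣sinPoly∣ m ∣b∣≤2))) ⟩
      ιₙ 9 * (ιₙ 2 * (∣ Sa ∣ * ∣ Sb ∣))      ≡⟨ cong (ιₙ 9 *_) ∣P∣≡ ⟨
      ιₙ 9 * ∣ P ∣                           ≤⟨ *-monoˡ-≤-nonNeg (ιₙ 9) P≤ ⟩
      ιₙ 9 * (∣ D ∣ + err)                   ∎
      where
      open ≤-Reasoning
      ⅓≤Sa : ⅓ ≤ ∣ Sa ∣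
      ⅓≤Sa = ≤-trans (≤-trans (≤-reflexive (sym (*-identityʳ ⅓))) (*-monoˡ-≤-nonNeg ⅓ (subst (1ℚ ≤_) (sym ∣a∣≡a) 1≤a))) (≤∣sinPoly∣ m ∣a∣≤2)
      P≤ : ∣ P ∣ ≤ ∣ D ∣ + err
      P≤ = begin
        ∣ P ∣                  ≡⟨ cong ∣_∣ (solve 2 (λ d p → p := d :+ (:- (d :- p))) refl D P) ⟩
        ∣ D + - (D - P) ∣      ≤⟨ ∣p+q∣≤∣p∣+∣q∣ D (- (D - P)) ⟩
        ∣ D ∣ + ∣ - (D - P) ∣  ≡⟨ cong (∣ D ∣ +_) (∣-p∣≡∣p∣ (D - P)) ⟩
        ∣ D ∣ + ∣ D - P ∣      ≤⟨ +-monoʳ-≤ ∣ D ∣ D≈P ⟩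
        ∣ D ∣ + err            ∎

  -- Left endpoint after n bisections of [1, 2], keeping a sign change of f.
  bisect : (ℚ → ℚ) → ℕ → ℚ
  bisect f zero = 1ℚ
  bisect f (suc n) with f (bisect f n + ½^ suc n) ≤? 0ℚ
  ... | yes _ = bisect f n
  ... | no  _ = bisect f n + ½^ suc n

  bisect-range : ∀ f n → 1ℚ ≤ bisect f n × bisect f n + ½^ n ≤ ιₙ 2
  bisect-range f zero = ≤-refl , ≤-refl
  bisect-range f (suc n) with f (bisect f n + ½^ suc n) ≤? 0ℚ | bisect-range f n
  ... | yes _ | 1≤a , b≤2 = 1≤a , ≤-trans (+-monoʳ-≤ (bisect f n) (½^-suc≤ n)) b≤2
  ... | no  _ | 1≤a , b≤2 = ≤-by′ , subst (_≤ ιₙ 2)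
        (solve 2 (λ a h → a :+ h := (a :+ con ½ :* h) :+ con ½ :* h) refl (bisect f n) (½^ n)) b≤2
    where
    ≤-by′ : 1ℚ ≤ bisect f n + ½^ suc n
    ≤-by′ = ≤-trans 1≤a (≤-by (½^ suc n) (½^-nonneg (suc n)) refl)

  bisect-signs : ∀ (f : ℚ → ℚ) → 0ℚ ≤ f 1ℚ → f (ιₙ 2) ≤ 0ℚ → ∀ n → 0ℚ ≤ f (bisect f n) × f (bisect f n + ½^ n) ≤ 0ℚ
  bisect-signs f 0≤f₁ f₂≤0 zero = 0≤f₁ , f₂≤0
  bisect-signs f 0≤f₁ f₂≤0 (suc n) with f (bisect f n + ½^ suc n) ≤? 0ℚ | bisect-signs f 0≤f₁ f₂≤0 n
  ... | yes f≤0 | 0≤fa , _   = 0≤fa , f≤0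
  ... | no  f≰0 | _ , fb≤0 = <⇒≤ (≰⇒> f≰0) , subst (λ z → f z ≤ 0ℚ)
        (solve 2 (λ a h → a :+ h := (a :+ con ½ :* h) :+ con ½ :* h) refl (bisect f n) (½^ n)) fb≤0

  -- Degree and number of bisections grow together, so that the length of the final interval and the
  -- truncation error are both of order `½ᵐ`.
  cosRoot : ℕ → ℚ
  cosRoot m = bisect (cosPoly m) m

  1≤cosRoot : ∀ m → 1ℚ ≤ cosRoot m
  1≤cosRoot m = proj₁ (bisect-range (cosPoly m) m)

  cosRoot≤2 : ∀ m → cosRoot m ≤ ιₙ 2
  cosRoot≤2 m = ≤-trans (≤-by (½^ m) (½^-nonneg m) refl) (proj₂ (bisect-range (cosPoly m) m))

  rootError : ℚ
  rootError = ιₙ 2 + ιₙ 2 * E₀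

  -- The polynomial is nonnegative at the left endpoint and nonpositive at the right one, so its
  -- value on the left is at most the difference of the two, which the Lipschitz bound controls over
  -- an interval of length `½ᵐ`.
  cosPoly-cosRoot : ∀ m → 2 ℕ.≤ m → ∣ cosPoly m (cosRoot m) ∣ ≤ rootError * ½^ m
  cosPoly-cosRoot (suc zero) (ℕ.s≤s ())
  cosPoly-cosRoot (suc (suc m)) _ = begin
    ∣ f a ∣                ≡⟨ 0≤p⇒∣p∣≡p 0≤fa ⟩
    f a                    ≤⟨ ≤-by (- f b) (neg-antimono-≤ fb≤0) refl ⟩
    f a - f b              ≤⟨ p≤∣p∣ (f a - f b) ⟩
    ∣ f a - f b ∣          ≤⟨ cosPoly-lipschitz (1≤cosRoot M) (cosRoot≤2 M) (≤-trans (1≤cosRoot M) (≤-by h (½^-nonneg M) refl)) (proj₂ (bisect-range f M)) (suc m) ⟩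
    ιₙ 2 * ∣ b - a ∣ + ιₙ 2 * (E₀ * h)
      ≡⟨ cong (λ z → ιₙ 2 * z + ιₙ 2 * (E₀ * h)) (trans (cong ∣_∣ (solve 2 (λ a h → (a :+ h) :- a := h) refl a h)) (0≤p⇒∣p∣≡p (½^-nonneg M))) ⟩
    ιₙ 2 * h + ιₙ 2 * (E₀ * h) ≡⟨ solve 2 (λ e h → con (ιₙ 2) :* h :+ con (ιₙ 2) :* (e :* h) := (con (ιₙ 2) :+ con (ιₙ 2) :* e) :* h) refl E₀ h ⟩
    rootError * h          ∎
    where
    open ≤-Reasoning
    M : ℕ
    M = suc (suc m)
    f : ℚ → ℚ
    f = cosPoly M
    a b h : ℚ
    h = ½^ M
    a = cosRoot M
    b = a + h
    0≤fa : 0ℚ ≤ f a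
    0≤fa = proj₁ (bisect-signs f (cosPoly-1≥0 (suc m)) (cosPoly-2≤0 m) M)
    fb≤0 : f b ≤ 0ℚ
    fb≤0 = proj₂ (bisect-signs f (cosPoly-1≥0 (suc m)) (cosPoly-2≤0 m) M)

  -- In order: the residue at the earlier root, the cost of lengthening its polynomial, the residue
  -- at the later root and the error of the product formula, all times the expansion constant 9.
  cosRootRate : ℚ
  cosRootRate = ιₙ 9 * (rootError + (termBound 2 + termBound 2) + rootError + ιₙ 2 * E₀)

  -- Both roots are approximate zeros of the longer polynomial: the later one by construction, the
  -- earlier one because passing from its own polynomial to the longer one costs only a geometric
  -- tail. `cosPoly-expanding` then bounds their distance.
  cosRoot-cauchy : ∀ m n → 2 ℕ.≤ m → m ℕ.≤ n → ∣ cosRoot n - cosRoot m ∣ ≤ cosRootRate * ½^ m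
  cosRoot-cauchy zero zero () _
  cosRoot-cauchy m (suc n) 2≤m m≤n = begin
    ∣ q - p ∣                                          ≤⟨ cosPoly-expanding (1≤cosRoot m) (cosRoot≤2 m) (1≤cosRoot N) (cosRoot≤2 N) n ⟩
    ιₙ 9 * (∣ Cp - Cq ∣ + ιₙ 2 * (E₀ * ½^ N))          ≤⟨ *-monoˡ-≤-nonNeg (ιₙ 9) (+-mono-≤ diff≤ (*-monoˡ-≤-nonNeg (ιₙ 2) (*-monoˡ-≤-nonNeg E₀ {{nonNegative E₀-nonneg}} h≤))) ⟩
    ιₙ 9 * ((R * h + K * h + R * h) + ιₙ 2 * (E₀ * h)) ≡⟨ solve 4 (λ r k e h → con (ιₙ 9) :* ((r :* h :+ k :* h :+ r :* h) :+ con (ιₙ 2) :* (e :* h)) := con (ιₙ 9) :* (r :+ k :+ r :+ con (ιₙ 2) :* e) :* h) refl R K E₀ h ⟩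
    cosRootRate * h                                    ∎
    where
    open ≤-Reasoning
    N : ℕ
    N = suc n
    p q h R K Cp Cq : ℚ
    p = cosRoot m
    q = cosRoot N
    h = ½^ m
    R = rootError
    K = termBound 2 + termBound 2
    Cp = cosPoly N p
    Cq = cosPoly N q
    h≤ : ½^ N ≤ h
    h≤ = ½^-antitone m≤n
    0≤R : 0ℚ ≤ R
    0≤R = +-nonneg {ιₙ 2} (ιₙ-mono {0} {2} ℕ.z≤n) (*-nonneg {ιₙ 2} (ιₙ-mono {0} {2} ℕ.z≤n) E₀-nonneg)
    ∣p∣≤2 : ∣ p ∣ ≤ ιₙ 2
    ∣p∣≤2 = subst (_≤ ιₙ 2) (sym (0≤p⇒∣p∣≡p (≤-trans (<⇒≤ (positive⁻¹ 1ℚ)) (1≤cosRoot m)))) (cosRoot≤2 m)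
    Cp≤ : ∣ Cp ∣ ≤ R * h + K * h
    Cp≤ = begin
      ∣ Cp ∣                                      ≡⟨ cong ∣_∣ (solve 2 (λ x y → x := y :+ (x :- y)) refl Cp (cosPoly m p)) ⟩
      ∣ cosPoly m p + (Cp - cosPoly m p) ∣        ≤⟨ ∣p+q∣≤∣p∣+∣q∣ (cosPoly m p) (Cp - cosPoly m p) ⟩
      ∣ cosPoly m p ∣ + ∣ Cp - cosPoly m p ∣      ≤⟨ +-mono-≤ (cosPoly-cosRoot m 2≤m) (≤-trans (weighted-cauchy κ ∣κ∣≤1 2 ∣p∣≤2 (double m) (double N) (double-mono m≤n))
                                                       (*-monoˡ-≤-nonNeg K {{nonNegative (+-nonneg (termBound-nonneg 2) (termBound-nonneg 2))}} (½^-antitone (n≤double m)))) ⟩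
      R * h + K * h                               ∎
    diff≤ : ∣ Cp - Cq ∣ ≤ R * h + K * h + R * h
    diff≤ = begin
      ∣ Cp - Cq ∣            ≤⟨ ∣p+q∣≤∣p∣+∣q∣ Cp (- Cq) ⟩
      ∣ Cp ∣ + ∣ - Cq ∣      ≡⟨ cong (∣ Cp ∣ +_) (∣-p∣≡∣p∣ Cq) ⟩
      ∣ Cp ∣ + ∣ Cq ∣        ≤⟨ +-mono-≤ Cp≤ (≤-trans (cosPoly-cosRoot N (ℕₚ.≤-trans 2≤m m≤n)) (*-monoˡ-≤-nonNeg R {{nonNegative 0≤R}} h≤)) ⟩
      R * h + K * h + R * h  ∎

-- Cauchy reals, limits, cosine, sine and the least positive zero of sine.

module RealAnalysis where
  open import Algebra.Bundles using (CommutativeRing)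
  open import Algebra.Bundles.Raw using (RawRing)
  import Algebra.Definitions.RawSemiring as RawSemiringDefs
  open import Data.Integer as ℤ using (ℤ)
  open import Data.Nat as ℕ using (ℕ; zero; suc; _!; _⊔_)
  import Data.Nat.Properties as ℕₚ
  open import Data.Product using (∃-syntax; _×_; _,_; proj₁; proj₂)
  open import Data.Rational as ℚ using (ℚ; 0ℚ; 1ℚ; ½; ∣_∣)
  import Data.Rational.Properties as ℚₚ
  open import Data.Rational.Solver using (module +-*-Solver)
  open import Data.Sum using (inj₁; inj₂)
  open import Level using (0ℓ)
  open import Relation.Binary.PropositionalEquality
  import Relation.Binary.Reasoning.Setoid as SetoidReasoning
  open import Relation.Nullary using (¬_)
  open import Defs
  open RationalArithmetic hiding (_^_)
  open ExponentialTerms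
  open TrigonometricPolynomials


  Eventually : (ℕ → Set) → Set
  Eventually P = ∃[ N ] (∀ n → N ℕ.≤ n → P n)

  private
    variable
      P Q R : ℕ → Set

  always : (∀ n → P n) → Eventually P
  always p = 0 , λ n _ → p n

  from : ∀ N → Eventually (N ℕ.≤_)
  from N = N , λ _ N≤n → N≤n

  mapᵉ : (∀ n → P n → Q n) → Eventually P → Eventually Q
  mapᵉ f (N , p) = N , λ n N≤n → f n (p n N≤n)

  zipᵉ : (∀ n → P n → Q n → R n) → Eventually P → Eventually Q → Eventually R
  zipᵉ f (M , p) (N , q) = M ⊔ N , λ n ≤n → f n (p n (ℕₚ.m⊔n≤o⇒m≤o M N ≤n)) (q n (ℕₚ.m⊔n≤o⇒n≤o M N ≤n))

  private
    ∣∣<-upper : ∀ {a b δ} → ∣ a ℚ.- b ∣ ℚ.< δ → a ℚ.< b ℚ.+ δ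
    ∣∣<-upper {a} {b} {δ} ab< = subst (ℚ._< b ℚ.+ δ) (solve 2 (λ a b → b :+ (a :- b) := a) refl a b)
      (ℚₚ.+-monoʳ-< b (ℚₚ.≤-<-trans (p≤∣p∣ (a ℚ.- b)) ab<))
      where open +-*-Solver

    ∣∣<-lower : ∀ {a b δ} → ∣ a ℚ.- b ∣ ℚ.< δ → b ℚ.< a ℚ.+ δ
    ∣∣<-lower {a} {b} {δ} ab< = ∣∣<-upper {b} {a} (subst (ℚ._< δ) (∣-∣-sym a b) ab<)

    triangle-< : ∀ {a b c ε} → ∣ a ℚ.- b ∣ ℚ.< ½ ℚ.* ε → ∣ b ℚ.- c ∣ ℚ.< ½ ℚ.* ε → ∣ a ℚ.- c ∣ ℚ.< ε
    triangle-< {a} {b} {c} {ε} ab bc = ℚₚ.≤-<-trans (∣-∣-triangle a b c)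
      (subst (∣ a ℚ.- b ∣ ℚ.+ ∣ b ℚ.- c ∣ ℚ.<_) (half+half ε) (ℚₚ.+-mono-< ab bc))

    self-close : ∀ q {ε} → 0ℚ ℚ.< ε → ∣ q ℚ.- q ∣ ℚ.< ε
    self-close q 0<ε = subst (λ z → ∣ z ∣ ℚ.< _) (sym (ℚₚ.+-inverseʳ q)) 0<ε

  ≈-pointwise : ∀ {x y} → (∀ n → seq x n ≡ seq y n) → x ≈ y
  ≈-pointwise {x} eq = mk≈ λ ε 0<ε → always λ n → subst (λ z → ∣ seq x n ℚ.- z ∣ ℚ.< ε) (eq n) (self-close (seq x n) 0<ε)

  ≈-refl : ∀ {x} → x ≈ x
  ≈-refl = ≈-pointwise λ _ → refl

  ≈-sym : ∀ {x y} → x ≈ y → y ≈ x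
  ≈-sym {x} {y} (mk≈ c) = mk≈ λ ε 0<ε → mapᵉ (λ n → subst (ℚ._< ε) (∣-∣-sym (seq x n) (seq y n))) (c ε 0<ε)

  ≈-trans : ∀ {x y z} → x ≈ y → y ≈ z → x ≈ z
  ≈-trans {x} {y} {z} (mk≈ c) (mk≈ d) = mk≈ λ ε 0<ε →
    zipᵉ (λ n → triangle-< {seq x n} {seq y n} {seq z n}) (c _ (half-pos 0<ε)) (d _ (half-pos 0<ε))

  -- The bound is a natural number because `termBound` takes one.
  bounded : ∀ x → ∃[ b ] Eventually (λ n → ∣ seq x n ∣ ℚ.≤ ιₙ b)
  bounded x = ℤ.∣ ℚ.↥ r ∣ , N , λ n N≤n → ℚₚ.≤-trans
      (subst (λ z → ∣ z ∣ ℚ.≤ r) (solve 2 (λ a b → (a :- b) :+ b := a) refl (seq x n) (seq x N))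
        (ℚₚ.≤-trans (ℚₚ.∣p+q∣≤∣p∣+∣q∣ (seq x n ℚ.- seq x N) (seq x N))
          (ℚₚ.+-monoˡ-≤ ∣ seq x N ∣ (ℚₚ.<⇒≤ (proj₂ bound n N N≤n ℕₚ.≤-refl)))))
      (≤-ι∣↥∣ r)
    where
    open +-*-Solver
    bound : ∃[ N ] (∀ m n → N ℕ.≤ m → N ℕ.≤ n → ∣ seq x m ℚ.- seq x n ∣ ℚ.< 1ℚ)
    bound = cauchy x 1ℚ (ℚₚ.positive⁻¹ 1ℚ)
    N : ℕ
    N = proj₁ bound
    r : ℚ
    r = 1ℚ ℚ.+ ∣ seq x N ∣

  private
    1≤suc : ∀ b → 0ℚ ℚ.< ιₙ (suc b)
    1≤suc b = ℚₚ.<-≤-trans (ℚₚ.positive⁻¹ 1ℚ) (ιₙ-mono {1} {suc b} (ℕ.s≤s ℕ.z≤n))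

    -- If |x| ≤ b, then |x y| < ε as soon as |y| < ε / (b + 1).
    shrink : ℕ → ℚ → ℚ
    shrink b ε = (ℤ.+ 1 ℚ./ suc b) ℚ.* ε

    shrink-pos : ∀ b {ε} → 0ℚ ℚ.< ε → 0ℚ ℚ.< shrink b ε
    shrink-pos b 0<ε = *-pos {ℤ.+ 1 ℚ./ suc b} (ℚₚ.positive⁻¹ _ {{ℚₚ.normalize-pos 1 (suc b)}}) 0<ε

    shrink-mul : ∀ {b ε p q} → ∣ p ∣ ℚ.≤ ιₙ b → ∣ q ∣ ℚ.< shrink b ε → ∣ p ℚ.* q ∣ ℚ.< ε
    shrink-mul {b} {ε} {p} {q} p≤ q< = begin-strict
      ∣ p ℚ.* q ∣                     ≡⟨ ℚₚ.∣p*q∣≡∣p∣*∣q∣ p q ⟩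
      ∣ p ∣ ℚ.* ∣ q ∣                 ≤⟨ ℚₚ.*-monoʳ-≤-nonNeg ∣ q ∣ {{ℚₚ.∣-∣-nonNeg q}} (ℚₚ.≤-trans p≤ (ιₙ-mono (ℕₚ.n≤1+n b))) ⟩
      ιₙ (suc b) ℚ.* ∣ q ∣            <⟨ ℚₚ.*-monoʳ-<-pos (ιₙ (suc b)) {{ℚ.positive (1≤suc b)}} q< ⟩
      ιₙ (suc b) ℚ.* shrink b ε       ≡⟨ solve 3 (λ i f e → i :* (f :* e) := (f :* i) :* e) refl (ιₙ (suc b)) (ℤ.+ 1 ℚ./ suc b) ε ⟩
      (ℤ.+ 1 ℚ./ suc b) ℚ.* ιₙ (suc b) ℚ.* ε ≡⟨ cong (ℚ._* ε) (1/-* (suc b)) ⟩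
      1ℚ ℚ.* ε                        ≡⟨ ℚₚ.*-identityˡ ε ⟩
      ε                               ∎
      where
      open ℚₚ.≤-Reasoning
      open +-*-Solver

  +-cong : ∀ {x x′ y y′} → x ≈ x′ → y ≈ y′ → x + y ≈ x′ + y′
  +-cong {x} {x′} {y} {y′} (mk≈ c) (mk≈ d) = mk≈ λ ε 0<ε → zipᵉ (λ n p q →
      ℚₚ.≤-<-trans (ℚₚ.≤-trans (ℚₚ.≤-reflexive (cong ∣_∣
        (solve 4 (λ a b c d → (a :+ b) :- (c :+ d) := (a :- c) :+ (b :- d)) refl (seq x n) (seq y n) (seq x′ n) (seq y′ n))))
          (ℚₚ.∣p+q∣≤∣p∣+∣q∣ (seq x n ℚ.- seq x′ n) (seq y n ℚ.- seq y′ n)))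
        (subst (_ ℚ.<_) (half+half ε) (ℚₚ.+-mono-< p q)))
      (c _ (half-pos 0<ε)) (d _ (half-pos 0<ε))
    where open +-*-Solver

  neg-cong : ∀ {x y} → x ≈ y → - x ≈ - y
  neg-cong {x} {y} (mk≈ c) = mk≈ λ ε 0<ε → mapᵉ (λ n → subst (ℚ._< ε)
      (trans (sym (ℚₚ.∣-p∣≡∣p∣ (seq x n ℚ.- seq y n))) (cong ∣_∣ (solve 2 (λ a b → :- (a :- b) := (:- a) :- (:- b)) refl (seq x n) (seq y n)))))
      (c ε 0<ε)
    where open +-*-Solver

  *-congˡ : ∀ x {y z} → y ≈ z → x * y ≈ x * z
  *-congˡ x {y} {z} (mk≈ c) = let b , x≤b = bounded x in mk≈ λ ε 0<ε → zipᵉ (λ n p q → subst (λ z → ∣ z ∣ ℚ.< ε)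
      (solve 3 (λ a b c → a :* (b :- c) := a :* b :- a :* c) refl (seq x n) (seq y n) (seq z n))
      (shrink-mul {b} {ε} {seq x n} {seq y n ℚ.- seq z n} p q)) x≤b (c _ (shrink-pos b 0<ε))
    where open +-*-Solver

  *-comm : ∀ x y → x * y ≈ y * x
  *-comm x y = ≈-pointwise {x * y} {y * x} λ n → ℚₚ.*-comm (seq x n) (seq y n)

  *-cong : ∀ {x x′ y y′} → x ≈ x′ → y ≈ y′ → x * y ≈ x′ * y′
  *-cong {x} {x′} {y} {y′} p q = ≈-trans (*-congˡ x {y} {y′} q) (≈-trans (*-comm x y′) (≈-trans (*-congˡ y′ {x} {x′} p) (*-comm y′ x′)))

  +-congˡ : ∀ x {y z} → y ≈ z → x + y ≈ x + z
  +-congˡ x {y} {z} = +-cong {x} {x} {y} {z} (≈-refl {x})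

  ℝ-ring : CommutativeRing 0ℓ 0ℓ
  ℝ-ring = record
    { Carrier = ℝ ; _≈_ = _≈_ ; _+_ = _+_ ; _*_ = _*_ ; -_ = -_ ; 0# = 0ℝ ; 1# = 1ℝ
    ; isCommutativeRing = record
      { isRing = record
        { +-isAbelianGroup = record
          { isGroup = record
            { isMonoid = record
              { isSemigroup = record
                { isMagma = record
                  { isEquivalence = record { refl = ≈-refl ; sym = ≈-sym ; trans = ≈-trans }
                  ; ∙-cong = +-cong
                  }
                ; assoc = λ x y z → ≈-pointwise λ n → ℚₚ.+-assoc (seq x n) (seq y n) (seq z n)
                }
              ; identity = (λ x → ≈-pointwise λ n → ℚₚ.+-identityˡ (seq x n))
                         , (λ x → ≈-pointwise λ n → ℚₚ.+-identityʳ (seq x n))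
              }
            ; inverse = (λ x → ≈-pointwise λ n → ℚₚ.+-inverseˡ (seq x n))
                      , (λ x → ≈-pointwise λ n → ℚₚ.+-inverseʳ (seq x n))
            ; ⁻¹-cong = neg-cong
            }
          ; comm = λ x y → ≈-pointwise λ n → ℚₚ.+-comm (seq x n) (seq y n)
          }
        ; *-cong = *-cong
        ; *-assoc = λ x y z → ≈-pointwise λ n → ℚₚ.*-assoc (seq x n) (seq y n) (seq z n)
        ; *-identity = (λ x → ≈-pointwise λ n → ℚₚ.*-identityˡ (seq x n))
                     , (λ x → ≈-pointwise λ n → ℚₚ.*-identityʳ (seq x n))
        ; distrib = (λ x y z → ≈-pointwise λ n → ℚₚ.*-distribˡ-+ (seq x n) (seq y n) (seq z n))
                  , (λ x y z → ≈-pointwise λ n → ℚₚ.*-distribʳ-+ (seq x n) (seq y n) (seq z n))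
        }
      ; *-comm = *-comm
      }
    }

  module ≈-Reasoning = SetoidReasoning (CommutativeRing.setoid ℝ-ring)

  <-resp-≈ : ∀ {x x′ y y′} → x ≈ x′ → y ≈ y′ → x < y → x′ < y′
  <-resp-≈ {x} {x′} {y} {y′} (mk≈ c) (mk≈ d) (ε , 0<ε , x<y) = ½ ℚ.* ε , half-pos 0<ε ,
      zipᵉ (λ n p q → step (seq x n) (seq x′ n) (seq y n) (seq y′ n) (proj₁ q) (proj₂ q) p)
        x<y (zipᵉ (λ _ → _,_) (c δ 0<δ) (d δ 0<δ))
    where
    open +-*-Solver
    -- A quarter of the margin is lost at each end, so half of it survives.
    δ : ℚ
    δ = ½ ℚ.* (½ ℚ.* ε)
    0<δ : 0ℚ ℚ.< δ
    0<δ = half-pos (half-pos 0<ε)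
    step : ∀ a a′ b b′ → ∣ a ℚ.- a′ ∣ ℚ.< δ → ∣ b ℚ.- b′ ∣ ℚ.< δ → a ℚ.+ ε ℚ.< b → a′ ℚ.+ ½ ℚ.* ε ℚ.< b′
    step a a′ b b′ aa bb ab = begin-strict
      a′ ℚ.+ ½ ℚ.* ε                    <⟨ ℚₚ.+-monoˡ-< (½ ℚ.* ε) (∣∣<-lower {a} {a′} aa) ⟩
      a ℚ.+ δ ℚ.+ ½ ℚ.* ε               ≡⟨ solve 2 (λ a e → a :+ con ½ :* (con ½ :* e) :+ con ½ :* e := (a :+ e) :- con ½ :* (con ½ :* e)) refl a ε ⟩
      (a ℚ.+ ε) ℚ.- δ                   <⟨ ℚₚ.+-monoˡ-< (ℚ.- δ) ab ⟩
      b ℚ.- δ                           <⟨ ℚₚ.+-monoˡ-< (ℚ.- δ) (∣∣<-upper {b} {b′} bb) ⟩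
      (b′ ℚ.+ δ) ℚ.- δ                  ≡⟨ solve 2 (λ b d → (b :+ d) :- d := b) refl b′ δ ⟩
      b′                                ∎
      where open ℚₚ.≤-Reasoning

  <-irrefl : ∀ {x y} → x ≈ y → ¬ (x < y)
  <-irrefl {x} {y} (mk≈ c) (ε , 0<ε , M , x<y) = ℚₚ.<-asym (x<y n (ℕₚ.m≤m⊔n M N)) (∣∣<-lower {seq x n} {seq y n} (proj₂ (c ε 0<ε) n (ℕₚ.m≤n⊔m M N)))
    where
    N : ℕ
    N = proj₁ (c ε 0<ε)
    n : ℕ
    n = M ⊔ N

  0<⇒eventually : ∀ {x} → 0ℝ < x → ∃[ ε ] (0ℚ ℚ.< ε × Eventually (λ n → ε ℚ.< seq x n))
  0<⇒eventually (ε , 0<ε , ev) = ε , 0<ε , mapᵉ (λ n → subst (ℚ._< _) (ℚₚ.+-identityˡ ε)) ev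

  eventually⇒0< : ∀ {x ε} → 0ℚ ℚ.< ε → Eventually (λ n → ε ℚ.< seq x n) → 0ℝ < x
  eventually⇒0< {ε = ε} 0<ε ev = ε , 0<ε , mapᵉ (λ n → subst (ℚ._< _) (sym (ℚₚ.+-identityˡ ε))) ev

  *-pos-ℝ : ∀ {x y} → 0ℝ < x → 0ℝ < y → 0ℝ < x * y
  *-pos-ℝ {x} {y} 0<x 0<y =
    let ε , 0<ε , ε<x = 0<⇒eventually {x} 0<x
        δ , 0<δ , δ<y = 0<⇒eventually {y} 0<y
    in eventually⇒0< {x * y} (*-pos 0<ε 0<δ) (zipᵉ (λ n p q →
      ℚₚ.<-≤-trans (ℚₚ.*-monoʳ-<-pos ε {{ℚ.positive 0<ε}} q)
        (ℚₚ.*-monoʳ-≤-nonNeg (seq y n) {{ℚ.nonNegative (ℚₚ.<⇒≤ (ℚₚ.<-trans 0<δ q))}} (ℚₚ.<⇒≤ p))) ε<x δ<y)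

  +-pos-ℝ : ∀ {x y} → 0ℝ < x → 0ℝ < y → 0ℝ < x + y
  +-pos-ℝ {x} {y} 0<x 0<y =
    let ε , 0<ε , ε<x = 0<⇒eventually {x} 0<x
        δ , 0<δ , δ<y = 0<⇒eventually {y} 0<y
    in eventually⇒0< {x + y} (ℚₚ.+-mono-< 0<ε 0<δ) (zipᵉ (λ n → ℚₚ.+-mono-<) ε<x δ<y)

  *-monoʳ-< : ∀ {q x y} → 0ℚ ℚ.< q → x < y → fromℚ q * x < fromℚ q * y
  *-monoʳ-< {q} {x} {y} 0<q (ε , 0<ε , x<y) = q ℚ.* ε , *-pos 0<q 0<ε , mapᵉ (λ n p →
    subst (ℚ._< q ℚ.* seq y n) (ℚₚ.*-distribˡ-+ q (seq x n) ε) (ℚₚ.*-monoʳ-<-pos q {{ℚ.positive 0<q}} p)) x<y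

  0<fromℚ : ∀ {q} → 0ℚ ℚ.< q → 0ℝ < fromℚ q
  0<fromℚ {q} 0<q = eventually⇒0< {fromℚ q} (half-pos 0<q) (always λ _ →
    subst (½ ℚ.* q ℚ.<_) (half+half q) (<-by (½ ℚ.* q) (half-pos 0<q) refl))

  -- Limits

  record Near (x y : ℝ) (ε : ℚ) : Set where
    constructor mkNear
    field
      near : Eventually (λ n → ∣ seq x n ℚ.- seq y n ∣ ℚ.< ε)

  infix 4 _⇝_

  -- Equivalent to `_⟶_`, but stated through distances of approximations, for which the triangle
  -- inequality is available, instead of two strict real inequalities.
  record _⇝_ (s : ℕ → ℝ) (ℓ : ℝ) : Set where
    constructor mk⇝
    field
      tends : ∀ ε → 0ℚ ℚ.< ε → Eventually (λ n → Near (s n) ℓ ε)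

  open _⇝_

  ⟶⇒⇝ : ∀ {s ℓ} → s ⟶ ℓ → s ⇝ ℓ
  ⟶⇒⇝ {s} {ℓ} lim = mk⇝ λ ε 0<ε → mapᵉ (λ n (lo , hi) → mkNear (both (s n) ε lo hi)) (lim ε 0<ε)
    where
    open +-*-Solver
    both : ∀ x ε → ℓ - fromℚ ε < x → x < ℓ + fromℚ ε → Eventually (λ n → ∣ seq x n ℚ.- seq ℓ n ∣ ℚ.< ε)
    both x ε (δ , 0<δ , lo) (η , 0<η , hi) = zipᵉ (λ n p q → ℚₚ.≤-<-trans
        (∣∣≤ {q = ε ℚ.- μ}
          (ℚₚ.≤-trans (ℚₚ.<⇒≤ (upper n q)) (ℚₚ.+-monoʳ-≤ ε (ℚₚ.neg-antimono-≤ (ℚₚ.p⊓q≤q δ η))))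
          (ℚₚ.≤-trans (ℚₚ.≤-reflexive (solve 2 (λ e m → :- (e :- m) := (:- e) :+ m) refl ε μ))
            (ℚₚ.≤-trans (ℚₚ.+-monoʳ-≤ (ℚ.- ε) (ℚₚ.p⊓q≤p δ η)) (ℚₚ.<⇒≤ (lower n p)))))
        (<-by μ 0<μ (solve 2 (λ e m → (e :- m) :+ m := e) refl ε μ))) lo hi
      where
      -- The two strict inequalities come with separate margins; the smaller one keeps the absolute
      -- value below `ε - μ`.
      μ : ℚ
      μ = δ ℚ.⊓ η
      0<μ : 0ℚ ℚ.< μ
      0<μ with ℚₚ.⊓-sel δ η
      ... | inj₁ e = subst (0ℚ ℚ.<_) (sym e) 0<δ
      ... | inj₂ e = subst (0ℚ ℚ.<_) (sym e) 0<η
      upper : ∀ n → seq x n ℚ.+ η ℚ.< seq ℓ n ℚ.+ ε → seq x n ℚ.- seq ℓ n ℚ.< ε ℚ.- η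
      upper n q = subst₂ ℚ._<_ (solve 3 (λ x h l → (x :+ h) :+ (:- (h :+ l)) := x :- l) refl (seq x n) η (seq ℓ n))
        (solve 3 (λ l e h → (l :+ e) :+ (:- (h :+ l)) := e :- h) refl (seq ℓ n) ε η) (ℚₚ.+-monoˡ-< (ℚ.- (η ℚ.+ seq ℓ n)) q)
      lower : ∀ n → (seq ℓ n ℚ.- ε) ℚ.+ δ ℚ.< seq x n → ℚ.- ε ℚ.+ δ ℚ.< seq x n ℚ.- seq ℓ n
      lower n p = subst (ℚ._< seq x n ℚ.- seq ℓ n) (solve 3 (λ l e d → ((l :- e) :+ d) :- l := (:- e) :+ d) refl (seq ℓ n) ε δ)
        (ℚₚ.+-monoˡ-< (ℚ.- seq ℓ n) p)

  -- Convergence is requested at `ε / 2`, and the other half becomes the margin that strict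
  -- inequality of reals demands.
  ⇝⇒⟶ : ∀ {s ℓ} → s ⇝ ℓ → s ⟶ ℓ
  ⇝⇒⟶ {s} {ℓ} (mk⇝ lim) ε 0<ε = mapᵉ (λ n (mkNear near) →
        (½ ℚ.* ε , half-pos 0<ε , mapᵉ (λ m p → lower m (seq (s n) m) p) near)
      , (½ ℚ.* ε , half-pos 0<ε , mapᵉ (λ m p → upper m (seq (s n) m) p) near)) (lim (½ ℚ.* ε) (half-pos 0<ε))
    where
    open +-*-Solver
    lower : ∀ m x → ∣ x ℚ.- seq ℓ m ∣ ℚ.< ½ ℚ.* ε → (seq ℓ m ℚ.- ε) ℚ.+ ½ ℚ.* ε ℚ.< x
    lower m x p = subst₂ ℚ._<_ (solve 2 (λ l e → l :- con ½ :* e := (l :- e) :+ con ½ :* e) refl (seq ℓ m) ε)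
      (solve 2 (λ x h → (x :+ h) :- h := x) refl x (½ ℚ.* ε)) (ℚₚ.+-monoˡ-< (ℚ.- (½ ℚ.* ε)) (∣∣<-lower {x} {seq ℓ m} p))
    upper : ∀ m x → ∣ x ℚ.- seq ℓ m ∣ ℚ.< ½ ℚ.* ε → x ℚ.+ ½ ℚ.* ε ℚ.< seq ℓ m ℚ.+ ε
    upper m x p = subst (x ℚ.+ ½ ℚ.* ε ℚ.<_) (solve 2 (λ l e → (l :+ con ½ :* e) :+ con ½ :* e := l :+ e) refl (seq ℓ m) ε)
      (ℚₚ.+-monoˡ-< (½ ℚ.* ε) (∣∣<-upper {x} {seq ℓ m} p))

  ≈⇒Near : ∀ {x y} → x ≈ y → ∀ {ε} → 0ℚ ℚ.< ε → Near x y ε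
  ≈⇒Near (mk≈ c) 0<ε = mkNear (c _ 0<ε)

  Near-trans : ∀ {x y z ε} → Near x y (½ ℚ.* ε) → Near y z (½ ℚ.* ε) → Near x z ε
  Near-trans {x} {y} {z} (mkNear p) (mkNear q) = mkNear (zipᵉ (λ n → triangle-< {seq x n} {seq y n} {seq z n}) p q)

  ⇝-cong : ∀ {s t ℓ m} → (∀ n → s n ≈ t n) → ℓ ≈ m → s ⇝ ℓ → t ⇝ m
  ⇝-cong s≈t ℓ≈m (mk⇝ lim) = mk⇝ λ ε 0<ε → mapᵉ (λ n p → Near-trans
      (≈⇒Near (≈-sym (s≈t n)) (half-pos 0<ε))
      (Near-trans p (≈⇒Near ℓ≈m (half-pos (half-pos 0<ε)))))
    (lim (½ ℚ.* (½ ℚ.* ε)) (half-pos (half-pos 0<ε)))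

  ⇝-unique : ∀ {s ℓ m} → s ⇝ ℓ → s ⇝ m → ℓ ≈ m
  ⇝-unique {s} {ℓ} {m} (mk⇝ p) (mk⇝ q) = mk≈ λ ε 0<ε →
    let M , p′ = p _ (half-pos 0<ε)
        N , q′ = q _ (half-pos 0<ε)
        mkNear u = p′ (M ⊔ N) (ℕₚ.m≤m⊔n M N)
        mkNear v = q′ (M ⊔ N) (ℕₚ.m≤n⊔m M N)
        x = s (M ⊔ N)
    in zipᵉ (λ n a b → triangle-< {seq ℓ n} {seq x n} {seq m n} (subst (ℚ._< _) (∣-∣-sym (seq x n) (seq ℓ n)) a) b) u v

  ⇝-const : ∀ {x} → (λ _ → x) ⇝ x
  ⇝-const {x} = mk⇝ λ ε 0<ε → always λ _ → ≈⇒Near (≈-refl {x}) 0<ε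

  ⇝-+ : ∀ {s t ℓ m} → s ⇝ ℓ → t ⇝ m → (λ n → s n + t n) ⇝ ℓ + m
  ⇝-+ {s} {t} {ℓ} {m} (mk⇝ p) (mk⇝ q) = mk⇝ λ ε 0<ε → zipᵉ (λ n (mkNear u) (mkNear v) → mkNear (zipᵉ (λ k a b →
      ℚₚ.≤-<-trans (ℚₚ.≤-trans (ℚₚ.≤-reflexive (cong ∣_∣
        (solve 4 (λ a b c d → (a :+ b) :- (c :+ d) := (a :- c) :+ (b :- d)) refl (seq (s n) k) (seq (t n) k) (seq ℓ k) (seq m k))))
          (ℚₚ.∣p+q∣≤∣p∣+∣q∣ (seq (s n) k ℚ.- seq ℓ k) (seq (t n) k ℚ.- seq m k)))
        (subst (_ ℚ.<_) (half+half ε) (ℚₚ.+-mono-< a b))) u v))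
      (p _ (half-pos 0<ε)) (q _ (half-pos 0<ε))
    where open +-*-Solver

  ⇝-*ˡ : ∀ c {s ℓ} → s ⇝ ℓ → (λ n → c * s n) ⇝ c * ℓ
  ⇝-*ˡ c {s} {ℓ} (mk⇝ p) = let b , c≤b = bounded c in mk⇝ λ ε 0<ε → mapᵉ (λ n (mkNear u) → mkNear (zipᵉ (λ k a q → subst (λ z → ∣ z ∣ ℚ.< ε)
      (solve 3 (λ a b c → a :* (b :- c) := a :* b :- a :* c) refl (seq c k) (seq (s n) k) (seq ℓ k))
      (shrink-mul {b} {ε} {seq c k} {seq (s n) k ℚ.- seq ℓ k} a q)) c≤b u)) (p _ (shrink-pos b 0<ε))
    where open +-*-Solver

  ⇝-neg : ∀ {s ℓ} → s ⇝ ℓ → (λ n → - s n) ⇝ - ℓ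
  ⇝-neg {s} {ℓ} lim = ⇝-cong {λ n → - 1ℝ * s n} {λ n → - s n} {(- 1ℝ) * ℓ} { - ℓ} (λ n → minus (s n)) (minus ℓ) (⇝-*ˡ (- 1ℝ) {s} {ℓ} lim)
    where
    open +-*-Solver
    minus : ∀ x → - 1ℝ * x ≈ - x
    minus x = ≈-pointwise λ n → solve 1 (λ x → (:- con 1ℚ) :* x := :- x) refl (seq x n)

  ⇝-subsequence : ∀ {s ℓ} (f : ℕ → ℕ) → (∀ n → n ℕ.≤ f n) → s ⇝ ℓ → (λ n → s (f n)) ⇝ ℓ
  ⇝-subsequence f n≤fn (mk⇝ p) = mk⇝ λ ε 0<ε → let N , q = p ε 0<ε in N , λ n N≤n → q (f n) (ℕₚ.≤-trans N≤n (n≤fn n))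

  -- Power series with coefficients w n / n!, |w n| ≤ 1

  infixr 8 _^_

  _^_ : ℝ → ℕ → ℝ
  x ^ zero  = 1ℝ
  x ^ suc n = x * x ^ n

  seq-^ : ∀ x n m → seq (x ^ n) m ≡ seq x m RationalArithmetic.^ n
  seq-^ x zero    m = refl
  seq-^ x (suc n) m = cong (seq x m ℚ.*_) (seq-^ x n m)

  seq-Σ : ∀ t n m → seq (partialSum ℝ-rawRing t n) m ≡ Σℚ (λ j → seq (t j) m) n
  seq-Σ t zero    m = refl
  seq-Σ t (suc n) m = cong (seq (t 0) m ℚ.+_) (seq-Σ (λ j → t (suc j)) n m)

  -- The unfolding of a sum or a power is proved pointwise: comparing the reals
  -- definitionally would also compare their Cauchy proofs.
  Σℝ-suc : ∀ t n → partialSum ℝ-rawRing t (suc n) ≈ t 0 + partialSum ℝ-rawRing (λ j → t (suc j)) n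
  Σℝ-suc t n = ≈-pointwise {partialSum ℝ-rawRing t (suc n)} {t 0 + partialSum ℝ-rawRing (λ j → t (suc j)) n} λ _ → refl

  Σℝ-cong : ∀ {s t} → (∀ j → s j ≈ t j) → ∀ n → partialSum ℝ-rawRing s n ≈ partialSum ℝ-rawRing t n
  Σℝ-cong {s} {t} s≈t zero    = ≈-pointwise {partialSum ℝ-rawRing s 0} {partialSum ℝ-rawRing t 0} λ _ → refl
  Σℝ-cong {s} {t} s≈t (suc n) = ≈-trans (Σℝ-suc s n) (≈-trans
    (+-cong {s 0} {t 0} {partialSum ℝ-rawRing (λ j → s (suc j)) n} {partialSum ℝ-rawRing (λ j → t (suc j)) n}
      (s≈t 0) (Σℝ-cong (λ j → s≈t (suc j)) n))
    (≈-sym (Σℝ-suc t n)))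

  ^-cong-ℝ : ∀ {x y} → x ≈ y → ∀ n → x ^ n ≈ y ^ n
  ^-cong-ℝ {x} {y} x≈y zero    = ≈-refl {1ℝ}
  ^-cong-ℝ {x} {y} x≈y (suc n) = *-cong {x} {y} {x ^ n} {y ^ n} x≈y (^-cong-ℝ x≈y n)

  IsCauchy-cong : ∀ {s t} → (∀ n → s n ≡ t n) → IsCauchy s → IsCauchy t
  IsCauchy-cong s≡t c ε 0<ε = let N , p = c ε 0<ε in N , λ m n N≤m N≤n →
    subst₂ (λ a b → ∣ a ℚ.- b ∣ ℚ.< ε) (s≡t m) (s≡t n) (p m n N≤m N≤n)

  module Series (w : ℕ → ℚ) (∣w∣≤1 : ∀ n → ∣ w n ∣ ℚ.≤ 1ℚ) where

    seriesTerm : ℝ → ℕ → ℝ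
    seriesTerm x j = fromℚ (w j) * (fromℚ (1/ j !) * x ^ j)

    seriesSum : ℝ → ℕ → ℝ
    seriesSum x = partialSum ℝ-rawRing (seriesTerm x)

    polySum : ℚ → ℕ → ℚ
    polySum q = Σℚ (λ j → w j ℚ.* term q j)

    seq-seriesSum : ∀ x n m → seq (seriesSum x n) m ≡ polySum (seq x m) n
    seq-seriesSum x n m = trans (seq-Σ (seriesTerm x) n m)
      (Σ-cong (λ j → cong (λ z → w j ℚ.* (1/ j ! ℚ.* z)) (seq-^ x j m)) n)

    private
      K : ℕ → ℚ
      K b = termBound b ℚ.+ termBound b

      tail-bound : ∀ {x} b {m n} → ∣ seq x m ∣ ℚ.≤ ιₙ b → n ℕ.≤ m →
        ∣ polySum (seq x m) (double m) ℚ.- polySum (seq x m) n ∣ ℚ.≤ K b ℚ.* ½^ n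
      tail-bound b {m} {n} x≤ n≤m = weighted-cauchy w ∣w∣≤1 b x≤ n (double m) (ℕₚ.≤-trans n≤m (n≤double m))

    -- The diagonal `f` is compared with `g`, the sum of fixed length `N` along the same
    -- approximations. The tail beyond `N` is small uniformly in the approximation, and `g` is
    -- Cauchy because it represents the real partial sum.
    series-cauchy : ∀ x → IsCauchy (λ m → polySum (seq x m) (double m))
    series-cauchy x ε 0<ε = L , λ m n L≤m L≤n →
          triangle-< {f m} {g m} {f n} (near m L≤m (ℕₚ.≤-trans (ℕₚ.m≤m⊔n (N ⊔ M) N₁) L≤m))
            (triangle-< {g m} {g n} {f n}
              (proj₂ cauchyg m n (ℕₚ.m⊔n≤o⇒n≤o (N ⊔ M) N₁ L≤m) (ℕₚ.m⊔n≤o⇒n≤o (N ⊔ M) N₁ L≤n))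
              (subst (ℚ._< _) (∣-∣-sym (f n) (g n)) (near′ n (ℕₚ.≤-trans (ℕₚ.m≤m⊔n (N ⊔ M) N₁) L≤n))))
      where
      b M : ℕ
      b = proj₁ (bounded x)
      M = proj₁ (proj₂ (bounded x))
      x≤b : ∀ m → M ℕ.≤ m → ∣ seq x m ∣ ℚ.≤ ιₙ b
      x≤b = proj₂ (proj₂ (bounded x))
      δ : ℚ
      δ = ½ ℚ.* (½ ℚ.* ε)
      0<δ : 0ℚ ℚ.< δ
      0<δ = half-pos (half-pos 0<ε)
      small : Eventually (λ n → K b ℚ.* ½^ n ℚ.< δ)
      small = geometric-vanishes (K b) δ 0<δ
      N : ℕ
      N = proj₁ small
      f g : ℕ → ℚ
      f m = polySum (seq x m) (double m)
      g m = polySum (seq x m) N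
      cauchyg : ∃[ N₁ ] (∀ m n → N₁ ℕ.≤ m → N₁ ℕ.≤ n → ∣ g m ℚ.- g n ∣ ℚ.< δ)
      cauchyg = IsCauchy-cong (seq-seriesSum x N) (cauchy (seriesSum x N)) δ 0<δ
      N₁ : ℕ
      N₁ = proj₁ cauchyg
      L : ℕ
      L = (N ⊔ M) ⊔ N₁
      near′ : ∀ m → N ⊔ M ℕ.≤ m → ∣ f m ℚ.- g m ∣ ℚ.< δ
      near′ m ≤m = ℚₚ.≤-<-trans (tail-bound {x} b (x≤b m (ℕₚ.m⊔n≤o⇒n≤o N M ≤m)) (ℕₚ.m⊔n≤o⇒m≤o N M ≤m)) (proj₂ small N ℕₚ.≤-refl)
      near : ∀ m → L ℕ.≤ m → N ⊔ M ℕ.≤ m → ∣ f m ℚ.- g m ∣ ℚ.< ½ ℚ.* ε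
      near m _ ≤m = ℚₚ.<-trans (near′ m ≤m) (subst (δ ℚ.<_) (half+half (½ ℚ.* ε)) (<-by δ 0<δ refl))

    -- For the weights `κ` and `σ` the `m`-th approximation is literally `cosPoly m` or `sinPoly m`
    -- at the `m`-th approximation of `x`, so facts about these polynomials transfer index by index.
    series : ℝ → ℝ
    series x = mkℝ (λ m → polySum (seq x m) (double m)) (series-cauchy x)

    -- For `m ≥ n` the diagonal entry contains the first `n` terms, and what remains is a geometric
    -- tail whose bound does not depend on `m`.
    series-limit : ∀ x → seriesSum x ⇝ series x
    series-limit x = let b , M , x≤b = bounded x in mk⇝ λ ε 0<ε → mapᵉ (λ n K½ⁿ<ε → mkNear (n ⊔ M , λ m ≤m →
        ℚₚ.≤-<-trans (subst (ℚ._≤ K b ℚ.* ½^ n)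
          (trans (∣-∣-sym (polySum (seq x m) (double m)) (polySum (seq x m) n)) (cong (λ z → ∣ z ℚ.- polySum (seq x m) (double m) ∣) (sym (seq-seriesSum x n m))))
          (tail-bound {x} b (x≤b m (ℕₚ.m⊔n≤o⇒n≤o n M ≤m)) (ℕₚ.m⊔n≤o⇒m≤o n M ≤m))) K½ⁿ<ε))
      (geometric-vanishes (K b) ε 0<ε)

    -- No continuity estimate is involved: equal reals have equal partial sums, and limits are
    -- unique.
    series-cong : ∀ {x y} → x ≈ y → series x ≈ series y
    series-cong {x} {y} x≈y = ⇝-unique (series-limit x)
      (⇝-cong (λ n → Σℝ-cong {seriesTerm y} {seriesTerm x} (λ j →
        *-congˡ (fromℚ (w j)) {fromℚ (1/ j !) * y ^ j} {fromℚ (1/ j !) * x ^ j} (*-congˡ (fromℚ (1/ j !)) {y ^ j} {x ^ j} (^-cong-ℝ (≈-sym x≈y) j))) n) ≈-refl (series-limit y))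

  module Cos = Series κ ∣κ∣≤1
  module Sin = Series σ ∣σ∣≤1

  cos sin : ℝ → ℝ
  cos = Cos.series
  sin = Sin.series

  cos-cong : ∀ {x y} → x ≈ y → cos x ≈ cos y
  cos-cong {x} {y} = Series.series-cong κ ∣κ∣≤1 {x} {y}

  sin-cong : ∀ {x y} → x ≈ y → sin x ≈ sin y
  sin-cong {x} {y} = Series.series-cong σ ∣σ∣≤1 {x} {y}

  private
    eventually-small⇒≈ : ∀ {x y} K → Eventually (λ n → ∣ seq x n ℚ.- seq y n ∣ ℚ.≤ K ℚ.* ½^ n) → x ≈ y
    eventually-small⇒≈ K ev = mk≈ λ ε 0<ε → zipᵉ (λ n → ℚₚ.≤-<-trans) ev (geometric-vanishes K ε 0<ε)

    ½^double≤ : ∀ K → 0ℚ ℚ.≤ K → ∀ n → K ℚ.* ½^ double n ℚ.≤ K ℚ.* ½^ n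
    ½^double≤ K 0≤K n = ℚₚ.*-monoˡ-≤-nonNeg K {{ℚ.nonNegative 0≤K}} (½^-antitone (n≤double n))

    bounded₂ : ∀ x y → ∃[ b ] Eventually (λ n → ∣ seq x n ∣ ℚ.≤ ιₙ b × ∣ seq y n ∣ ℚ.≤ ιₙ b)
    bounded₂ x y = let b , x≤b = bounded x ; c , y≤c = bounded y in b ⊔ c , zipᵉ (λ n p q → ℚₚ.≤-trans p (ιₙ-mono (ℕₚ.m≤m⊔n b c)) , ℚₚ.≤-trans q (ιₙ-mono (ℕₚ.m≤n⊔m b c))) x≤b y≤c

  -- Addition of reals is index by index, so each index is an instance of `cosSum-+` of length `2n`,
  -- whose error tends to 0.
  cos-+ : ∀ x y → cos (x + y) ≈ cos x * cos y + - (sin x * sin y)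
  cos-+ x y = let b , ≤b = bounded₂ x y in ≈-sym (eventually-small⇒≈ {cos x * cos y + - (sin x * sin y)} {cos (x + y)} (termBound b ℚ.* termBound b) (mapᵉ (λ n (p , q) →
      ℚₚ.≤-trans (cosSum-+ b p q (double n)) (½^double≤ _ (*-nonneg (termBound-nonneg b) (termBound-nonneg b)) n)) ≤b))

  sin-+ : ∀ x y → sin (x + y) ≈ sin x * cos y + cos x * sin y
  sin-+ x y = let b , ≤b = bounded₂ x y in ≈-sym (eventually-small⇒≈ {sin x * cos y + cos x * sin y} {sin (x + y)} (termBound b ℚ.* termBound b) (mapᵉ (λ n (p , q) →
      ℚₚ.≤-trans (sinSum-+ b p q (double n)) (½^double≤ _ (*-nonneg (termBound-nonneg b) (termBound-nonneg b)) n)) ≤b))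

  cos-neg : ∀ x → cos (- x) ≈ cos x
  cos-neg x = ≈-pointwise λ n → cosPoly-neg n (seq x n)

  sin-neg : ∀ x → sin (- x) ≈ - sin x
  sin-neg x = ≈-pointwise λ n → sinPoly-neg n (seq x n)

  cos-0 : cos 0ℝ ≈ 1ℝ
  -- The approximation at index 0 is the empty sum 0; from index 1 on it equals 1 exactly.
  cos-0 = mk≈ λ ε 0<ε → mapᵉ (λ { zero () ; (suc n) _ → subst (λ z → ∣ z ℚ.- 1ℚ ∣ ℚ.< ε) (sym (cosPoly-0 n)) (self-close 1ℚ 0<ε) }) (from 1)

  -- The addition theorem for `x + - x`, together with parity and `cos 0 = 1`.
  cos²+sin²≈1 : ∀ x → cos x * cos x + sin x * sin x ≈ 1ℝ
  cos²+sin²≈1 x = begin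
    cos x * cos x + sin x * sin x          ≈⟨ ≈-pointwise (λ n → solve 2 (λ c s → c :* c :+ s :* s := c :* c :- s :* (:- s)) refl (seq (cos x) n) (seq (sin x) n)) ⟩
    cos x * cos x + - (sin x * (- sin x))      ≈⟨ +-cong {cos x * cos (- x)} {cos x * cos x} {(- (sin x * sin (- x)))} {(- (sin x * (- sin x)))} (*-congˡ (cos x) {cos (- x)} {cos x} (cos-neg x))
                                                (neg-cong {sin x * sin (- x)} {sin x * (- sin x)} (*-congˡ (sin x) {sin (- x)} { - sin x} (sin-neg x))) ⟨
    cos x * cos (- x) + - (sin x * sin (- x))  ≈⟨ cos-+ x (- x) ⟨
    cos (x + - x)                            ≈⟨ cos-cong {x + - x} {0ℝ} (≈-pointwise {x + - x} {0ℝ} λ n → ℚₚ.+-inverseʳ (seq x n)) ⟩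
    cos 0ℝ                                 ≈⟨ cos-0 ⟩
    1ℝ                                     ∎
    where
    open ≈-Reasoning
    open +-*-Solver using (solve; _:=_; _:+_; _:*_; _:-_; :-_)

  -- π/2

  π/2 : ℝ
  π/2 = mkℝ cosRoot λ ε 0<ε →
    let N , small = geometric-vanishes cosRootRate (½ ℚ.* ε) (half-pos 0<ε)
        -- The estimates for the roots start at 2, where the cosine polynomial is known to change
        -- sign on [1, 2].
        L = 2 ⊔ N
        near : ∀ n → L ℕ.≤ n → ∣ cosRoot n ℚ.- cosRoot L ∣ ℚ.< ½ ℚ.* ε
        near n L≤n = ℚₚ.≤-<-trans (cosRoot-cauchy L n (ℕₚ.m≤m⊔n 2 N) L≤n) (small L (ℕₚ.m≤n⊔m 2 N))
    in L , λ m n L≤m L≤n → triangle-< {cosRoot m} {cosRoot L} {cosRoot n} (near m L≤m)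
         (subst (ℚ._< _) (∣-∣-sym (cosRoot n) (cosRoot L)) (near n L≤n))

  -- At index `n` the diagonal evaluates `cosPoly n` at its own approximate root `cosRoot n`.
  cos-π/2 : cos π/2 ≈ 0ℝ
  cos-π/2 = eventually-small⇒≈ {cos π/2} {0ℝ} rootError (mapᵉ (λ n 2≤n →
    subst (λ z → ∣ z ∣ ℚ.≤ rootError ℚ.* ½^ n) (sym (ℚₚ.+-identityʳ (cosPoly n (cosRoot n)))) (cosPoly-cosRoot n 2≤n)) (from 2))

  0<π/2 : 0ℝ < π/2
  0<π/2 = eventually⇒0< {π/2} (ℚₚ.positive⁻¹ ½) (always λ n → ℚₚ.<-≤-trans (<-by ½ (ℚₚ.positive⁻¹ ½) refl) (1≤cosRoot n))

  private
    0<⅓ : 0ℚ ℚ.< ⅓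
    0<⅓ = ℚₚ.positive⁻¹ ⅓

  -- The bound `sin t ≥ t/3` on [0, 2] holds for every nonempty truncation, so a margin for `t`
  -- gives a third of that margin for `sin t`.
  sin-pos : ∀ {t} → 0ℝ < t → Eventually (λ n → seq t n ℚ.≤ ιₙ 2) → 0ℝ < sin t
  sin-pos {t} 0<t t≤2 = let ε , 0<ε , ε<t = 0<⇒eventually {t} 0<t in eventually⇒0< {sin t} (*-pos 0<⅓ 0<ε) (zipᵉ (λ { zero () ; (suc n) _ (ε<tₙ , tₙ≤2) →
      ℚₚ.<-≤-trans (ℚₚ.*-monoʳ-<-pos ⅓ ε<tₙ) (≤sinPoly n (ℚₚ.<⇒≤ (ℚₚ.<-trans 0<ε ε<tₙ)) tₙ≤2) }) (from 1) (zipᵉ (λ _ → _,_) ε<t t≤2))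

  <π/2⇒≤2 : ∀ {y} → y < π/2 → Eventually (λ n → seq y n ℚ.≤ ιₙ 2)
  <π/2⇒≤2 {y} (ε , 0<ε , y<) = mapᵉ (λ n p → ℚₚ.≤-trans (ℚₚ.<⇒≤ (ℚₚ.<-trans (<-by ε 0<ε refl) p)) (cosRoot≤2 n)) y<

  -- cos y = cos y - cos π/2 = 2 sin ((π/2 + y)/2) sin ((π/2 + - y)/2)
  cos-pos : ∀ {y} → 0ℝ < y → y < π/2 → 0ℝ < cos y
  cos-pos {y} 0<y y<π/2 = <-resp-≈ {0ℝ} {0ℝ} {2sasb} {cos y} (≈-refl {0ℝ}) identity
      (+-pos-ℝ {sin a * sin b} {sin a * sin b} 0<sasb 0<sasb)
    where
    open ≈-Reasoning
    open +-*-Solver using (solve; _:=_; _:+_; _:*_; _:-_; :-_; con)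
    a b 2sasb : ℝ
    a = fromℚ ½ * (π/2 + y)
    b = fromℚ ½ * (π/2 + - y)
    2sasb = sin a * sin b + sin a * sin b
    ½-pos : ∀ {x} → 0ℝ < x → 0ℝ < fromℚ ½ * x
    ½-pos {x} = *-pos-ℝ {fromℚ ½} {x} (0<fromℚ (ℚₚ.positive⁻¹ ½))
    0<a : 0ℝ < a
    0<a = ½-pos {π/2 + y} (+-pos-ℝ {π/2} {y} 0<π/2 0<y)
    0<b : 0ℝ < b
    0<b = ½-pos {π/2 + - y} (let ε , 0<ε , ev = y<π/2 in ε , 0<ε , mapᵉ (λ n p →
      subst (ℚ._< cosRoot n ℚ.- seq y n) (solve 2 (λ y e → (y :+ e) :- y := con 0ℚ :+ e) refl (seq y n) ε) (ℚₚ.+-monoˡ-< (ℚ.- seq y n) p)) ev)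
    a≤2 : Eventually (λ n → seq a n ℚ.≤ ιₙ 2)
    a≤2 = mapᵉ (λ n y≤2 → ℚₚ.*-monoˡ-≤-nonNeg ½ (ℚₚ.+-mono-≤ (cosRoot≤2 n) y≤2)) (<π/2⇒≤2 {y} y<π/2)
    b≤2 : Eventually (λ n → seq b n ℚ.≤ ιₙ 2)
    b≤2 = let ε , 0<ε , ev = 0<⇒eventually {y} 0<y in mapᵉ (λ n p →
        -- A crude bound is enough: the first summand is at most 4, `- y` is at most 0, and half of
        -- 4 is the required 2.
        ℚₚ.*-monoˡ-≤-nonNeg ½ {y = ιₙ 4 ℚ.+ ℚ.- 0ℚ} (ℚₚ.+-mono-≤ {y = ιₙ 4}
          (ℚₚ.≤-trans (cosRoot≤2 n) (ιₙ-mono {2} {4} (ℕ.s≤s (ℕ.s≤s ℕ.z≤n))))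
          (ℚₚ.neg-antimono-≤ {0ℚ} {seq y n} (ℚₚ.<⇒≤ (ℚₚ.<-trans 0<ε p))))) ev
    0<sasb : 0ℝ < sin a * sin b
    0<sasb = *-pos-ℝ {sin a} {sin b} (sin-pos {a} 0<a a≤2) (sin-pos {b} 0<b b≤2)
    cos-y : cos y ≈ cos a * cos b + sin a * sin b
    cos-y = begin
      cos y                                  ≈⟨ cos-cong {y} {a + - b} (≈-pointwise {y} {a + - b} λ n → solve 2 (λ p y → y := con ½ :* (p :+ y) :- con ½ :* (p :- y)) refl (cosRoot n) (seq y n)) ⟩
      cos (a + - b)                            ≈⟨ cos-+ a (- b) ⟩
      cos a * cos (- b) + - (sin a * sin (- b))  ≈⟨ +-cong {cos a * cos (- b)} {cos a * cos b} {(- (sin a * sin (- b)))} {(- (sin a * (- sin b)))} (*-congˡ (cos a) {cos (- b)} {cos b} (cos-neg b))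
                                                  (neg-cong {sin a * sin (- b)} {sin a * (- sin b)} (*-congˡ (sin a) {sin (- b)} { - sin b} (sin-neg b))) ⟩
      cos a * cos b + - (sin a * (- sin b))      ≈⟨ ≈-pointwise (λ n → solve 3 (λ c s t → c :- s :* (:- t) := c :+ s :* t) refl (seq (cos a * cos b) n) (seq (sin a) n) (seq (sin b) n)) ⟩
      cos a * cos b + sin a * sin b          ∎
    0≈ : 0ℝ ≈ cos a * cos b + - (sin a * sin b)
    0≈ = begin
      0ℝ                             ≈⟨ cos-π/2 ⟨
      cos π/2                        ≈⟨ cos-cong {π/2} {a + b} (≈-pointwise {π/2} {a + b} λ n → solve 2 (λ p y → p := con ½ :* (p :+ y) :+ con ½ :* (p :- y)) refl (cosRoot n) (seq y n)) ⟩
      cos (a + b)                    ≈⟨ cos-+ a b ⟩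
      cos a * cos b + - (sin a * sin b)  ∎
    identity : 2sasb ≈ cos y
    identity = begin
      2sasb                                                             ≈⟨ ≈-pointwise (λ n → solve 2 (λ c s → s :+ s := (c :+ s) :- (c :- s)) refl (seq (cos a * cos b) n) (seq (sin a * sin b) n)) ⟩
      cos a * cos b + sin a * sin b + - (cos a * cos b + - (sin a * sin b))   ≈⟨ +-cong {cos y} {cos a * cos b + sin a * sin b} {(- 0ℝ)} {(- (cos a * cos b + - (sin a * sin b)))} cos-y (neg-cong {0ℝ} {cos a * cos b + - (sin a * sin b)} 0≈) ⟨
      cos y + - 0ℝ                                                        ≈⟨ ≈-pointwise (λ n → solve 1 (λ x → x :- con 0ℚ := x) refl (seq (cos y) n)) ⟩
      cos y                                                             ∎

  -- By `sin y = 2 sin (y/2) cos (y/2)`; the half angle lies below `π/2`, where both factors are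
  -- positive.
  sin-pos-<π : ∀ {y} → 0ℝ < y → y < π/2 + π/2 → 0ℝ < sin y
  sin-pos-<π {y} 0<y y<π = <-resp-≈ {0ℝ} {0ℝ} {sin h * cos h + cos h * sin h} {sin y} (≈-refl {0ℝ})
      (≈-trans (≈-sym (sin-+ h h)) (sin-cong {h + h} {y} (≈-pointwise {h + h} {y} λ n → half+half (seq y n))))
      (+-pos-ℝ {sin h * cos h} {cos h * sin h} (*-pos-ℝ {sin h} {cos h} 0<sin 0<cos) (*-pos-ℝ {cos h} {sin h} 0<cos 0<sin))
    where
    open +-*-Solver
    h : ℝ
    h = fromℚ ½ * y
    0<h : 0ℝ < h
    0<h = *-pos-ℝ {fromℚ ½} {y} (0<fromℚ (ℚₚ.positive⁻¹ ½)) 0<y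
    h<π/2 : h < π/2
    h<π/2 = <-resp-≈ {h} {h} {fromℚ ½ * (π/2 + π/2)} {π/2} (≈-refl {h})
      (≈-pointwise {fromℚ ½ * (π/2 + π/2)} {π/2} λ n → solve 1 (λ p → con ½ :* (p :+ p) := p) refl (cosRoot n)) (*-monoʳ-< {½} {y} {π/2 + π/2} (ℚₚ.positive⁻¹ ½) y<π)
    0<sin : 0ℝ < sin h
    0<sin = sin-pos {h} 0<h (<π/2⇒≤2 {h} h<π/2)
    0<cos : 0ℝ < cos h
    0<cos = cos-pos {h} 0<h h<π/2

  cos-+π : ∀ x → cos (x + (π/2 + π/2)) ≈ - cos x
  sin-+π : ∀ x → sin (x + (π/2 + π/2)) ≈ - sin x

  private
    -- Rewriting `cos² - sin²` as `2 cos² - (cos² + sin²)` avoids determining `sin π/2`.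
    cos-π : cos (π/2 + π/2) ≈ - 1ℝ
    cos-π = begin
      cos (π/2 + π/2)              ≈⟨ cos-+ π/2 π/2 ⟩
      cos π/2 * cos π/2 + - (sin π/2 * sin π/2)            ≈⟨ ≈-pointwise (λ n → solve 2 (λ c s → c :- s := (c :+ c) :- (c :+ s)) refl (seq (cos π/2 * cos π/2) n) (seq (sin π/2 * sin π/2) n)) ⟩
      cos π/2 * cos π/2 + cos π/2 * cos π/2 + - (cos π/2 * cos π/2 + sin π/2 * sin π/2) ≈⟨ +-cong {cos π/2 * cos π/2 + cos π/2 * cos π/2} {0ℝ + 0ℝ} {(- (cos π/2 * cos π/2 + sin π/2 * sin π/2))} {(- 1ℝ)} (+-cong {cos π/2 * cos π/2} {0ℝ} {cos π/2 * cos π/2} {0ℝ} cos²≈0 cos²≈0) (neg-cong {cos π/2 * cos π/2 + sin π/2 * sin π/2} {1ℝ} (cos²+sin²≈1 π/2)) ⟩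
      0ℝ + 0ℝ + - 1ℝ       ≈⟨ ≈-pointwise (λ _ → refl {x = ℚ.- 1ℚ}) ⟩
      - 1ℝ               ∎
      where
      open ≈-Reasoning
      open +-*-Solver using (solve; _:=_; _:+_; _:-_)
      cos²≈0 : cos π/2 * cos π/2 ≈ 0ℝ
      cos²≈0 = ≈-trans (*-congˡ (cos π/2) {cos π/2} {0ℝ} cos-π/2) (≈-pointwise {cos π/2 * 0ℝ} {0ℝ} λ n → ℚₚ.*-zeroʳ (seq (cos π/2) n))

    sin-π : sin (π/2 + π/2) ≈ 0ℝ
    sin-π = begin
      sin (π/2 + π/2)                          ≈⟨ sin-+ π/2 π/2 ⟩
      sin π/2 * cos π/2 + cos π/2 * sin π/2                  ≈⟨ +-congˡ (sin π/2 * cos π/2) {cos π/2 * sin π/2} {sin π/2 * cos π/2} (*-comm (cos π/2) (sin π/2)) ⟩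
      sin π/2 * cos π/2 + sin π/2 * cos π/2                  ≈⟨ +-cong {sin π/2 * cos π/2} {sin π/2 * 0ℝ} {sin π/2 * cos π/2} {sin π/2 * 0ℝ} (*-congˡ (sin π/2) {cos π/2} {0ℝ} cos-π/2) (*-congˡ (sin π/2) {cos π/2} {0ℝ} cos-π/2) ⟩
      sin π/2 * 0ℝ + sin π/2 * 0ℝ                ≈⟨ ≈-pointwise (λ n → solve 1 (λ s → s :* con 0ℚ :+ s :* con 0ℚ := con 0ℚ) refl (seq (sin π/2) n)) ⟩
      0ℝ                             ∎
      where
      open ≈-Reasoning
      open +-*-Solver using (solve; _:=_; _:+_; _:*_; con)

  cos-+π x = begin
    cos (x + (π/2 + π/2))                      ≈⟨ cos-+ x (π/2 + π/2) ⟩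
    cos x * cos (π/2 + π/2) + - (sin x * sin (π/2 + π/2))    ≈⟨ +-cong {cos x * cos (π/2 + π/2)} {cos x * (- 1ℝ)} {(- (sin x * sin (π/2 + π/2)))} {(- (sin x * 0ℝ))} (*-congˡ (cos x) {cos (π/2 + π/2)} { - 1ℝ} cos-π)
                                          (neg-cong {sin x * sin (π/2 + π/2)} {sin x * 0ℝ} (*-congˡ (sin x) {sin (π/2 + π/2)} {0ℝ} sin-π)) ⟩
    cos x * (- 1ℝ) + - (sin x * 0ℝ)      ≈⟨ ≈-pointwise (λ n → solve 2 (λ c s → c :* (:- con 1ℚ) :- s :* con 0ℚ := :- c) refl (seq (cos x) n) (seq (sin x) n)) ⟩
    - cos x                          ∎
    where
    open ≈-Reasoning
    open +-*-Solver using (solve; _:=_; _:*_; _:-_; :-_; con)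

  sin-+π x = begin
    sin (x + (π/2 + π/2))                      ≈⟨ sin-+ x (π/2 + π/2) ⟩
    sin x * cos (π/2 + π/2) + cos x * sin (π/2 + π/2)    ≈⟨ +-cong {sin x * cos (π/2 + π/2)} {sin x * (- 1ℝ)} {cos x * sin (π/2 + π/2)} {cos x * 0ℝ} (*-congˡ (sin x) {cos (π/2 + π/2)} { - 1ℝ} cos-π) (*-congˡ (cos x) {sin (π/2 + π/2)} {0ℝ} sin-π) ⟩
    sin x * (- 1ℝ) + cos x * 0ℝ      ≈⟨ ≈-pointwise (λ n → solve 2 (λ s c → s :* (:- con 1ℚ) :+ c :* con 0ℚ := :- s) refl (seq (sin x) n) (seq (cos x) n)) ⟩
    - sin x                          ∎
    where
    open ≈-Reasoning
    open +-*-Solver using (solve; _:=_; _:+_; _:*_; :-_; con)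

  -- The sine series of the statement has only the odd terms.

  2*≡double : ∀ j → 2 ℕ.* j ≡ double j
  2*≡double zero    = refl
  2*≡double (suc j) = cong suc (trans (ℕₚ.+-suc j (j ℕ.+ 0)) (cong suc (2*≡double j)))

  module RawPower = RawSemiringDefs (RawRing.rawSemiring ℝ-rawRing)

  seq-RawPower : ∀ x n m → seq (x RawPower.^ n) m ≡ seq x m RationalArithmetic.^ n
  seq-RawPower x zero    m = refl
  seq-RawPower x (suc n) m = cong (seq x m ℚ.*_) (seq-RawPower x n m)

  seq-sinTerms : ∀ x m n → seq (partialSum ℝ-rawRing (sinTerm x) m) n ≡ sinPoly m (seq x n)
  seq-sinTerms x m n = trans (seq-Σ (sinTerm x) m n) (trans (Σ-cong (λ j → cong₂ ℚ._*_ (seq-RawPower (- 1ℝ) j n)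
      (trans (cong (λ k → 1/ suc k ! ℚ.* seq (x RawPower.^ suc k) n) (2*≡double j))
        (cong (1/ suc (double j) ! ℚ.*_) (seq-RawPower x (suc (double j)) n)))) m)
    (sym (sinPoly-Σ m (seq x n))))

  -- The weights `σ` vanish at even indices, so `m` terms of the odd series are the first `2m` terms
  -- of the full one.
  sinTerms≈ : ∀ x m → partialSum ℝ-rawRing (sinTerm x) m ≈ Sin.seriesSum x (double m)
  sinTerms≈ x m = ≈-pointwise λ n → trans (seq-sinTerms x m n) (sym (Sin.seq-seriesSum x (double m) n))

  sinTerms⇝sin : ∀ x → partialSum ℝ-rawRing (sinTerm x) ⇝ sin x
  sinTerms⇝sin x = ⇝-cong (λ m → ≈-sym (sinTerms≈ x m)) ≈-refl (⇝-subsequence double n≤double (Sin.series-limit x))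

  IsSin⇒≈ : ∀ {x s} → IsSin x s → sin x ≈ s
  IsSin⇒≈ {x} {s} lim = ⇝-unique (sinTerms⇝sin x) (⟶⇒⇝ {partialSum ℝ-rawRing (sinTerm x)} {s} lim)

  -- As `p ≤ y` is the negation of `y < p`, minimality amounts to sine being nonzero, in fact
  -- positive, strictly between 0 and `π`.
  isPi : IsPi (π/2 + π/2)
  isPi = +-pos-ℝ {π/2} {π/2} 0<π/2 0<π/2
       , ⇝⇒⟶ (⇝-cong (λ _ → ≈-refl) sin-π (sinTerms⇝sin (π/2 + π/2)))
       , λ y 0<y sin-y≈0 y<π → <-irrefl {0ℝ} {sin y} (≈-sym (IsSin⇒≈ {y} {0ℝ} sin-y≈0)) (sin-pos-<π {y} 0<y y<π)

-- Finite sums, matrices and diagonalisation over commutative rings with limits.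

module LinearMaps where
  open import Algebra.Bundles using (CommutativeRing)
  open import Algebra.Bundles.Raw using (RawRing)
  open import Data.Bool using (if_then_else_)
  open import Data.List using (List; []; _∷_; foldr; map)
  open import Data.List.Membership.Propositional using (_∈_)
  open import Data.List.Relation.Unary.All as All using (All; []; _∷_)
  open import Data.List.Relation.Unary.AllPairs using ([]; _∷_)
  open import Data.List.Relation.Unary.Any using (here; there)
  open import Data.List.Relation.Unary.Unique.Propositional using (Unique)
  open import Data.Nat using (ℕ; zero; suc)
  open import Data.Product using (_×_; _,_; proj₁; proj₂)
  open import Level using (0ℓ)
  open import Relation.Binary.PropositionalEquality as ≡ using (_≡_; _≢_)
  import Relation.Binary.Reasoning.Setoid as SetoidReasoning
  open import Relation.Nullary using (yes; no; does)
  open import Relation.Nullary.Negation using (contradiction)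
  open import Defs using (FiniteSet; partialSum; module LinearAlgebra)
  open FiniteSet using (elements)

  -- A function of the ring rather than a definition in a parameterised module:
  -- at a concrete ring, Agda unfolds a copy made by a module application and
  -- then compares Cauchy proofs.
  power : (R : CommutativeRing 0ℓ 0ℓ) → CommutativeRing.Carrier R → ℕ → CommutativeRing.Carrier R
  power R x zero    = CommutativeRing.1# R
  power R x (suc n) = CommutativeRing._*_ R x (power R x n)

  -- Likewise not CommutativeRing.rawRing, which is such a copy.
  raw : CommutativeRing 0ℓ 0ℓ → RawRing 0ℓ 0ℓ
  raw R = record
    { Carrier = CommutativeRing.Carrier R ; _≈_ = CommutativeRing._≈_ R
    ; _+_ = CommutativeRing._+_ R ; _*_ = CommutativeRing._*_ R ; -_ = CommutativeRing.-_ R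
    ; 0# = CommutativeRing.0# R ; 1# = CommutativeRing.1# R }

  module Sums (R : CommutativeRing 0ℓ 0ℓ) where
    open CommutativeRing R
    open SetoidReasoning setoid

    interchange : ∀ a b c d → (a + b) + (c + d) ≈ (a + c) + (b + d)
    interchange a b c d = begin
      (a + b) + (c + d)  ≈⟨ +-assoc a b (c + d) ⟩
      a + (b + (c + d))  ≈⟨ +-congˡ (+-assoc b c d) ⟨
      a + ((b + c) + d)  ≈⟨ +-congˡ (+-congʳ (+-comm b c)) ⟩
      a + ((c + b) + d)  ≈⟨ +-congˡ (+-assoc c b d) ⟩
      a + (c + (b + d))  ≈⟨ +-assoc a c (b + d) ⟨
      (a + c) + (b + d)  ∎

    x∙yz≈y∙xz : ∀ x y z → x * (y * z) ≈ y * (x * z)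
    x∙yz≈y∙xz x y z = begin
      x * (y * z)  ≈⟨ *-assoc x y z ⟨
      (x * y) * z  ≈⟨ *-congʳ (*-comm x y) ⟩
      (y * x) * z  ≈⟨ *-assoc y x z ⟩
      y * (x * z)  ∎

    Σ[_] : ∀ {I : Set} → List I → (I → Carrier) → Carrier
    Σ[ xs ] f = foldr _+_ 0# (map f xs)

    module _ {I : Set} where
      Σ-cong : ∀ (xs : List I) {f g : I → Carrier} → (∀ v → f v ≈ g v) → Σ[ xs ] f ≈ Σ[ xs ] g
      Σ-cong []       f≈g = refl
      Σ-cong (x ∷ xs) f≈g = +-cong (f≈g x) (Σ-cong xs f≈g)

      Σ-0 : ∀ (xs : List I) → Σ[ xs ] (λ _ → 0#) ≈ 0#
      Σ-0 []       = refl
      Σ-0 (x ∷ xs) = trans (+-identityˡ _) (Σ-0 xs)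

      Σ-+ : ∀ (xs : List I) f g → Σ[ xs ] (λ v → f v + g v) ≈ Σ[ xs ] f + Σ[ xs ] g
      Σ-+ []       f g = sym (+-identityˡ 0#)
      Σ-+ (x ∷ xs) f g = trans (+-congˡ (Σ-+ xs f g)) (interchange (f x) (g x) _ _)

      Σ-*ˡ : ∀ (xs : List I) c f → Σ[ xs ] (λ v → c * f v) ≈ c * Σ[ xs ] f
      Σ-*ˡ []       c f = sym (zeroʳ c)
      Σ-*ˡ (x ∷ xs) c f = trans (+-congˡ (Σ-*ˡ xs c f)) (sym (distribˡ c (f x) _))

    Σ-swap : ∀ {I J : Set} (xs : List I) (ys : List J) (f : I → J → Carrier) →
      Σ[ xs ] (λ u → Σ[ ys ] (f u)) ≈ Σ[ ys ] (λ v → Σ[ xs ] (λ u → f u v))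
    Σ-swap []       ys f = sym (Σ-0 ys)
    Σ-swap (x ∷ xs) ys f = trans (+-congˡ (Σ-swap xs ys f)) (sym (Σ-+ ys (f x) (λ v → Σ[ xs ] (λ u → f u v))))

    partialSum-cong : ∀ {s t : ℕ → Carrier} → (∀ j → s j ≈ t j) → ∀ n → partialSum (raw R) s n ≈ partialSum (raw R) t n
    partialSum-cong s≈t zero    = refl
    partialSum-cong s≈t (suc n) = +-cong (s≈t 0) (partialSum-cong (λ j → s≈t (suc j)) n)

    Σ-partialSum : ∀ {I : Set} (xs : List I) (t : I → ℕ → Carrier) n →
      Σ[ xs ] (λ v → partialSum (raw R) (t v) n) ≈ partialSum (raw R) (λ j → Σ[ xs ] (λ v → t v j)) n
    Σ-partialSum xs t zero    = Σ-0 xs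
    Σ-partialSum xs t (suc n) = trans (Σ-+ xs (λ v → t v 0) (λ v → partialSum (raw R) (λ j → t v (suc j)) n))
      (+-congˡ (Σ-partialSum xs (λ v j → t v (suc j)) n))

    partialSum-*ˡ : ∀ c (t : ℕ → Carrier) n → partialSum (raw R) (λ j → c * t j) n ≈ c * partialSum (raw R) t n
    partialSum-*ˡ c t zero    = sym (zeroʳ c)
    partialSum-*ˡ c t (suc n) = trans (+-congˡ (partialSum-*ˡ c (λ j → t (suc j)) n)) (sym (distribˡ c (t 0) _))

  module MatrixSums (R : CommutativeRing 0ℓ 0ℓ) (V : FiniteSet) where
    open CommutativeRing R
    open SetoidReasoning setoid
    open Sums R
    open FiniteSet V renaming (Carrier to Vertex; _≟_ to _≟ⱽ_) hiding (elements)
    open LinearAlgebra (raw R) V public using (Matrix; Vector; ∑; e; _·_; _^ᴹ_)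

    xs : List Vertex
    xs = elements V

    private
      δ : Vertex → Vertex → Carrier
      δ u v = if does (u ≟ⱽ v) then 1# else 0#

      δ-≢ : ∀ {u v} → u ≢ v → δ u v ≈ 0#
      δ-≢ {u} {v} u≢v with u ≟ⱽ v
      ... | yes u≡v = contradiction u≡v u≢v
      ... | no  _   = refl

      δ-refl : ∀ u → δ u u ≈ 1#
      δ-refl u with u ≟ⱽ u
      ... | yes _   = refl
      ... | no  u≢u = contradiction ≡.refl u≢u

    δ-sym : ∀ u v → δ u v ≈ δ v u
    δ-sym u v with u ≟ⱽ v | v ≟ⱽ u
    ... | yes _   | yes _   = refl
    ... | no  _   | no  _   = refl
    ... | yes u≡v | no  v≢u = contradiction (≡.sym u≡v) v≢u
    ... | no  u≢v | yes v≡u = contradiction (≡.sym v≡u) u≢v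

    private
      Σ-δ-∉ : ∀ ys w (f : Vector) → All (w ≢_) ys → Σ[ ys ] (λ v → f v * δ v w) ≈ 0#
      Σ-δ-∉ []       w f []           = refl
      Σ-δ-∉ (y ∷ ys) w f (w≢y ∷ w∉ys) = trans
        (+-cong (trans (*-congˡ (δ-≢ (λ y≡w → w≢y (≡.sym y≡w)))) (zeroʳ (f y))) (Σ-δ-∉ ys w f w∉ys)) (+-identityˡ 0#)

      Σ-δ-∈ : ∀ {ys} w (f : Vector) → Unique ys → w ∈ ys → Σ[ ys ] (λ v → f v * δ v w) ≈ f w
      Σ-δ-∈ {y ∷ ys} w f (y∉ys ∷ _) (here ≡.refl) = trans
        (+-cong (trans (*-congˡ (δ-refl w)) (*-identityʳ (f w))) (Σ-δ-∉ ys w f y∉ys)) (+-identityʳ (f w))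
      Σ-δ-∈ {y ∷ ys} w f (y∉ys ∷ u) (there w∈ys) = trans
        (+-cong (trans (*-congˡ (δ-≢ (All.lookup y∉ys w∈ys))) (zeroʳ (f y))) (Σ-δ-∈ w f u w∈ys)) (+-identityˡ (f w))

    -- Completeness of the enumeration provides the term at `w`, and uniqueness makes it the only
    -- nonzero one.
    ∑-δ : ∀ (f : Vector) w → ∑ (λ v → f v * δ v w) ≈ f w
    ∑-δ f w = Σ-δ-∈ w f (FiniteSet.unique V) (FiniteSet.complete V w)

    ∑-δ′ : ∀ (f : Vector) w → ∑ (λ v → f v * δ w v) ≈ f w
    ∑-δ′ f w = trans (Σ-cong xs (λ v → *-congˡ (δ-sym w v))) (∑-δ f w)

    -- Here `χ` is a left eigenvector. Powers multiply by `M` on the left, so `χ` meets that factor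
    -- first, and exchanging the two finite sums pulls out one `μ`.
    eigen-power : ∀ (M : Matrix) (χ : Vector) μ → (∀ w → ∑ (λ u → χ u * M u w) ≈ μ * χ w) →
      ∀ j w → ∑ (λ u → χ u * (M ^ᴹ j) u w) ≈ power R μ j * χ w
    eigen-power M χ μ eig zero    w = trans (∑-δ χ w) (sym (*-identityˡ (χ w)))
    eigen-power M χ μ eig (suc j) w = begin
      ∑ (λ u → χ u * ∑ (λ v → M u v * N v w))       ≈⟨ Σ-cong xs (λ u → Σ-*ˡ xs (χ u) (λ v → M u v * N v w)) ⟨
      ∑ (λ u → ∑ (λ v → χ u * (M u v * N v w)))     ≈⟨ Σ-swap xs xs (λ u v → χ u * (M u v * N v w)) ⟩
      ∑ (λ v → ∑ (λ u → χ u * (M u v * N v w)))     ≈⟨ Σ-cong xs (λ v → Σ-cong xs (λ u → regroup (χ u) (M u v) (N v w))) ⟩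
      ∑ (λ v → ∑ (λ u → N v w * (χ u * M u v)))     ≈⟨ Σ-cong xs (λ v → Σ-*ˡ xs (N v w) (λ u → χ u * M u v)) ⟩
      ∑ (λ v → N v w * ∑ (λ u → χ u * M u v))       ≈⟨ Σ-cong xs (λ v → *-congˡ (eig v)) ⟩
      ∑ (λ v → N v w * (μ * χ v))                   ≈⟨ Σ-cong xs (λ v → trans (*-comm (N v w) (μ * χ v)) (*-assoc μ (χ v) (N v w))) ⟩
      ∑ (λ v → μ * (χ v * N v w))                   ≈⟨ Σ-*ˡ xs μ (λ v → χ v * N v w) ⟩
      μ * ∑ (λ v → χ v * N v w)                     ≈⟨ *-congˡ (eigen-power M χ μ eig j w) ⟩
      μ * (power R μ j * χ w)                             ≈⟨ *-assoc μ (power R μ j) (χ w) ⟨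
      power R μ (suc j) * χ w                               ∎
      where
      N : Matrix
      N = M ^ᴹ j
      regroup : ∀ a b c → a * (b * c) ≈ c * (a * b)
      regroup a b c = trans (sym (*-assoc a b c)) (*-comm (a * b) c)

    column : ∀ (U : Vertex → Vertex → Carrier) x u → LinearAlgebra._*ᵥ_ (raw R) V U (LinearAlgebra.e (raw R) V x) u ≈ U u x
    column U x u = ∑-δ′ (U u) x

    ^ᴹ-cong : ∀ {M N : Matrix} → (∀ u v → M u v ≈ N u v) → ∀ j u v →
      LinearAlgebra._^ᴹ_ (raw R) V M j u v ≈ LinearAlgebra._^ᴹ_ (raw R) V N j u v
    ^ᴹ-cong M≈N zero    u v = refl
    ^ᴹ-cong M≈N (suc j) u w = Σ-cong xs (λ v → *-cong (M≈N u v) (^ᴹ-cong M≈N j v w))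

    expSum-cong : ∀ (f : ℕ → Carrier) {M N : Matrix} → (∀ u v → M u v ≈ N u v) → ∀ n u v →
      partialSum (raw R) (λ j → f j * LinearAlgebra._^ᴹ_ (raw R) V M j u v) n
        ≈ partialSum (raw R) (λ j → f j * LinearAlgebra._^ᴹ_ (raw R) V N j u v) n
    expSum-cong f M≈N n u v = partialSum-cong (λ j → *-congˡ {f j} (^ᴹ-cong M≈N j u v)) n

  -- The properties of convergence that carry a diagonalisation from partial sums to the
  -- exponential.
  record Limits (R : CommutativeRing 0ℓ 0ℓ) : Set₁ where
    open CommutativeRing R
    infix 4 _⇝_
    field
      _⇝_    : (ℕ → Carrier) → Carrier → Set
      ⇝-cong : ∀ {s t ℓ m} → (∀ n → s n ≈ t n) → ℓ ≈ m → s ⇝ ℓ → t ⇝ m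
      ⇝-0    : (λ _ → 0#) ⇝ 0#
      ⇝-+    : ∀ {s t ℓ m} → s ⇝ ℓ → t ⇝ m → (λ n → s n + t n) ⇝ ℓ + m
      ⇝-*ˡ   : ∀ c {s ℓ} → s ⇝ ℓ → (λ n → c * s n) ⇝ c * ℓ
      ⇝-unique : ∀ {s ℓ m} → s ⇝ ℓ → s ⇝ m → ℓ ≈ m

  record Embedding (A B : CommutativeRing 0ℓ 0ℓ) : Set where
    private
      module A = CommutativeRing A
      module B = CommutativeRing B
    field
      h      : A.Carrier → B.Carrier
      h-cong : ∀ {x y} → x A.≈ y → h x B.≈ h y
      h-0    : h A.0# B.≈ B.0#
      h-1    : h A.1# B.≈ B.1#
      h-+    : ∀ x y → h (x A.+ y) B.≈ h x B.+ h y
      h-*    : ∀ x y → h (x A.* y) B.≈ h x B.* h y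

  -- The intended instance has real `A`, complex `B`, `c = -iτ` and `f j = 1/j!`: the real matrix
  -- `K` has left eigenvectors `χ S` with eigenvalues `κ S`, and the partial sums of `exp (c K)` are
  -- formed over `B`.
  module Diagonalisation
    (A B : CommutativeRing 0ℓ 0ℓ) (H : Embedding A B) (L : Limits B) (V : FiniteSet)
    (K : MatrixSums.Matrix A V)
    (χ : FiniteSet.Carrier V → FiniteSet.Carrier V → CommutativeRing.Carrier A)
    (κ : FiniteSet.Carrier V → CommutativeRing.Carrier A)
    (eigen : ∀ S w → CommutativeRing._≈_ A
      (MatrixSums.∑ A V (λ u → CommutativeRing._*_ A (χ S u) (K u w))) (CommutativeRing._*_ A (κ S) (χ S w)))
    (c : CommutativeRing.Carrier B) (f : ℕ → CommutativeRing.Carrier B)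
    where
    private
      module A = CommutativeRing A
      module ΣA = Sums A
    open CommutativeRing B
    open SetoidReasoning setoid
    open Sums B
    open MatrixSums B V
    open Embedding H
    open Limits L
    open FiniteSet V renaming (Carrier to Vertex) using ()

    M : Matrix
    M u v = c * h (K u v)

    expSum : ℕ → Matrix
    expSum n u v = partialSum (raw B) (λ j → f j * (M ^ᴹ j) u v) n

    scalarSum : Vertex → ℕ → Carrier
    scalarSum S = partialSum (raw B) (λ j → f j * power B (c * h (κ S)) j)

    h-Σ : ∀ (ys : List Vertex) g → h (ΣA.Σ[ ys ] g) ≈ Σ[ ys ] (λ v → h (g v))
    h-Σ []       g = h-0
    h-Σ (y ∷ ys) g = trans (h-+ (g y) (ΣA.Σ[ ys ] g)) (+-congˡ (h-Σ ys g))

    M-eigen : ∀ S w → ∑ (λ u → h (χ S u) * M u w) ≈ (c * h (κ S)) * h (χ S w)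
    M-eigen S w = begin
      ∑ (λ u → h (χ S u) * (c * h (K u w)))      ≈⟨ Σ-cong xs (λ u → x∙yz≈y∙xz (h (χ S u)) c (h (K u w))) ⟩
      ∑ (λ u → c * (h (χ S u) * h (K u w)))      ≈⟨ Σ-*ˡ xs c (λ u → h (χ S u) * h (K u w)) ⟩
      c * ∑ (λ u → h (χ S u) * h (K u w))        ≈⟨ *-congˡ (Σ-cong xs (λ u → h-* (χ S u) (K u w))) ⟨
      c * ∑ (λ u → h (χ S u A.* K u w))          ≈⟨ *-congˡ (h-Σ xs (λ u → χ S u A.* K u w)) ⟨
      c * h (ΣA.Σ[ xs ] (λ u → χ S u A.* K u w)) ≈⟨ *-congˡ (h-cong (eigen S w)) ⟩
      c * h (κ S A.* χ S w)                      ≈⟨ *-congˡ (h-* (κ S) (χ S w)) ⟩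
      c * (h (κ S) * h (χ S w))                  ≈⟨ *-assoc c (h (κ S)) (h (χ S w)) ⟨
      (c * h (κ S)) * h (χ S w)                  ∎

    -- At every finite stage the transform of a column by `χ S` is a scalar partial sum times
    -- `χ S w`. This reduces the matrix exponential to scalar exponentials before any limit is
    -- taken.
    expSum-transform : ∀ S w n → ∑ (λ u → h (χ S u) * expSum n u w) ≈ h (χ S w) * scalarSum S n
    expSum-transform S w n = begin
      ∑ (λ u → h (χ S u) * expSum n u w)
        ≈⟨ Σ-cong xs (λ u → partialSum-*ˡ (h (χ S u)) (λ j → f j * (M ^ᴹ j) u w) n) ⟨
      ∑ (λ u → partialSum (raw B) (λ j → h (χ S u) * (f j * (M ^ᴹ j) u w)) n)
        ≈⟨ Σ-partialSum xs (λ u j → h (χ S u) * (f j * (M ^ᴹ j) u w)) n ⟩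
      partialSum (raw B) (λ j → ∑ (λ u → h (χ S u) * (f j * (M ^ᴹ j) u w))) n
        ≈⟨ partialSum-cong (λ j → trans (Σ-cong xs (λ u → x∙yz≈y∙xz (h (χ S u)) (f j) ((M ^ᴹ j) u w)))
             (trans (Σ-*ˡ xs (f j) (λ u → h (χ S u) * (M ^ᴹ j) u w))
             (trans (*-congˡ (eigen-power M (λ u → h (χ S u)) (c * h (κ S)) (M-eigen S) j w))
               (rotate (f j) (power B (c * h (κ S)) j) (h (χ S w)))))) n ⟩
      partialSum (raw B) (λ j → h (χ S w) * (f j * power B (c * h (κ S)) j)) n
        ≈⟨ partialSum-*ˡ (h (χ S w)) (λ j → f j * power B (c * h (κ S)) j) n ⟩
      h (χ S w) * scalarSum S n ∎
      where
      rotate : ∀ a b c → a * (b * c) ≈ c * (a * b)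
      rotate a b c = trans (sym (*-assoc a b c)) (*-comm (a * b) c)

    ⇝-Σ : ∀ {I : Set} (ys : List I) {s : I → ℕ → Carrier} {ℓ} → (∀ v → s v ⇝ ℓ v) → (λ n → Σ[ ys ] (λ v → s v n)) ⇝ Σ[ ys ] ℓ
    ⇝-Σ []       lim = ⇝-0
    ⇝-Σ (y ∷ ys) lim = ⇝-+ (lim y) (⇝-Σ ys lim)

    -- The necessary direction: if column `a` of the exponential is `γ` times the basis vector at
    -- `b`, its transform by `χ S` is `γ χ S b`, while `expSum-transform` computes the same limit
    -- through the eigenvalue.
    scalarSum-limit : ∀ {a b γ} (E : Vector) → (∀ u → (λ n → expSum n u a) ⇝ E u) → (∀ u → E u ≈ γ * e b u) →
      ∀ S → (λ n → h (χ S a) * scalarSum S n) ⇝ γ * h (χ S b)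
    scalarSum-limit {a} {b} {γ} E lim E≈ S = ⇝-cong (λ n → expSum-transform S a n) (begin
        ∑ (λ u → h (χ S u) * E u)            ≈⟨ Σ-cong xs (λ u → trans (*-congˡ (E≈ u)) (x∙yz≈y∙xz (h (χ S u)) γ (e b u))) ⟩
        ∑ (λ u → γ * (h (χ S u) * e b u))    ≈⟨ Σ-*ˡ xs γ (λ u → h (χ S u) * e b u) ⟩
        γ * ∑ (λ u → h (χ S u) * e b u)      ≈⟨ *-congˡ (∑-δ′ (λ u → h (χ S u)) b) ⟩
        γ * h (χ S b)                        ∎)
      (⇝-Σ xs (λ u → ⇝-*ˡ (h (χ S u)) (lim u)))

    module Inversion (N N⁻¹ : A.Carrier) (inverse : N⁻¹ A.* N A.≈ A.1#)
      (orthogonal : ∀ u v → MatrixSums.∑ A V (λ S → χ S u A.* χ S v) A.≈ N A.* MatrixSums.e A V u v)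
      (h-e : ∀ u v → h (MatrixSums.e A V u v) ≈ e u v)
      where

      orthogonal-B : ∀ u v → ∑ (λ S → h (χ S u) * h (χ S v)) ≈ h N * e u v
      orthogonal-B u v = begin
        ∑ (λ S → h (χ S u) * h (χ S v))            ≈⟨ Σ-cong xs (λ S → h-* (χ S u) (χ S v)) ⟨
        ∑ (λ S → h (χ S u A.* χ S v))              ≈⟨ h-Σ xs (λ S → χ S u A.* χ S v) ⟨
        h (ΣA.Σ[ xs ] (λ S → χ S u A.* χ S v))     ≈⟨ h-cong (orthogonal u v) ⟩
        h (N A.* MatrixSums.e A V u v)             ≈⟨ h-* N (MatrixSums.e A V u v) ⟩
        h N * h (MatrixSums.e A V u v)             ≈⟨ *-congˡ (h-e u v) ⟩
        h N * e u v                                ∎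

      cancel : ∀ x → h N⁻¹ * (h N * x) ≈ x
      cancel x = begin
        h N⁻¹ * (h N * x)     ≈⟨ *-assoc (h N⁻¹) (h N) x ⟨
        h N⁻¹ * h N * x       ≈⟨ *-congʳ (h-* N⁻¹ N) ⟨
        h (N⁻¹ A.* N) * x     ≈⟨ *-congʳ (trans (h-cong inverse) h-1) ⟩
        1# * x                ≈⟨ *-identityˡ x ⟩
        x                     ∎

      -- Fourier inversion, kept multiplied by the group order `N`; orthogonality collapses the
      -- double sum.
      expand : ∀ (g : Vector) u → h N * g u ≈ ∑ (λ S → h (χ S u) * ∑ (λ v → h (χ S v) * g v))
      expand g u = begin
        h N * g u                                              ≈⟨ *-congˡ (∑-δ′ g u) ⟨
        h N * ∑ (λ v → g v * e u v)                            ≈⟨ Σ-*ˡ xs (h N) (λ v → g v * e u v) ⟨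
        ∑ (λ v → h N * (g v * e u v))                          ≈⟨ Σ-cong xs (λ v → x∙yz≈y∙xz (h N) (g v) (e u v)) ⟩
        ∑ (λ v → g v * (h N * e u v))                          ≈⟨ Σ-cong xs (λ v → *-congˡ (orthogonal-B u v)) ⟨
        ∑ (λ v → g v * ∑ (λ S → h (χ S u) * h (χ S v)))        ≈⟨ Σ-cong xs (λ v → Σ-*ˡ xs (g v) (λ S → h (χ S u) * h (χ S v))) ⟨
        ∑ (λ v → ∑ (λ S → g v * (h (χ S u) * h (χ S v))))      ≈⟨ Σ-swap xs xs (λ v S → g v * (h (χ S u) * h (χ S v))) ⟩
        ∑ (λ S → ∑ (λ v → g v * (h (χ S u) * h (χ S v))))      ≈⟨ Σ-cong xs (λ S → Σ-cong xs (λ v → trans (x∙yz≈y∙xz (g v) (h (χ S u)) (h (χ S v))) (*-congˡ (*-comm (g v) (h (χ S v)))))) ⟩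
        ∑ (λ S → ∑ (λ v → h (χ S u) * (h (χ S v) * g v)))      ≈⟨ Σ-cong xs (λ S → Σ-*ˡ xs (h (χ S u)) (λ v → h (χ S v) * g v)) ⟩
        ∑ (λ S → h (χ S u) * ∑ (λ v → h (χ S v) * g v))        ∎

      -- The sufficient direction. By `translate` the sign `ε S` moves `w` to `τ w` in every
      -- character, so Fourier inversion of the scalar limits returns `γ` times the basis vector at
      -- `τ w`.
      expSum-limit : ∀ (τ : Vertex → Vertex) γ (ε : Vector) →
        (∀ S w → ε S * h (χ S w) ≈ h (χ S (τ w))) → (∀ S → scalarSum S ⇝ γ * ε S) →
        ∀ u w → (λ n → expSum n u w) ⇝ γ * e (τ w) u
      expSum-limit τ γ ε translate lim u w = ⇝-cong
        (λ n → begin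
          h N⁻¹ * ∑ (λ S → h (χ S u) * (h (χ S w) * scalarSum S n))
            ≈⟨ *-congˡ (Σ-cong xs (λ S → *-congˡ (expSum-transform S w n))) ⟨
          h N⁻¹ * ∑ (λ S → h (χ S u) * ∑ (λ v → h (χ S v) * expSum n v w))
            ≈⟨ *-congˡ (expand (λ v → expSum n v w) u) ⟨
          h N⁻¹ * (h N * expSum n u w)
            ≈⟨ cancel (expSum n u w) ⟩
          expSum n u w ∎)
        (begin
          h N⁻¹ * ∑ (λ S → h (χ S u) * (h (χ S w) * (γ * ε S)))
            ≈⟨ *-congˡ (Σ-cong xs (λ S → regroup (h (χ S u)) (h (χ S w)) γ (ε S))) ⟩
          h N⁻¹ * ∑ (λ S → γ * ((ε S * h (χ S w)) * h (χ S u)))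
            ≈⟨ *-congˡ (Σ-cong xs (λ S → *-congˡ (*-congʳ (translate S w)))) ⟩
          h N⁻¹ * ∑ (λ S → γ * (h (χ S (τ w)) * h (χ S u)))
            ≈⟨ *-congˡ (Σ-*ˡ xs γ (λ S → h (χ S (τ w)) * h (χ S u))) ⟩
          h N⁻¹ * (γ * ∑ (λ S → h (χ S (τ w)) * h (χ S u)))
            ≈⟨ *-congˡ (*-congˡ (orthogonal-B (τ w) u)) ⟩
          h N⁻¹ * (γ * (h N * e (τ w) u))
            ≈⟨ *-congˡ (x∙yz≈y∙xz γ (h N) (e (τ w) u)) ⟩
          h N⁻¹ * (h N * (γ * e (τ w) u))
            ≈⟨ cancel (γ * e (τ w) u) ⟩
          γ * e (τ w) u ∎)
        (⇝-*ˡ (h N⁻¹) (⇝-Σ xs (λ S → ⇝-*ˡ (h (χ S u)) (⇝-*ˡ (h (χ S w)) (lim S)))))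
        where
        regroup : ∀ a b g t → a * (b * (g * t)) ≈ g * ((t * b) * a)
        regroup a b g t = begin
          a * (b * (g * t))  ≈⟨ *-congˡ (x∙yz≈y∙xz b g t) ⟩
          a * (g * (b * t))  ≈⟨ x∙yz≈y∙xz a g (b * t) ⟩
          g * (a * (b * t))  ≈⟨ *-congˡ (*-comm a (b * t)) ⟩
          g * ((b * t) * a)  ≈⟨ *-congˡ (*-congʳ (*-comm b t)) ⟩
          g * ((t * b) * a)  ∎

-- Characters of the cube: eigenvalues of the adjacency matrix and orthogonality.

module CubeCharacters where
  open import Algebra.Bundles using (CommutativeRing)
  import Algebra.Properties.Ring as RingProperties
  open import Data.Bool using (Bool; true; false; if_then_else_)
  open import Data.List using (List; []; _∷_; _++_; map)
  open import Data.Nat using (ℕ; zero; suc; _≡ᵇ_)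
  open import Data.Parity as ℙ using (Parity; 0ℙ; 1ℙ)
  open import Data.Vec using ([]; _∷_)
  open import Level using (0ℓ)
  open import Relation.Binary.PropositionalEquality as ≡ using (_≡_)
  import Relation.Binary.Reasoning.Setoid as SetoidReasoning
  open import Relation.Nullary using (does)
  open import Defs using (Word; words; _≟ᵂ_; 𝔽₂^; antipode; adjacent?; differences; module LinearAlgebra)
  open LinearMaps

  -- Once the first coordinates differ, adjacency leaves no further difference to the tails. The
  -- test against 0 is what `adjacent?` reduces to in that case.
  does-adjacent-flip : ∀ {d} (u w : Word d) → (differences u w ≡ᵇ 0) ≡ does (u ≟ᵂ w)
  does-adjacent-flip []        []        = ≡.refl
  does-adjacent-flip (0ℙ ∷ u) (0ℙ ∷ w) = does-adjacent-flip u w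
  does-adjacent-flip (0ℙ ∷ u) (1ℙ ∷ w) = ≡.refl
  does-adjacent-flip (1ℙ ∷ u) (0ℙ ∷ w) = ≡.refl
  does-adjacent-flip (1ℙ ∷ u) (1ℙ ∷ w) = does-adjacent-flip u w

  module _ (R : CommutativeRing 0ℓ 0ℓ) where
    open CommutativeRing R

    -- This is `(-1)^(s x)`, so `χ S w` is `(-1)` to the scalar product of `S` and `w`.
    bit : Parity → Parity → Carrier
    bit 0ℙ _  = 1#
    bit 1ℙ 0ℙ = 1#
    bit 1ℙ 1ℙ = - 1#

    χ : ∀ {d} → Word d → Word d → Carrier
    χ []      []      = 1#
    χ (s ∷ S) (x ∷ w) = bit s x * χ S w

    -- The eigenvalue d - 2|S| of the adjacency matrix, and the sign (-1)^|S|
    eigenvalue parity : ∀ {d} → Word d → Carrier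
    eigenvalue []      = 0#
    eigenvalue (s ∷ S) = bit s 1ℙ + eigenvalue S
    parity []      = 1#
    parity (s ∷ S) = bit s 1ℙ * parity S

    adjacency : ∀ {d} → Word d → Word d → Carrier
    adjacency x y = if does (adjacent? x y) then 1# else 0#

  module Characters (R : CommutativeRing 0ℓ 0ℓ) where
    open CommutativeRing R
    open RingProperties ring
    open SetoidReasoning setoid
    open Sums R

    Σ-++ : ∀ {I : Set} (xs ys : List I) f → Σ[ xs ++ ys ] f ≈ Σ[ xs ] f + Σ[ ys ] f
    Σ-++ []       ys f = sym (+-identityˡ _)
    Σ-++ (x ∷ xs) ys f = trans (+-congˡ (Σ-++ xs ys f)) (sym (+-assoc (f x) _ _))

    Σ-map : ∀ {I J : Set} (g : I → J) (xs : List I) f → Σ[ map g xs ] f ≈ Σ[ xs ] (λ v → f (g v))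
    Σ-map g []       f = refl
    Σ-map g (x ∷ xs) f = +-congˡ (Σ-map g xs f)

    Σ-words : ∀ d (f : Word (suc d) → Carrier) →
      Σ[ words (suc d) ] f ≈ Σ[ words d ] (λ u → f (0ℙ ∷ u)) + Σ[ words d ] (λ u → f (1ℙ ∷ u))
    Σ-words d f = begin
      Σ[ words (suc d) ] f
        ≈⟨ Σ-++ (map (0ℙ ∷_) (words d)) (map (1ℙ ∷_) (words d) ++ []) f ⟩
      Σ[ map (0ℙ ∷_) (words d) ] f + Σ[ map (1ℙ ∷_) (words d) ++ [] ] f
        ≈⟨ +-cong (Σ-map (0ℙ ∷_) (words d) f) (trans (Σ-++ (map (1ℙ ∷_) (words d)) [] f) (trans (+-identityʳ _) (Σ-map (1ℙ ∷_) (words d) f))) ⟩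
      Σ[ words d ] (λ u → f (0ℙ ∷ u)) + Σ[ words d ] (λ u → f (1ℙ ∷ u)) ∎

    -1*-1 : - 1# * - 1# ≈ 1#
    -1*-1 = trans (-1*x≈-x (- 1#)) (-‿involutive 1#)

    bit-flip : ∀ s b → bit R s (b ℙ.+ 1ℙ) ≈ bit R s 1ℙ * bit R s b
    bit-flip 0ℙ b  = sym (*-identityˡ 1#)
    bit-flip 1ℙ 0ℙ = sym (*-identityʳ (- 1#))
    bit-flip 1ℙ 1ℙ = sym -1*-1

    χ-antipode : ∀ {d} (S w : Word d) → parity R S * χ R S w ≈ χ R S (antipode w)
    χ-antipode []      []      = *-identityˡ 1#
    χ-antipode (s ∷ S) (b ∷ w) = begin
      (bit R s 1ℙ * parity R S) * (bit R s b * χ R S w)  ≈⟨ *-assoc (bit R s 1ℙ) (parity R S) (bit R s b * χ R S w) ⟩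
      bit R s 1ℙ * (parity R S * (bit R s b * χ R S w))  ≈⟨ *-congˡ (x∙yz≈y∙xz (parity R S) (bit R s b) (χ R S w)) ⟩
      bit R s 1ℙ * (bit R s b * (parity R S * χ R S w))  ≈⟨ *-assoc (bit R s 1ℙ) (bit R s b) (parity R S * χ R S w) ⟨
      (bit R s 1ℙ * bit R s b) * (parity R S * χ R S w)  ≈⟨ *-cong (bit-flip s b) (sym (χ-antipode S w)) ⟨
      bit R s (b ℙ.+ 1ℙ) * χ R S (antipode w)        ∎

    χ² : ∀ {d} (S w : Word d) → χ R S w * χ R S w ≈ 1#
    χ² []      []      = *-identityˡ 1#
    χ² (s ∷ S) (x ∷ w) = begin
      (bit R s x * χ R S w) * (bit R s x * χ R S w)  ≈⟨ *-assoc (bit R s x) (χ R S w) _ ⟩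
      bit R s x * (χ R S w * (bit R s x * χ R S w))  ≈⟨ *-congˡ (x∙yz≈y∙xz (χ R S w) (bit R s x) (χ R S w)) ⟩
      bit R s x * (bit R s x * (χ R S w * χ R S w))  ≈⟨ *-congˡ (*-congˡ (χ² S w)) ⟩
      bit R s x * (bit R s x * 1#)               ≈⟨ *-congˡ (*-identityʳ (bit R s x)) ⟩
      bit R s x * bit R s x                      ≈⟨ bit² s x ⟩
      1#                                     ∎
      where
      bit² : ∀ s x → bit R s x * bit R s x ≈ 1#
      bit² 0ℙ x  = *-identityˡ 1#
      bit² 1ℙ 0ℙ = *-identityˡ 1#
      bit² 1ℙ 1ℙ = -1*-1

    δ : ∀ {d} → Word d → Word d → Carrier
    δ u v = if does (u ≟ᵂ v) then 1# else 0#

    private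
      indicator-cong : ∀ {a b : Bool} → a ≡ b → (if a then 1# else 0#) ≈ (if b then 1# else 0#)
      indicator-cong ≡.refl = refl

      x+yx : ∀ x y → x + y * x ≈ (1# + y) * x
      x+yx x y = trans (+-congʳ (sym (*-identityˡ x))) (sym (distribʳ x 1# y))

    Σ-χ-δ : ∀ {d} (S w : Word d) → Σ[ words d ] (λ u → χ R S u * δ u w) ≈ χ R S w
    Σ-χ-δ {d} S w = MatrixSums.∑-δ R (𝔽₂^ d) (χ R S) w

    -- Split the neighbours by their first bit. Those that share it see the adjacency matrix of the
    -- smaller cube; those that differ see the identity on the tails and contribute `bit s 1ℙ`, the
    -- new summand of the eigenvalue.
    adjacency-eigen : ∀ {d} (S w : Word d) → Σ[ words d ] (λ u → χ R S u * adjacency R u w) ≈ eigenvalue R S * χ R S w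
    adjacency-eigen []      []      = trans (+-identityʳ _) (trans (zeroʳ 1#) (sym (zeroˡ 1#)))
    adjacency-eigen {suc d} (s ∷ S) (b ∷ w) = begin
      Σ[ words (suc d) ] (λ u → χ R (s ∷ S) u * adjacency R u (b ∷ w))
        ≈⟨ Σ-words d (λ u → χ R (s ∷ S) u * adjacency R u (b ∷ w)) ⟩
      Σ[ words d ] (λ u → (bit R s 0ℙ * χ R S u) * adjacency R (0ℙ ∷ u) (b ∷ w)) + Σ[ words d ] (λ u → (bit R s 1ℙ * χ R S u) * adjacency R (1ℙ ∷ u) (b ∷ w))
        ≈⟨ split b ⟩
      bit R s b * Σ[ words d ] (λ u → χ R S u * adjacency R u w) + bit R s (b ℙ.+ 1ℙ) * Σ[ words d ] (λ u → χ R S u * δ u w)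
        ≈⟨ +-cong (*-congˡ (adjacency-eigen S w)) (*-congˡ (Σ-χ-δ S w)) ⟩
      bit R s b * (eigenvalue R S * χ R S w) + bit R s (b ℙ.+ 1ℙ) * χ R S w
        ≈⟨ +-cong (x∙yz≈y∙xz (bit R s b) (eigenvalue R S) (χ R S w)) (trans (*-congʳ (bit-flip s b)) (*-assoc (bit R s 1ℙ) (bit R s b) (χ R S w))) ⟩
      eigenvalue R S * (bit R s b * χ R S w) + bit R s 1ℙ * (bit R s b * χ R S w)
        ≈⟨ distribʳ (bit R s b * χ R S w) (eigenvalue R S) (bit R s 1ℙ) ⟨
      (eigenvalue R S + bit R s 1ℙ) * (bit R s b * χ R S w)
        ≈⟨ *-congʳ (+-comm (eigenvalue R S) (bit R s 1ℙ)) ⟩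
      (bit R s 1ℙ + eigenvalue R S) * (bit R s b * χ R S w) ∎
      where
      same : ∀ c → Σ[ words d ] (λ u → (c * χ R S u) * adjacency R u w) ≈ c * Σ[ words d ] (λ u → χ R S u * adjacency R u w)
      same c = trans (Σ-cong (words d) (λ u → *-assoc c (χ R S u) (adjacency R u w))) (Σ-*ˡ (words d) c (λ u → χ R S u * adjacency R u w))
      flip : ∀ c → Σ[ words d ] (λ u → (c * χ R S u) * (if differences u w ≡ᵇ 0 then 1# else 0#)) ≈ c * Σ[ words d ] (λ u → χ R S u * δ u w)
      flip c = trans (Σ-cong (words d) (λ u → trans (*-assoc c (χ R S u) _) (*-congˡ (*-congˡ (indicator-cong (does-adjacent-flip u w))))))
        (Σ-*ˡ (words d) c (λ u → χ R S u * δ u w))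
      split : ∀ b →
        Σ[ words d ] (λ u → (bit R s 0ℙ * χ R S u) * adjacency R (0ℙ ∷ u) (b ∷ w)) + Σ[ words d ] (λ u → (bit R s 1ℙ * χ R S u) * adjacency R (1ℙ ∷ u) (b ∷ w))
        ≈ bit R s b * Σ[ words d ] (λ u → χ R S u * adjacency R u w) + bit R s (b ℙ.+ 1ℙ) * Σ[ words d ] (λ u → χ R S u * δ u w)
      split 0ℙ = +-cong (same (bit R s 0ℙ)) (flip (bit R s 1ℙ))
      split 1ℙ = trans (+-comm _ _) (+-cong (same (bit R s 1ℙ)) (flip (bit R s 0ℙ)))

    order : ℕ → Carrier
    order zero    = 1#
    order (suc d) = (1# + 1#) * order d

    -- Summation over the first letter of `S` produces the factor `1 + (-1)^(a + b)`, which is 2 for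
    -- equal first bits and 0 otherwise.
    orthogonality : ∀ {d} (u v : Word d) → Σ[ words d ] (λ S → χ R S u * χ R S v) ≈ order d * δ u v
    orthogonality [] [] = trans (+-identityʳ _) refl
    orthogonality {suc d} (a ∷ u) (b ∷ v) = begin
      Σ[ words (suc d) ] (λ S → χ R S (a ∷ u) * χ R S (b ∷ v))
        ≈⟨ Σ-words d (λ S → χ R S (a ∷ u) * χ R S (b ∷ v)) ⟩
      Σ[ words d ] (λ S → (1# * χ R S u) * (1# * χ R S v)) + Σ[ words d ] (λ S → (bit R 1ℙ a * χ R S u) * (bit R 1ℙ b * χ R S v))
        ≈⟨ +-cong (trans (Σ-cong (words d) (λ S → *-cong (*-identityˡ _) (*-identityˡ _))) (orthogonality u v))
             (trans (Σ-cong (words d) (λ S → regroup (bit R 1ℙ a) (χ R S u) (bit R 1ℙ b) (χ R S v)))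
             (trans (Σ-*ˡ (words d) (bit R 1ℙ a * bit R 1ℙ b) (λ S → χ R S u * χ R S v)) (*-congˡ (orthogonality u v)))) ⟩
      order d * δ u v + (bit R 1ℙ a * bit R 1ℙ b) * (order d * δ u v)
        ≈⟨ combine a b ⟩
      order (suc d) * δ (a ∷ u) (b ∷ v) ∎
      where
      regroup : ∀ a x b y → (a * x) * (b * y) ≈ (a * b) * (x * y)
      regroup a x b y = begin
        (a * x) * (b * y)  ≈⟨ *-assoc a x (b * y) ⟩
        a * (x * (b * y))  ≈⟨ *-congˡ (x∙yz≈y∙xz x b y) ⟩
        a * (b * (x * y))  ≈⟨ *-assoc a b (x * y) ⟨
        (a * b) * (x * y)  ∎
      equal : ∀ p → p ≈ 1# → order d * δ u v + p * (order d * δ u v) ≈ order (suc d) * δ u v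
      equal p p≈1 = trans (x+yx (order d * δ u v) p) (trans (*-congʳ (+-congˡ p≈1)) (sym (*-assoc (1# + 1#) (order d) (δ u v))))
      unequal : ∀ p → p ≈ - 1# → order d * δ u v + p * (order d * δ u v) ≈ order (suc d) * 0#
      unequal p p≈-1 = trans (x+yx (order d * δ u v) p) (trans (*-congʳ (trans (+-congˡ p≈-1) (-‿inverseʳ 1#)))
        (trans (zeroˡ (order d * δ u v)) (sym (zeroʳ (order (suc d))))))
      combine : ∀ a b → order d * δ u v + (bit R 1ℙ a * bit R 1ℙ b) * (order d * δ u v) ≈ order (suc d) * δ (a ∷ u) (b ∷ v)
      combine 0ℙ 0ℙ = equal (1# * 1#) (*-identityˡ 1#)
      combine 0ℙ 1ℙ = unequal (1# * - 1#) (*-identityˡ (- 1#))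
      combine 1ℙ 0ℙ = unequal (- 1# * 1#) (*-identityʳ (- 1#))
      combine 1ℙ 1ℙ = equal (- 1# * - 1#) -1*-1

-- The ring of complex numbers, its limits and the exponential on the imaginary axis.

module ComplexNumbers where
  open import Algebra.Bundles using (CommutativeRing)
  open import Algebra.Bundles.Raw using (RawRing)
  open import Data.Nat as ℕ using (ℕ; zero; suc; _!)
  open import Data.Product using (_×_; _,_; proj₁; proj₂)
  open import Data.Rational as ℚ using (ℚ; 0ℚ; 1ℚ)
  import Data.Rational.Properties as ℚₚ
  open import Data.Rational.Solver using (module +-*-Solver)
  open import Level using (0ℓ)
  open import Relation.Binary.PropositionalEquality using (_≡_; refl; sym; trans; cong; cong₂)
  open import Defs
  open RationalArithmetic using (Σℚ)
  open ExponentialTerms using (κ; σ)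
  open RealAnalysis
  open LinearMaps

  open +-*-Solver using (solve; _:=_; _:+_; _:*_; _:-_; :-_; con)

  sub-cong : ∀ {x x′ y y′} → x ≈ x′ → y ≈ y′ → x - y ≈ x′ - y′
  sub-cong {x} {x′} {y} {y′} p q = ≈-trans (unfold x y) (≈-trans
      (+-cong {x} {x′} { - y} { - y′} p (neg-cong {y} {y′} q)) (≈-sym (unfold x′ y′)))
    where
    unfold : ∀ a b → a - b ≈ a + - b
    unfold a b = ≈-pointwise {a - b} {a + - b} λ n → refl {x = seq a n ℚ.- seq b n}

  infix 4 _≈ᶜ_

  _≈ᶜ_ : ℂ → ℂ → Set
  z ≈ᶜ w = re z ≈ re w × im z ≈ im w

  pointwiseᶜ : ∀ {z w} → (∀ n → seq (re z) n ≡ seq (re w) n) → (∀ n → seq (im z) n ≡ seq (im w) n) → z ≈ᶜ w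
  pointwiseᶜ {z} {w} p q = _,_ (≈-pointwise {re z} {re w} p) (≈-pointwise {im z} {im w} q)

  ℂ-ring : CommutativeRing 0ℓ 0ℓ
  ℂ-ring = record
    { Carrier = ℂ ; _≈_ = _≈ᶜ_ ; _+_ = ℂR._+_ ; _*_ = ℂR._*_ ; -_ = ℂR.-_ ; 0# = ℂR.0# ; 1# = ℂR.1#
    ; isCommutativeRing = record
      { isRing = record
        { +-isAbelianGroup = record
          { isGroup = record
            { isMonoid = record
              { isSemigroup = record
                { isMagma = record
                  { isEquivalence = record
                    { refl  = λ {z} → _,_ (≈-refl {re z}) (≈-refl {im z})
                    ; sym   = λ (p , q) → ≈-sym p , ≈-sym q
                    ; trans = λ (p , q) (r , s) → ≈-trans p r , ≈-trans q s
                    }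
                  ; ∙-cong = λ {z} {z′} {w} {w′} (p , q) (r , s) → _,_
                      (+-cong {re z} {re z′} {re w} {re w′} p r) (+-cong {im z} {im z′} {im w} {im w′} q s)
                  }
                ; assoc = λ x y z → pointwiseᶜ
                    (λ n → ℚₚ.+-assoc (seq (re x) n) (seq (re y) n) (seq (re z) n))
                    (λ n → ℚₚ.+-assoc (seq (im x) n) (seq (im y) n) (seq (im z) n))
                }
              ; identity = (λ x → pointwiseᶜ (λ n → ℚₚ.+-identityˡ (seq (re x) n)) (λ n → ℚₚ.+-identityˡ (seq (im x) n)))
                         , (λ x → pointwiseᶜ (λ n → ℚₚ.+-identityʳ (seq (re x) n)) (λ n → ℚₚ.+-identityʳ (seq (im x) n)))
              }
            ; inverse = (λ x → pointwiseᶜ (λ n → ℚₚ.+-inverseˡ (seq (re x) n)) (λ n → ℚₚ.+-inverseˡ (seq (im x) n)))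
                      , (λ x → pointwiseᶜ (λ n → ℚₚ.+-inverseʳ (seq (re x) n)) (λ n → ℚₚ.+-inverseʳ (seq (im x) n)))
            ; ⁻¹-cong = λ {z} {w} (p , q) → _,_ (neg-cong {re z} {re w} p) (neg-cong {im z} {im w} q)
            }
          ; comm = λ x y → pointwiseᶜ (λ n → ℚₚ.+-comm (seq (re x) n) (seq (re y) n)) (λ n → ℚₚ.+-comm (seq (im x) n) (seq (im y) n))
          }
        ; *-cong = λ {z} {z′} {w} {w′} (p , q) (r , s) → _,_
            (sub-cong {re z * re w} {re z′ * re w′} {im z * im w} {im z′ * im w′} (*-cong {re z} {re z′} {re w} {re w′} p r) (*-cong {im z} {im z′} {im w} {im w′} q s))
            (+-cong {re z * im w} {re z′ * im w′} {im z * re w} {im z′ * re w′} (*-cong {re z} {re z′} {im w} {im w′} p s) (*-cong {im z} {im z′} {re w} {re w′} q r))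
        ; *-assoc = λ x y z → pointwiseᶜ
            (λ n → solve 6 (λ a b c d e f → (a :* c :- b :* d) :* e :- (a :* d :+ b :* c) :* f := a :* (c :* e :- d :* f) :- b :* (c :* f :+ d :* e)) refl
              (seq (re x) n) (seq (im x) n) (seq (re y) n) (seq (im y) n) (seq (re z) n) (seq (im z) n))
            (λ n → solve 6 (λ a b c d e f → (a :* c :- b :* d) :* f :+ (a :* d :+ b :* c) :* e := a :* (c :* f :+ d :* e) :+ b :* (c :* e :- d :* f)) refl
              (seq (re x) n) (seq (im x) n) (seq (re y) n) (seq (im y) n) (seq (re z) n) (seq (im z) n))
        ; *-identity =
            (λ x → pointwiseᶜ
              (λ n → solve 2 (λ a b → con 1ℚ :* a :- con 0ℚ :* b := a) refl (seq (re x) n) (seq (im x) n))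
              (λ n → solve 2 (λ a b → con 1ℚ :* b :+ con 0ℚ :* a := b) refl (seq (re x) n) (seq (im x) n)))
          , (λ x → pointwiseᶜ
              (λ n → solve 2 (λ a b → a :* con 1ℚ :- b :* con 0ℚ := a) refl (seq (re x) n) (seq (im x) n))
              (λ n → solve 2 (λ a b → a :* con 0ℚ :+ b :* con 1ℚ := b) refl (seq (re x) n) (seq (im x) n)))
        ; distrib =
            (λ x y z → pointwiseᶜ
              (λ n → solve 6 (λ a b c d e f → a :* (c :+ e) :- b :* (d :+ f) := (a :* c :- b :* d) :+ (a :* e :- b :* f)) refl
                (seq (re x) n) (seq (im x) n) (seq (re y) n) (seq (im y) n) (seq (re z) n) (seq (im z) n))
              (λ n → solve 6 (λ a b c d e f → a :* (d :+ f) :+ b :* (c :+ e) := (a :* d :+ b :* c) :+ (a :* f :+ b :* e)) refl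
                (seq (re x) n) (seq (im x) n) (seq (re y) n) (seq (im y) n) (seq (re z) n) (seq (im z) n)))
          , (λ x y z → pointwiseᶜ
              (λ n → solve 6 (λ a b c d e f → (c :+ e) :* a :- (d :+ f) :* b := (c :* a :- d :* b) :+ (e :* a :- f :* b)) refl
                (seq (re x) n) (seq (im x) n) (seq (re y) n) (seq (im y) n) (seq (re z) n) (seq (im z) n))
              (λ n → solve 6 (λ a b c d e f → (c :+ e) :* b :+ (d :+ f) :* a := (c :* b :+ d :* a) :+ (e :* b :+ f :* a)) refl
                (seq (re x) n) (seq (im x) n) (seq (re y) n) (seq (im y) n) (seq (re z) n) (seq (im z) n)))
        }
      ; *-comm = λ x y → pointwiseᶜ
          (λ n → solve 4 (λ a b c d → a :* c :- b :* d := c :* a :- d :* b) refl (seq (re x) n) (seq (im x) n) (seq (re y) n) (seq (im y) n))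
          (λ n → solve 4 (λ a b c d → a :* d :+ b :* c := c :* b :+ d :* a) refl (seq (re x) n) (seq (im x) n) (seq (re y) n) (seq (im y) n))
      }
    }

  infix 4 _⇝ᶜ_

  record _⇝ᶜ_ (s : ℕ → ℂ) (ℓ : ℂ) : Set where
    constructor mk⇝ᶜ
    field
      re⇝ : (λ n → re (s n)) ⇝ re ℓ
      im⇝ : (λ n → im (s n)) ⇝ im ℓ

  open _⇝ᶜ_ public

  ⇝ᶜ-unique : ∀ {s ℓ m} → s ⇝ᶜ ℓ → s ⇝ᶜ m → ℓ ≈ᶜ m
  ⇝ᶜ-unique (mk⇝ᶜ p q) (mk⇝ᶜ p′ q′) = _,_ (⇝-unique p p′) (⇝-unique q q′)

  ⇝ᶜ-cong : ∀ (s t : ℕ → ℂ) ℓ m → (∀ n → s n ≈ᶜ t n) → ℓ ≈ᶜ m → s ⇝ᶜ ℓ → t ⇝ᶜ m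
  ⇝ᶜ-cong s t ℓ m s≈t ℓ≈m (mk⇝ᶜ p q) = mk⇝ᶜ
    (⇝-cong {λ n → re (s n)} {λ n → re (t n)} {re ℓ} {re m} (λ n → proj₁ (s≈t n)) (proj₁ ℓ≈m) p)
    (⇝-cong {λ n → im (s n)} {λ n → im (t n)} {im ℓ} {im m} (λ n → proj₂ (s≈t n)) (proj₂ ℓ≈m) q)

  ⟶ᶜ⇒⇝ᶜ : ∀ {s ℓ} → s ⟶ᶜ ℓ → s ⇝ᶜ ℓ
  ⟶ᶜ⇒⇝ᶜ {s} {ℓ} (p , q) = mk⇝ᶜ (⟶⇒⇝ {λ n → re (s n)} {re ℓ} p) (⟶⇒⇝ {λ n → im (s n)} {im ℓ} q)

  ⇝ᶜ⇒⟶ᶜ : ∀ {s ℓ} → s ⇝ᶜ ℓ → s ⟶ᶜ ℓ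
  ⇝ᶜ⇒⟶ᶜ (mk⇝ᶜ p q) = ⇝⇒⟶ p , ⇝⇒⟶ q

  ℂ-limits : Limits ℂ-ring
  ℂ-limits = record
    { _⇝_    = _⇝ᶜ_
    ; ⇝-cong = λ {s} {t} {ℓ} {m} → ⇝ᶜ-cong s t ℓ m
    ; ⇝-unique = λ {s} {ℓ} {m} → ⇝ᶜ-unique {s} {ℓ} {m}
    ; ⇝-0    = mk⇝ᶜ (⇝-const {0ℝ}) (⇝-const {0ℝ})
    ; ⇝-+    = λ {s} {t} {ℓ} {m} (mk⇝ᶜ p q) (mk⇝ᶜ r u) → mk⇝ᶜ
        (⇝-+ {λ n → re (s n)} {λ n → re (t n)} {re ℓ} {re m} p r) (⇝-+ {λ n → im (s n)} {λ n → im (t n)} {im ℓ} {im m} q u)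
    ; ⇝-*ˡ   = λ c {s} {ℓ} (mk⇝ᶜ p q) → mk⇝ᶜ
        (⇝-cong {λ n → re c * re (s n) + - (im c * im (s n))} {λ n → re c * re (s n) - im c * im (s n)}
                {re c * re ℓ + - (im c * im ℓ)} {re c * re ℓ - im c * im ℓ}
          (λ n → sub (re c * re (s n)) (im c * im (s n))) (sub (re c * re ℓ) (im c * im ℓ))
          (⇝-+ {λ n → re c * re (s n)} {λ n → - (im c * im (s n))} {re c * re ℓ} { - (im c * im ℓ)}
            (⇝-*ˡ (re c) {λ n → re (s n)} {re ℓ} p) (⇝-neg {λ n → im c * im (s n)} {im c * im ℓ} (⇝-*ˡ (im c) {λ n → im (s n)} {im ℓ} q))))
        (⇝-+ {λ n → re c * im (s n)} {λ n → im c * re (s n)} {re c * im ℓ} {im c * re ℓ}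
          (⇝-*ˡ (re c) {λ n → im (s n)} {im ℓ} q) (⇝-*ˡ (im c) {λ n → re (s n)} {re ℓ} p))
    }
    where
    sub : ∀ a b → a + - b ≈ a - b
    sub a b = ≈-pointwise {a + - b} {a - b} λ n → refl {x = seq a n ℚ.- seq b n}

  ℝ↪ℂ : Embedding ℝ-ring ℂ-ring
  ℝ↪ℂ = record
    { h      = fromℝ
    ; h-cong = λ p → _,_ p (≈-refl {0ℝ})
    ; h-0    = _,_ (≈-refl {0ℝ}) (≈-refl {0ℝ})
    ; h-1    = _,_ (≈-refl {1ℝ}) (≈-refl {0ℝ})
    ; h-+    = λ x y → pointwiseᶜ (λ n → refl {x = seq x n ℚ.+ seq y n}) (λ n → refl {x = 0ℚ})
    ; h-*    = λ x y → pointwiseᶜ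
        (λ n → solve 2 (λ x y → x :* y := x :* y :- con 0ℚ :* con 0ℚ) refl (seq x n) (seq y n))
        (λ n → solve 2 (λ x y → con 0ℚ := x :* con 0ℚ :+ con 0ℚ :* y) refl (seq x n) (seq y n))
    }

  private
    module Cx = CommutativeRing ℂ-ring

  -- (-iθ)ʲ = θʲ (κ j - i σ j), where κ j + i σ j = iʲ.
  -iθ^ : ∀ {z θ} → z ≈ᶜ (0ℝ +i - θ) → ∀ j → power ℂ-ring z j ≈ᶜ (fromℚ (κ j) * θ ^ j +i - (fromℚ (σ j) * θ ^ j))
  -iθ^ {z} {θ} z≈ = go
    where
    Claim : ℕ → Set
    Claim j = power ℂ-ring z j ≈ᶜ (fromℚ (κ j) * θ ^ j +i - (fromℚ (σ j) * θ ^ j))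
    multiply : ∀ j → (0ℝ +i - θ) ℂR.* (fromℚ (κ j) * θ ^ j +i - (fromℚ (σ j) * θ ^ j))
      ≈ᶜ (fromℚ (κ (suc j)) * θ ^ suc j +i - (fromℚ (σ (suc j)) * θ ^ suc j))
    multiply j = pointwiseᶜ
      {(0ℝ +i - θ) ℂR.* (fromℚ (κ j) * θ ^ j +i - (fromℚ (σ j) * θ ^ j))}
      {fromℚ (κ (suc j)) * θ ^ suc j +i - (fromℚ (σ (suc j)) * θ ^ suc j)}
      (λ n → solve 4 (λ t k s p → con 0ℚ :* (k :* p) :- (:- t) :* (:- (s :* p)) := (:- s) :* (t :* p)) refl
        (seq θ n) (κ j) (σ j) (seq (θ ^ j) n))
      (λ n → solve 4 (λ t k s p → con 0ℚ :* (:- (s :* p)) :+ (:- t) :* (k :* p) := :- (k :* (t :* p))) refl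
        (seq θ n) (κ j) (σ j) (seq (θ ^ j) n))
    step : ∀ j → Claim j → Claim (suc j)
    step j ih = Cx.trans
      {power ℂ-ring z (suc j)} {(0ℝ +i - θ) ℂR.* (fromℚ (κ j) * θ ^ j +i - (fromℚ (σ j) * θ ^ j))}
      {fromℚ (κ (suc j)) * θ ^ suc j +i - (fromℚ (σ (suc j)) * θ ^ suc j)}
      (Cx.*-cong {z} {0ℝ +i - θ} {power ℂ-ring z j} {fromℚ (κ j) * θ ^ j +i - (fromℚ (σ j) * θ ^ j)} z≈ ih)
      (multiply j)
    go : ∀ j → Claim j
    go zero    = pointwiseᶜ (λ n → refl {x = 1ℚ}) (λ n → refl {x = 0ℚ})
    go (suc j) = step j (go j)

  expTerm : ℂ → ℕ → ℂ
  expTerm z j = CommutativeRing._*_ ℂ-ring (fromℝ (fromℚ (1/ j !))) (power ℂ-ring z j)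

  expTerm≈ : ∀ {z θ} → z ≈ᶜ (0ℝ +i - θ) → ∀ j → expTerm z j ≈ᶜ (Cos.seriesTerm θ j +i - Sin.seriesTerm θ j)
  expTerm≈ {z} {θ} z≈ j = Cx.trans
      {fromℝ (fromℚ (1/ j !)) ℂR.* power ℂ-ring z j}
      {fromℝ (fromℚ (1/ j !)) ℂR.* (fromℚ (κ j) * θ ^ j +i - (fromℚ (σ j) * θ ^ j))}
      {Cos.seriesTerm θ j +i - Sin.seriesTerm θ j}
      (Cx.*-cong {fromℝ (fromℚ (1/ j !))} {fromℝ (fromℚ (1/ j !))} {power ℂ-ring z j} {fromℚ (κ j) * θ ^ j +i - (fromℚ (σ j) * θ ^ j)}
        (Cx.refl {fromℝ (fromℚ (1/ j !))}) (-iθ^ {z} {θ} z≈ j))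
      expand
    where
    expand : fromℝ (fromℚ (1/ j !)) ℂR.* (fromℚ (κ j) * θ ^ j +i - (fromℚ (σ j) * θ ^ j)) ≈ᶜ (Cos.seriesTerm θ j +i - Sin.seriesTerm θ j)
    expand = pointwiseᶜ
      {fromℝ (fromℚ (1/ j !)) ℂR.* (fromℚ (κ j) * θ ^ j +i - (fromℚ (σ j) * θ ^ j))} {Cos.seriesTerm θ j +i - Sin.seriesTerm θ j}
      (λ n → solve 4 (λ f k s p → f :* (k :* p) :- con 0ℚ :* (:- (s :* p)) := k :* (f :* p)) refl
        (1/ j !) (κ j) (σ j) (seq (θ ^ j) n))
      (λ n → solve 4 (λ f k s p → f :* (:- (s :* p)) :+ con 0ℚ :* (k :* p) := :- (s :* (f :* p))) refl
        (1/ j !) (κ j) (σ j) (seq (θ ^ j) n))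

  seq-re-Σ : ∀ z n m → seq (re (partialSum ℂ-rawRing z n)) m ≡ Σℚ (λ j → seq (re (z j)) m) n
  seq-re-Σ z zero    m = refl {x = 0ℚ}
  seq-re-Σ z (suc n) m = cong (seq (re (z 0)) m ℚ.+_) (seq-re-Σ (λ j → z (suc j)) n m)

  seq-im-Σ : ∀ z n m → seq (im (partialSum ℂ-rawRing z n)) m ≡ Σℚ (λ j → seq (im (z j)) m) n
  seq-im-Σ z zero    m = refl {x = 0ℚ}
  seq-im-Σ z (suc n) m = cong (seq (im (z 0)) m ℚ.+_) (seq-im-Σ (λ j → z (suc j)) n m)

  Σℚ-neg : ∀ a n → Σℚ (λ j → ℚ.- a j) n ≡ ℚ.- Σℚ a n
  Σℚ-neg a zero    = refl
  Σℚ-neg a (suc n) = trans (cong (ℚ.- a 0 ℚ.+_) (Σℚ-neg (λ j → a (suc j)) n)) (sym (ℚₚ.neg-distrib-+ (a 0) _))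

  partialSum-split : ∀ (s t : ℕ → ℝ) n →
    partialSum ℂ-rawRing (λ j → s j +i - t j) n ≈ᶜ (partialSum ℝ-rawRing s n +i - partialSum ℝ-rawRing t n)
  partialSum-split s t n = pointwiseᶜ
    {partialSum ℂ-rawRing (λ j → s j +i - t j) n} {partialSum ℝ-rawRing s n +i - partialSum ℝ-rawRing t n}
    (λ m → trans (seq-re-Σ (λ j → s j +i - t j) n m) (sym (seq-Σ s n m)))
    (λ m → trans (seq-im-Σ (λ j → s j +i - t j) n m)
      (trans (Σℚ-neg (λ j → seq (t j) m) n) (cong ℚ.-_ (sym (seq-Σ t n m)))))

  -- Euler's formula for `exp (-iθ)`. The exponent is given only up to `≈ᶜ`, because it arises as a
  -- product of `-iτ` with an embedded real.
  exp-limit : ∀ {z θ} → z ≈ᶜ (0ℝ +i - θ) → (λ n → partialSum (raw ℂ-ring) (expTerm z) n) ⇝ᶜ (cos θ +i - sin θ)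
  exp-limit {z} {θ} z≈ = Limits.⇝-cong ℂ-limits
    {λ n → Cos.seriesSum θ n +i - Sin.seriesSum θ n} {λ n → partialSum (raw ℂ-ring) (expTerm z) n}
    {cos θ +i - sin θ} {cos θ +i - sin θ}
    (λ n → Cx.sym {partialSum (raw ℂ-ring) (expTerm z) n} {Cos.seriesSum θ n +i - Sin.seriesSum θ n}
      (Cx.trans {partialSum (raw ℂ-ring) (expTerm z) n} {partialSum (raw ℂ-ring) (λ j → Cos.seriesTerm θ j +i - Sin.seriesTerm θ j) n}
        (Sums.partialSum-cong ℂ-ring (expTerm≈ {z} {θ} z≈) n)
        (partialSum-split (Cos.seriesTerm θ) (Sin.seriesTerm θ) n)))
    (_,_ (≈-refl {cos θ}) (≈-refl { - sin θ}))
    (mk⇝ᶜ (Cos.series-limit θ) (⇝-neg {Sin.seriesSum θ} {sin θ} (Sin.series-limit θ)))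

-- Exponentials of powers of the adjacency matrix, and signs of characters.

module CubeSpectrum where
  open import Algebra.Bundles using (CommutativeRing)
  import Algebra.Properties.Ring as RingProperties
  open import Data.Bool using (true; false; if_then_else_)
  open import Data.Integer using (ℤ)
  import Data.Integer as ℤ
  import Data.Integer.Properties as ℤₚ
  open import Data.Nat using (ℕ; zero; suc)
  import Data.Nat as ℕ
  open import Data.Parity using (0ℙ; 1ℙ)
  open import Data.Vec using ([]; _∷_)
  open import Level using (0ℓ)
  import Relation.Binary.PropositionalEquality as ≡
  import Relation.Binary.Reasoning.Setoid as SetoidReasoning
  open import Relation.Nullary using (does)
  open import Defs using (Word; words; _≟ᵂ_; 𝔽₂^; antipode; partialSum; module LinearAlgebra)
  open LinearMaps
  open CubeCharacters

  -- The basis vectors `δᴮ` enter as a parameter tied to the indicator by `≈` alone, so that those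
  -- of the statement can be supplied without unfolding.
  module Hypercubeᴿ
    (A B : CommutativeRing 0ℓ 0ℓ) (H : Embedding A B) (L : Limits B) (d k : ℕ)
    (½ : CommutativeRing.Carrier A)
    (½*2 : CommutativeRing._≈_ A
      (CommutativeRing._*_ A ½ (CommutativeRing._+_ A (CommutativeRing.1# A) (CommutativeRing.1# A))) (CommutativeRing.1# A))
    (c : CommutativeRing.Carrier B) (f : ℕ → CommutativeRing.Carrier B)
    (δᴮ : Word d → Word d → CommutativeRing.Carrier B)
    (δᴮ≈ : ∀ u v → CommutativeRing._≈_ B (δᴮ u v) (if does (u ≟ᵂ v) then CommutativeRing.1# B else CommutativeRing.0# B))
    where
    private
      module A = CommutativeRing A
      module ΣA = Sums A
      module MA = MatrixSums A (𝔽₂^ d)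
    open CommutativeRing B
    open SetoidReasoning setoid
    open Embedding H
    open Limits L
    open Characters A
    open Sums B using (x∙yz≈y∙xz)

    K : Word d → Word d → A.Carrier
    K = LinearAlgebra._^ᴹ_ (raw A) (𝔽₂^ d) (adjacency A) k

    K-eigen : ∀ S w → ΣA.Σ[ words d ] (λ u → χ A S u A.* K u w) A.≈ power A (eigenvalue A S) k A.* χ A S w
    K-eigen S w = MA.eigen-power (adjacency A) (χ A S) (eigenvalue A S) (adjacency-eigen S) k w

    open Diagonalisation A B H L (𝔽₂^ d) K (χ A) (λ S → power A (eigenvalue A S) k) K-eigen c f

    order⁻¹ : ℕ → A.Carrier
    order⁻¹ zero    = A.1#
    order⁻¹ (suc n) = ½ A.* order⁻¹ n

    order⁻¹-inverse : ∀ n → order⁻¹ n A.* order n A.≈ A.1#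
    order⁻¹-inverse zero    = A.*-identityˡ A.1#
    order⁻¹-inverse (suc n) = A.trans (A.*-assoc ½ (order⁻¹ n) _) (A.trans (A.*-congˡ (ΣA.x∙yz≈y∙xz (order⁻¹ n) (A.1# A.+ A.1#) (order n)))
      (A.trans (A.sym (A.*-assoc ½ (A.1# A.+ A.1#) _)) (A.trans (A.*-cong ½*2 (order⁻¹-inverse n)) (A.*-identityˡ A.1#))))

    indicator : ∀ u v → h (MA.e u v) ≈ (if does (u ≟ᵂ v) then 1# else 0#)
    indicator u v with does (u ≟ᵂ v)
    ... | true  = h-1
    ... | false = h-0

    open Inversion (order d) (order⁻¹ d) (order⁻¹-inverse d) orthogonality indicator

    -- The exponential series of an eigenvalue A and of the matrix itself
    spectralSum : Word d → ℕ → Carrier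
    spectralSum S = partialSum (raw B) (λ j → f j * power B (c * h (power A (eigenvalue A S) k)) j)

    matrixSum : ℕ → Word d → Word d → Carrier
    matrixSum n u v = partialSum (raw B) (λ j → f j * LinearAlgebra._^ᴹ_ (raw B) (𝔽₂^ d) (λ u v → c * h (K u v)) j u v) n

    -- If each spectral exponential is `γ` times the sign of its character, then the whole matrix
    -- exponential is `γ` times the permutation matrix of the antipode.
    matrixSum-limit : ∀ γ (E : Word d → Carrier) → (∀ S → spectralSum S ⇝ E S) → (∀ S → E S ≈ γ * h (parity A S)) →
      ∀ u w → (λ n → matrixSum n u w) ⇝ γ * δᴮ (antipode w) u
    matrixSum-limit γ E lim E≈ u w = ⇝-cong (λ _ → refl) (*-congˡ (sym (δᴮ≈ (antipode w) u)))
      (expSum-limit antipode γ (λ S → h (parity A S))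
        (λ S w → trans (sym (h-* (parity A S) (χ A S w))) (h-cong (χ-antipode S w)))
        (λ S → ⇝-cong (λ _ → refl) (E≈ S) (lim S)) u w)

    -- The antipode only changes `χ S x` by the sign `parity S`, and `χ S x` squares to 1, so it can
    -- be cancelled from both sides.
    spectralSum-limit : ∀ γ x (E : Word d → Carrier) → (∀ u → (λ n → matrixSum n u x) ⇝ E u) →
      (∀ u → E u ≈ γ * δᴮ (antipode x) u) → ∀ S → spectralSum S ⇝ γ * h (parity A S)
    spectralSum-limit γ x E lim E≈ S = ⇝-cong
      (λ n → cancel-χ (spectralSum S n))
      (begin
        h (χ A S x) * (γ * h (χ A S (antipode x)))              ≈⟨ *-congˡ (*-congˡ (h-cong (χ-antipode S x))) ⟨
        h (χ A S x) * (γ * h (parity A S A.* χ A S x))          ≈⟨ *-congˡ (*-congˡ (trans (h-* (parity A S) (χ A S x)) (*-comm (h (parity A S)) (h (χ A S x))))) ⟩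
        h (χ A S x) * (γ * (h (χ A S x) * h (parity A S)))      ≈⟨ *-congˡ (x∙yz≈y∙xz γ (h (χ A S x)) (h (parity A S))) ⟩
        h (χ A S x) * (h (χ A S x) * (γ * h (parity A S)))      ≈⟨ cancel-χ (γ * h (parity A S)) ⟩
        γ * h (parity A S)                                      ∎)
      (⇝-*ˡ (h (χ A S x)) (scalarSum-limit E lim (λ u → trans (E≈ u) (*-congˡ (δᴮ≈ (antipode x) u))) S))
      where
      cancel-χ : ∀ y → h (χ A S x) * (h (χ A S x) * y) ≈ y
      cancel-χ y = begin
        h (χ A S x) * (h (χ A S x) * y)  ≈⟨ *-assoc (h (χ A S x)) (h (χ A S x)) y ⟨
        h (χ A S x) * h (χ A S x) * y    ≈⟨ *-congʳ (h-* (χ A S x) (χ A S x)) ⟨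
        h (χ A S x A.* χ A S x) * y      ≈⟨ *-congʳ (trans (h-cong (χ² S x)) h-1) ⟩
        1# * y                           ≈⟨ *-identityˡ y ⟩
        y                                ∎

    -- Comparing two characters of opposite sign eliminates the unknown phase `γ`. This is the only
    -- consequence of transfer that the lower bounds and the impossibility use.
    limits-opposite : ∀ γ x (E : Word d → Carrier) → (∀ u → (λ n → matrixSum n u x) ⇝ E u) →
      (∀ u → E u ≈ γ * δᴮ (antipode x) u) → (F : Word d → Carrier) → (∀ S → spectralSum S ⇝ F S) →
      ∀ S T → parity A T A.≈ A.- parity A S → F T ≈ - F S
    limits-opposite γ x E lim E≈ F limF S T T≈-S = begin
      F T                          ≈⟨ F≈ T ⟩
      γ * h (parity A T)           ≈⟨ *-congˡ (h-cong T≈-S) ⟩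
      γ * h (A.- parity A S)       ≈⟨ *-congˡ (h-neg (parity A S)) ⟩
      γ * - h (parity A S)         ≈⟨ RingProperties.-‿distribʳ-* ring γ (h (parity A S)) ⟨
      - (γ * h (parity A S))       ≈⟨ -‿cong (F≈ S) ⟨
      - F S                        ∎
      where
      F≈ : ∀ S → F S ≈ γ * h (parity A S)
      F≈ S = ⇝-unique (limF S) (spectralSum-limit γ x E lim E≈ S)
      h-neg : ∀ y → h (A.- y) ≈ - h y
      h-neg y = RingProperties.+-inverseˡ-unique ring (h (A.- y)) (h y) (trans (sym (h-+ (A.- y) y)) (trans (h-cong (A.-‿inverseˡ y)) h-0))

  module EmbeddingProperties (A B : CommutativeRing 0ℓ 0ℓ) (H : Embedding A B) where
    private
      module A = CommutativeRing A
    open CommutativeRing B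
    open RingProperties ring
    open SetoidReasoning setoid
    open Embedding H
    open Characters B

    h-‿-1 : h (A.- A.1#) ≈ - 1#
    h-‿-1 = begin
      h (A.- A.1#)                     ≈⟨ +-identityʳ _ ⟨
      h (A.- A.1#) + 0#                ≈⟨ +-congˡ (-‿inverseʳ 1#) ⟨
      h (A.- A.1#) + (1# + - 1#)       ≈⟨ +-assoc _ 1# (- 1#) ⟨
      h (A.- A.1#) + 1# + - 1#         ≈⟨ +-congʳ (+-congˡ h-1) ⟨
      h (A.- A.1#) + h A.1# + - 1#     ≈⟨ +-congʳ (h-+ (A.- A.1#) A.1#) ⟨
      h (A.- A.1# A.+ A.1#) + - 1#     ≈⟨ +-congʳ (trans (h-cong (A.-‿inverseˡ A.1#)) h-0) ⟩
      0# + - 1#                        ≈⟨ +-identityˡ (- 1#) ⟩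
      - 1#                             ∎

    h-bit : ∀ s x → h (bit A s x) ≈ bit B s x
    h-bit 0ℙ x  = h-1
    h-bit 1ℙ 0ℙ = h-1
    h-bit 1ℙ 1ℙ = h-‿-1

    h-eigenvalue : ∀ {d} (S : Word d) → h (eigenvalue A S) ≈ eigenvalue B S
    h-eigenvalue []      = h-0
    h-eigenvalue (s ∷ S) = trans (h-+ (bit A s 1ℙ) (eigenvalue A S)) (+-cong (h-bit s 1ℙ) (h-eigenvalue S))

    h-power : ∀ x k → h (power A x k) ≈ power B (h x) k
    h-power x zero    = h-1
    h-power x (suc k) = trans (h-* x (power A x k)) (*-congˡ (h-power x k))

    power-cong : ∀ {x y} → x ≈ y → ∀ k → power B x k ≈ power B y k
    power-cong x≈y zero    = refl
    power-cong x≈y (suc k) = *-cong x≈y (power-cong x≈y k)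

    h-eigenvalue-power : ∀ {d} (S : Word d) k → h (power A (eigenvalue A S) k) ≈ power B (eigenvalue B S) k
    h-eigenvalue-power S k = trans (h-power (eigenvalue A S) k) (power-cong (h-eigenvalue S) k)

  -- The eigenvalues as integers, where congruences modulo 4 can be stated.
  λᶻ : ∀ {d} → Word d → ℤ
  λᶻ = eigenvalue ℤₚ.+-*-commutativeRing

  -- Covers cosine and sine at multiples of `π/2` together: both change sign when the multiple grows
  -- by 2.
  module Antiperiodic (R : CommutativeRing 0ℓ 0ℓ) (g : ℤ → CommutativeRing.Carrier R)
    (g-+2 : ∀ m → CommutativeRing._≈_ R (g (m ℤ.+ ℤ.+ 2)) (CommutativeRing.-_ R (g m))) where
    open CommutativeRing R
    open RingProperties ring
    open SetoidReasoning setoid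
    open Characters R

    private
      g-≡ : ∀ {m n} → m ≡.≡ n → g m ≈ g n
      g-≡ ≡.refl = refl

    g-+4* : ∀ m n → g (m ℤ.+ ℤ.+ (n ℕ.* 4)) ≈ g m
    g-+4* m zero    = g-≡ (ℤₚ.+-identityʳ m)
    g-+4* m (suc n) = begin
      g (m ℤ.+ ℤ.+ (4 ℕ.+ n ℕ.* 4))                      ≈⟨ g-≡ (shift m (ℤ.+ (n ℕ.* 4))) ⟩
      g (m ℤ.+ ℤ.+ (n ℕ.* 4) ℤ.+ ℤ.+ 2 ℤ.+ ℤ.+ 2)        ≈⟨ g-+2 _ ⟩
      - g (m ℤ.+ ℤ.+ (n ℕ.* 4) ℤ.+ ℤ.+ 2)                ≈⟨ -‿cong (g-+2 _) ⟩
      - - g (m ℤ.+ ℤ.+ (n ℕ.* 4))                        ≈⟨ -‿involutive _ ⟩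
      g (m ℤ.+ ℤ.+ (n ℕ.* 4))                            ≈⟨ g-+4* m n ⟩
      g m                                                ∎
      where
      shift : ∀ m z → m ℤ.+ (ℤ.+ 4 ℤ.+ z) ≡.≡ m ℤ.+ z ℤ.+ ℤ.+ 2 ℤ.+ ℤ.+ 2
      shift m z = ≡.trans (≡.cong (λ y → m ℤ.+ y) (ℤₚ.+-comm (ℤ.+ 4) z))
        (≡.trans (≡.sym (ℤₚ.+-assoc m z (ℤ.+ 4))) (≡.sym (ℤₚ.+-assoc (m ℤ.+ z) (ℤ.+ 2) (ℤ.+ 2))))

    g-mod4 : ∀ m z → g (m ℤ.+ z ℤ.* ℤ.+ 4) ≈ g m
    g-mod4 m (ℤ.+ n)    = trans (g-≡ (≡.cong (λ y → m ℤ.+ y) (≡.sym (ℤₚ.pos-* n 4)))) (g-+4* m n)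
    g-mod4 m ℤ.-[1+ n ] = sym (trans (g-≡ back) (g-+4* (m ℤ.+ ℤ.-[1+ n ] ℤ.* ℤ.+ 4) (suc n)))
      where
      back : m ≡.≡ m ℤ.+ ℤ.-[1+ n ] ℤ.* ℤ.+ 4 ℤ.+ ℤ.+ (suc n ℕ.* 4)
      back = ≡.sym (≡.trans (ℤₚ.+-assoc m (ℤ.-[1+ n ] ℤ.* ℤ.+ 4) (ℤ.+ (suc n ℕ.* 4)))
        (≡.trans (≡.cong (λ y → m ℤ.+ y) (≡.trans (≡.cong (λ y → ℤ.-[1+ n ] ℤ.* ℤ.+ 4 ℤ.+ y) (ℤₚ.pos-* (suc n) 4))
          (≡.trans (≡.sym (ℤₚ.*-distribʳ-+ (ℤ.+ 4) ℤ.-[1+ n ] (ℤ.+ suc n)))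
            (≡.cong (λ y → y ℤ.* ℤ.+ 4) (ℤₚ.+-inverseˡ (ℤ.+ suc n)))))) (ℤₚ.+-identityʳ m)))

    -- The eigenvalue is `d - 2|S|`, so the sign changes `|S|` times. The offset `z` collects the
    -- letters already read and makes the induction go through.
    g-word : ∀ {d} (S : Word d) z → g (λᶻ S ℤ.+ z) ≈ parity R S * g (ℤ.+ d ℤ.+ z)
    g-word []           z = sym (*-identityˡ _)
    g-word {suc d} (0ℙ ∷ S) z = begin
      g (ℤ.+ 1 ℤ.+ λᶻ S ℤ.+ z)                      ≈⟨ g-≡ (swap (ℤ.+ 1) (λᶻ S)) ⟩
      g (λᶻ S ℤ.+ (ℤ.+ 1 ℤ.+ z))                    ≈⟨ g-word S (ℤ.+ 1 ℤ.+ z) ⟩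
      parity R S * g (ℤ.+ d ℤ.+ (ℤ.+ 1 ℤ.+ z))        ≈⟨ *-cong (*-identityˡ (parity R S)) (g-≡ (swap (ℤ.+ 1) (ℤ.+ d))) ⟨
      1# * parity R S * g (ℤ.+ suc d ℤ.+ z)           ∎
      where
      swap : ∀ a b → a ℤ.+ b ℤ.+ z ≡.≡ b ℤ.+ (a ℤ.+ z)
      swap a b = ≡.trans (≡.cong (λ y → y ℤ.+ z) (ℤₚ.+-comm a b)) (ℤₚ.+-assoc b a z)
    g-word {suc d} (1ℙ ∷ S) z = begin
      g (ℤ.- ℤ.+ 1 ℤ.+ λᶻ S ℤ.+ z)                        ≈⟨ g-≡ (≡.trans (≡.cong (λ y → y ℤ.+ z) (ℤₚ.+-comm (ℤ.- ℤ.+ 1) (λᶻ S))) (ℤₚ.+-assoc (λᶻ S) (ℤ.- ℤ.+ 1) z)) ⟩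
      g (λᶻ S ℤ.+ (ℤ.- ℤ.+ 1 ℤ.+ z))                      ≈⟨ g-word S (ℤ.- ℤ.+ 1 ℤ.+ z) ⟩
      parity R S * g n                                      ≈⟨ *-congˡ (trans (-‿cong (g-+2 n)) (-‿involutive (g n))) ⟨
      parity R S * - g (n ℤ.+ ℤ.+ 2)                        ≈⟨ *-congˡ (-‿cong (g-≡ up)) ⟩
      parity R S * - g (ℤ.+ suc d ℤ.+ z)                    ≈⟨ sym (-‿distribʳ-* (parity R S) _) ⟩
      - (parity R S * g (ℤ.+ suc d ℤ.+ z))                  ≈⟨ trans (*-assoc (- 1#) (parity R S) _) (-1*x≈-x _) ⟨
      - 1# * parity R S * g (ℤ.+ suc d ℤ.+ z)               ∎
      where
      n : ℤ
      n = ℤ.+ d ℤ.+ (ℤ.- ℤ.+ 1 ℤ.+ z)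
      up : n ℤ.+ ℤ.+ 2 ≡.≡ ℤ.+ suc d ℤ.+ z
      up = ≡.trans (ℤₚ.+-assoc (ℤ.+ d) (ℤ.- ℤ.+ 1 ℤ.+ z) (ℤ.+ 2))
        (≡.trans (≡.cong (λ y → ℤ.+ d ℤ.+ y) (≡.trans (ℤₚ.+-comm (ℤ.- ℤ.+ 1 ℤ.+ z) (ℤ.+ 2)) (≡.sym (ℤₚ.+-assoc (ℤ.+ 2) (ℤ.- ℤ.+ 1) z))))
        (≡.trans (≡.sym (ℤₚ.+-assoc (ℤ.+ d) (ℤ.+ 1) z)) (≡.cong (λ y → y ℤ.+ z) (ℤₚ.+-comm (ℤ.+ d) (ℤ.+ 1)))))

  -- Equally many zeros and ones, hence eigenvalue 0; all witness words extend it by at most two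
  -- letters.
  balanced : ∀ n → Word (n ℕ.* 2)
  balanced zero    = []
  balanced (suc n) = 0ℙ ∷ 1ℙ ∷ balanced n

  module WitnessWords (R : CommutativeRing 0ℓ 0ℓ) where
    open CommutativeRing R
    open RingProperties ring
    open Characters R

    eigenvalue-balanced : ∀ n → eigenvalue R (balanced n) ≈ 0#
    eigenvalue-balanced zero    = refl
    eigenvalue-balanced (suc n) = trans (sym (+-assoc 1# (- 1#) _)) (trans (+-cong (-‿inverseʳ 1#) (eigenvalue-balanced n)) (+-identityˡ 0#))

    eigenvalue-00 : ∀ n → eigenvalue R (0ℙ ∷ 0ℙ ∷ balanced n) ≈ 1# + 1#
    eigenvalue-00 n = +-congˡ (trans (+-congˡ (eigenvalue-balanced n)) (+-identityʳ 1#))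

    parity-00 : ∀ n → parity R (0ℙ ∷ 0ℙ ∷ balanced n) ≈ - parity R (balanced (suc n))
    parity-00 n = trans (*-identityˡ _) (trans (*-identityˡ (parity R (balanced n)))
      (sym (trans (-‿cong (trans (*-identityˡ _) (-1*x≈-x (parity R (balanced n))))) (-‿involutive (parity R (balanced n))))))

    eigenvalue-0 : ∀ n → eigenvalue R (0ℙ ∷ balanced n) ≈ 1#
    eigenvalue-0 n = trans (+-congˡ (eigenvalue-balanced n)) (+-identityʳ 1#)

    eigenvalue-1 : ∀ n → eigenvalue R (1ℙ ∷ balanced n) ≈ - 1#
    eigenvalue-1 n = trans (+-congˡ (eigenvalue-balanced n)) (+-identityʳ (- 1#))

    parity-1 : ∀ n → parity R (1ℙ ∷ balanced n) ≈ - parity R (0ℙ ∷ balanced n)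
    parity-1 n = trans (-1*x≈-x _) (-‿cong (sym (*-identityˡ _)))

-- Eigenvalue powers modulo 4 and phases as multiples of a quarter turn.

module QuarterTurns where
  open import Algebra.Bundles using (CommutativeRing)
  open import Data.Integer as ℤ using (ℤ)
  import Data.Integer.DivMod as ℤ
  import Data.Integer.Properties as ℤₚ
  open import Data.Integer.Solver using () renaming (module +-*-Solver to ℤ-Solver)
  open import Data.Nat as ℕ using (ℕ; zero; suc)
  import Data.Nat.Properties as ℕₚ
  open import Data.Nat.Divisibility using (_∣_; divides)
  open import Data.Parity using (0ℙ; 1ℙ)
  open import Data.Product using (∃-syntax; _×_; _,_; proj₁; proj₂)
  open import Data.Rational as ℚ using (ℚ; 0ℚ; 1ℚ)
  import Data.Rational.Properties as ℚₚ
  open import Data.Rational.Solver using (module +-*-Solver)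
  open import Data.Sum using (_⊎_; inj₁; inj₂)
  open import Data.Vec using ([]; _∷_)
  open import Relation.Binary.PropositionalEquality using (_≡_; refl; sym; trans; cong; cong₂; subst)
  open import Relation.Nullary.Negation using (contradiction)
  open import Defs
  open RationalArithmetic using (ι; ιₙ; ι-+; ι-*; 1/-*)
  open RealAnalysis
  open LinearMaps
  open CubeCharacters
  open ComplexNumbers
  open CubeSpectrum

  ℤ-ring = ℤₚ.+-*-commutativeRing

  ℤ↪ℝ : Embedding ℤ-ring ℝ-ring
  ℤ↪ℝ = record
    { h      = λ z → fromℚ (ι z)
    ; h-cong = λ { {x} refl → ≈-refl {fromℚ (ι x)} }
    ; h-0    = ≈-refl {0ℝ}
    ; h-1    = ≈-refl {1ℝ}
    ; h-+    = λ x y → ≈-pointwise {fromℚ (ι (x ℤ.+ y))} {fromℚ (ι x) + fromℚ (ι y)} λ _ → ι-+ x y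
    ; h-*    = λ x y → ≈-pointwise {fromℚ (ι (x ℤ.* y))} {fromℚ (ι x) * fromℚ (ι y)} λ _ → ι-* x y
    }

  -- Congruences between a power of an eigenvalue and the eigenvalue

  even-or-odd : ∀ n → (∃[ q ] n ≡ q ℕ.* 2) ⊎ (∃[ q ] n ≡ suc (q ℕ.* 2))
  even-or-odd zero = inj₁ (0 , refl)
  even-or-odd (suc n) with even-or-odd n
  ... | inj₁ (q , refl) = inj₂ (q , refl)
  ... | inj₂ (q , refl) = inj₁ (suc q , refl)

  Even⇒ : ∀ {n} → Even n → ∃[ q ] n ≡ q ℕ.* 2
  Even⇒ (divides q eq) = q , eq

  Odd⇒ : ∀ {n} → Odd n → ∃[ q ] n ≡ suc (q ℕ.* 2)
  Odd⇒ {n} odd with even-or-odd n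
  ... | inj₁ (q , eq) = contradiction (divides q eq) odd
  ... | inj₂ odd′     = odd′

  suc-Odd : ∀ q → Odd (suc (q ℕ.* 2))
  suc-Odd q (divides r eq) = absurd q r eq
    where
    absurd : ∀ q r → suc (q ℕ.* 2) ≡ r ℕ.* 2 → _
    absurd zero    (suc zero)    ()
    absurd zero    (suc (suc r)) ()
    absurd (suc q) (suc r)       eq = absurd q r (ℕₚ.suc-injective (ℕₚ.suc-injective eq))

  -- The witness `m` is `- |S|`: each letter 1 lowers it by one.
  λᶻ-parity : ∀ {d} (S : Word d) → ∃[ m ] λᶻ S ≡ ℤ.+ d ℤ.+ m ℤ.* ℤ.+ 2
  λᶻ-parity [] = ℤ.0ℤ , refl
  λᶻ-parity {suc d} (0ℙ ∷ S) = let m , eq = λᶻ-parity S in m , trans (cong (λ x → ℤ.+ 1 ℤ.+ x) eq)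
    (solve 2 (λ n m → con (ℤ.+ 1) :+ (n :+ m :* con (ℤ.+ 2)) := (con (ℤ.+ 1) :+ n) :+ m :* con (ℤ.+ 2)) refl (ℤ.+ d) m)
    where open ℤ-Solver
  λᶻ-parity {suc d} (1ℙ ∷ S) = let m , eq = λᶻ-parity S in m ℤ.- ℤ.+ 1 , trans (cong (λ x → ℤ.- ℤ.+ 1 ℤ.+ x) eq)
    (solve 2 (λ n m → con (ℤ.- ℤ.+ 1) :+ (n :+ m :* con (ℤ.+ 2)) := (con (ℤ.+ 1) :+ n) :+ (m :- con (ℤ.+ 1)) :* con (ℤ.+ 2)) refl (ℤ.+ d) m)
    where open ℤ-Solver

  infixr 8 _^ᶻ_
  _^ᶻ_ : ℤ → ℕ → ℤ
  _^ᶻ_ = power ℤ-ring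

  odd-^ᶻ : ∀ q k → ∃[ w ] (ℤ.+ 1 ℤ.+ q ℤ.* ℤ.+ 2) ^ᶻ k ≡ ℤ.+ 1 ℤ.+ w ℤ.* ℤ.+ 2
  odd-^ᶻ q zero    = ℤ.0ℤ , refl
  odd-^ᶻ q (suc k) = let w , eq = odd-^ᶻ q k in q ℤ.+ w ℤ.+ q ℤ.* w ℤ.* ℤ.+ 2 , trans (cong (λ x → (ℤ.+ 1 ℤ.+ q ℤ.* ℤ.+ 2) ℤ.* x) eq)
    (solve 2 (λ q w → (con (ℤ.+ 1) :+ q :* con (ℤ.+ 2)) :* (con (ℤ.+ 1) :+ w :* con (ℤ.+ 2))
       := con (ℤ.+ 1) :+ (q :+ w :+ q :* w :* con (ℤ.+ 2)) :* con (ℤ.+ 2)) refl q w)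
    where open ℤ-Solver

  m^k≡m[2] : ∀ m k → ∃[ z ] m ^ᶻ suc k ≡ m ℤ.+ z ℤ.* ℤ.+ 2
  m^k≡m[2] m k with m ℤ.% ℤ.+ 2 | m ℤ./ ℤ.+ 2 | ℤ.a≡a%n+[a/n]*n m (ℤ.+ 2) | ℤ.n%d<d m (ℤ.+ 2)
  ... | 0 | q | refl | _ = q ℤ.* p ℤ.- q ,
        solve 2 (λ q p → (con (ℤ.+ 0) :+ q :* con (ℤ.+ 2)) :* p := con (ℤ.+ 0) :+ q :* con (ℤ.+ 2) :+ (q :* p :- q) :* con (ℤ.+ 2)) refl q p
    where
    open ℤ-Solver
    p : ℤ
    p = (ℤ.+ 0 ℤ.+ q ℤ.* ℤ.+ 2) ^ᶻ k
  ... | 1 | q | refl | _ = let w , eq = odd-^ᶻ q (suc k) in w ℤ.- q , trans eq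
        (solve 2 (λ q w → con (ℤ.+ 1) :+ w :* con (ℤ.+ 2) := con (ℤ.+ 1) :+ q :* con (ℤ.+ 2) :+ (w :- q) :* con (ℤ.+ 2)) refl q w)
    where open ℤ-Solver
  ... | suc (suc _) | _ | _ | ℕ.s≤s (ℕ.s≤s ())

  -- For even `d` the eigenvalue is `2m`, and `π/2ᵏ` times its `k`-th power is `2 mᵏ` quarter turns.
  -- A positive power preserves parity, and doubling lifts the congruence from 2 to 4.
  2m^k≡2m[4] : ∀ m k → ∃[ z ] ℤ.+ 2 ℤ.* m ^ᶻ suc k ≡ m ℤ.* ℤ.+ 2 ℤ.+ z ℤ.* ℤ.+ 4
  2m^k≡2m[4] m k = let z , eq = m^k≡m[2] m k in z , trans (cong (λ x → ℤ.+ 2 ℤ.* x) eq)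
    (solve 2 (λ m z → con (ℤ.+ 2) :* (m :+ z :* con (ℤ.+ 2)) := m :* con (ℤ.+ 2) :+ z :* con (ℤ.+ 4)) refl m z)
    where open ℤ-Solver

  -- The square of an odd number is `(1 + 2q)² = 1 + 4 (q + q²)`.
  odd-^ᶻ-even≡1[4] : ∀ q j → ∃[ w ] (ℤ.+ 1 ℤ.+ q ℤ.* ℤ.+ 2) ^ᶻ (j ℕ.* 2) ≡ ℤ.+ 1 ℤ.+ w ℤ.* ℤ.+ 4
  odd-^ᶻ-even≡1[4] q zero    = ℤ.0ℤ , refl
  odd-^ᶻ-even≡1[4] q (suc j) = let w , eq = odd-^ᶻ-even≡1[4] q j in
      w ℤ.+ (q ℤ.+ q ℤ.* q) ℤ.* (ℤ.+ 1 ℤ.+ w ℤ.* ℤ.+ 4) ,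
      trans (cong (λ z → (ℤ.+ 1 ℤ.+ q ℤ.* ℤ.+ 2) ℤ.* ((ℤ.+ 1 ℤ.+ q ℤ.* ℤ.+ 2) ℤ.* z)) eq)
        (solve 2 (λ q w → (con (ℤ.+ 1) :+ q :* con (ℤ.+ 2)) :* ((con (ℤ.+ 1) :+ q :* con (ℤ.+ 2)) :* (con (ℤ.+ 1) :+ w :* con (ℤ.+ 4)))
          := con (ℤ.+ 1) :+ (w :+ (q :+ q :* q) :* (con (ℤ.+ 1) :+ w :* con (ℤ.+ 4))) :* con (ℤ.+ 4)) refl q w)
    where open ℤ-Solver

  odd-^ᶻ-odd≡[4] : ∀ q j → let m = ℤ.+ 1 ℤ.+ q ℤ.* ℤ.+ 2 in ∃[ z ] m ^ᶻ suc (j ℕ.* 2) ≡ m ℤ.+ z ℤ.* ℤ.+ 4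
  odd-^ᶻ-odd≡[4] q j = let w , eq = odd-^ᶻ-even≡1[4] q j in (ℤ.+ 1 ℤ.+ q ℤ.* ℤ.+ 2) ℤ.* w ,
    trans (cong (λ x → (ℤ.+ 1 ℤ.+ q ℤ.* ℤ.+ 2) ℤ.* x) eq)
      (solve 2 (λ m w → m :* (con (ℤ.+ 1) :+ w :* con (ℤ.+ 4)) := m :+ (m :* w) :* con (ℤ.+ 4)) refl (ℤ.+ 1 ℤ.+ q ℤ.* ℤ.+ 2) w)
    where open ℤ-Solver

  ^ᶻ-*2 : ∀ m k → (m ℤ.* ℤ.+ 2) ^ᶻ k ≡ ℤ.+ (2 ℕ.^ k) ℤ.* m ^ᶻ k
  ^ᶻ-*2 m zero    = refl
  ^ᶻ-*2 m (suc k) = trans (cong (λ x → (m ℤ.* ℤ.+ 2) ℤ.* x) (^ᶻ-*2 m k))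
    (trans (solve 3 (λ m t p → (m :* con (ℤ.+ 2)) :* (t :* p) := (con (ℤ.+ 2) :* t) :* (m :* p)) refl m (ℤ.+ (2 ℕ.^ k)) (m ^ᶻ k))
      (cong (λ x → x ℤ.* (m ℤ.* m ^ᶻ k)) (sym (ℤₚ.pos-* 2 (2 ℕ.^ k)))))
    where open ℤ-Solver

  module Rx = CommutativeRing ℝ-ring

  cosᶻ sinᶻ : ℤ → ℝ
  cosᶻ z = cos (π/2 * fromℚ (ι z))
  sinᶻ z = sin (π/2 * fromℚ (ι z))

  private
    angle-+2 : ∀ m → π/2 * fromℚ (ι (m ℤ.+ ℤ.+ 2)) ≈ π/2 * fromℚ (ι m) + (π/2 + π/2)
    angle-+2 m = ≈-pointwise {π/2 * fromℚ (ι (m ℤ.+ ℤ.+ 2))} {π/2 * fromℚ (ι m) + (π/2 + π/2)} λ n →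
      trans (cong (seq π/2 n ℚ.*_) (ι-+ m (ℤ.+ 2)))
        (solve 2 (λ p m → p :* (m :+ con (ιₙ 2)) := p :* m :+ (p :+ p)) refl (seq π/2 n) (ι m))
      where open +-*-Solver

  cosᶻ-+2 : ∀ m → cosᶻ (m ℤ.+ ℤ.+ 2) ≈ - cosᶻ m
  cosᶻ-+2 m = ≈-trans
    (cos-cong {π/2 * fromℚ (ι (m ℤ.+ ℤ.+ 2))} {π/2 * fromℚ (ι m) + (π/2 + π/2)} (angle-+2 m))
    (cos-+π (π/2 * fromℚ (ι m)))

  sinᶻ-+2 : ∀ m → sinᶻ (m ℤ.+ ℤ.+ 2) ≈ - sinᶻ m
  sinᶻ-+2 m = ≈-trans
    (sin-cong {π/2 * fromℚ (ι (m ℤ.+ ℤ.+ 2))} {π/2 * fromℚ (ι m) + (π/2 + π/2)} (angle-+2 m))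
    (sin-+π (π/2 * fromℚ (ι m)))

  -- exp(-iτ λᵏ) = (-1)^|S| exp(-i d π/2) for the eigenvalue λ of every character S,
  -- stated for the real and imaginary parts.
  PhaseMatch : ℕ → ℕ → ℝ → Set
  PhaseMatch d k τ = ∀ (S : Word d) →
      cos (τ * power ℝ-ring (eigenvalue ℝ-ring S) k) ≈ parity ℝ-ring S * cosᶻ (ℤ.+ d)
    × sin (τ * power ℝ-ring (eigenvalue ℝ-ring S) k) ≈ parity ℝ-ring S * sinᶻ (ℤ.+ d)

  -- The number `y S` counts the quarter turns in `τ λᵏ`. Only its class modulo 4 affects the phase,
  -- and that class is required to be the class of the eigenvalue itself.
  phaseMatch : ∀ {d k τ} (y : Word d → ℤ) →
    (∀ S → ∃[ z ] y S ≡ λᶻ S ℤ.+ z ℤ.* ℤ.+ 4) →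
    (∀ S → τ * fromℚ (ι (λᶻ S ^ᶻ k)) ≈ π/2 * fromℚ (ι (y S))) →
    PhaseMatch d k τ
  phaseMatch {d} {k} {τ} y y≡ τλ≈ S =
      ≈-trans (cos-cong {τ * power ℝ-ring (eigenvalue ℝ-ring S) k} {π/2 * fromℚ (ι (y S))} angle≈)
        (value cosᶻ cosᶻ-+2)
    , ≈-trans (sin-cong {τ * power ℝ-ring (eigenvalue ℝ-ring S) k} {π/2 * fromℚ (ι (y S))} angle≈)
        (value sinᶻ sinᶻ-+2)
    where
    angle≈ : τ * power ℝ-ring (eigenvalue ℝ-ring S) k ≈ π/2 * fromℚ (ι (y S))
    angle≈ = ≈-trans
      (*-congˡ τ {power ℝ-ring (eigenvalue ℝ-ring S) k} {fromℚ (ι (λᶻ S ^ᶻ k))}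
        (≈-sym (EmbeddingProperties.h-eigenvalue-power ℤ-ring ℝ-ring ℤ↪ℝ S k)))
      (τλ≈ S)
    value : ∀ (g : ℤ → ℝ) → (∀ m → g (m ℤ.+ ℤ.+ 2) ≈ - g m) → g (y S) ≈ parity ℝ-ring S * g (ℤ.+ d)
    value g g-+2 = ≈-trans (g-≡ (proj₂ (y≡ S))) (≈-trans (Antiperiodic.g-mod4 ℝ-ring g g-+2 (λᶻ S) (proj₁ (y≡ S)))
      (≈-trans (g-≡ (sym (ℤₚ.+-identityʳ (λᶻ S)))) (≈-trans (Antiperiodic.g-word ℝ-ring g g-+2 S ℤ.0ℤ)
        (*-congˡ (parity ℝ-ring S) {g (ℤ.+ d ℤ.+ ℤ.0ℤ)} {g (ℤ.+ d)} (g-≡ (ℤₚ.+-identityʳ (ℤ.+ d)))))))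
      where
      g-≡ : ∀ {m n} → m ≡ n → g m ≈ g n
      g-≡ {m} refl = ≈-refl {g m}

  -- With `λ = 2m`, the time is chosen to cancel the factor `2ᵏ`: `(π/2ᵏ) (2m)ᵏ = (π/2) (2 mᵏ)`.
  phaseMatch-even : ∀ h k → PhaseMatch (h ℕ.* 2) (suc k) ((π/2 + π/2) /2^ suc k)
  phaseMatch-even h k = phaseMatch {h ℕ.* 2} {suc k} {(π/2 + π/2) /2^ suc k} (λ S → ℤ.+ 2 ℤ.* m S ^ᶻ suc k)
    (λ S → let z , eq = 2m^k≡2m[4] (m S) k in z , trans eq (cong (λ x → x ℤ.+ z ℤ.* ℤ.+ 4) (sym (λ≡ S))))
    (λ S → ≈-pointwise {((π/2 + π/2) /2^ suc k) * fromℚ (ι (λᶻ S ^ᶻ suc k))} {π/2 * fromℚ (ι (ℤ.+ 2 ℤ.* m S ^ᶻ suc k))} λ n →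
      trans (cong ((seq π/2 n ℚ.+ seq π/2 n) ℚ.* r ℚ.*_)
          (trans (cong ι (trans (cong (_^ᶻ suc k) (λ≡ S)) (^ᶻ-*2 (m S) (suc k)))) (ι-* (ℤ.+ (2 ℕ.^ suc k)) (m S ^ᶻ suc k))))
        (trans (solve 4 (λ p r t x → (p :+ p) :* r :* (t :* x) := (r :* t) :* (p :* (con (ιₙ 2) :* x))) refl (seq π/2 n) r (ιₙ (2 ℕ.^ suc k)) (ι (m S ^ᶻ suc k)))
          (trans (cong (ℚ._* (seq π/2 n ℚ.* (ιₙ 2 ℚ.* ι (m S ^ᶻ suc k)))) (1/-* (2 ℕ.^ suc k) {{ℕₚ.m^n≢0 2 (suc k)}}))
            (trans (ℚₚ.*-identityˡ _) (cong (seq π/2 n ℚ.*_) (sym (ι-* (ℤ.+ 2) (m S ^ᶻ suc k))))))))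
    where
    open +-*-Solver
    r : ℚ
    r = (ℤ.+ 1 ℚ./ (2 ℕ.^ suc k)) {{ℕₚ.m^n≢0 2 (suc k)}}
    m : Word (h ℕ.* 2) → ℤ
    m S = ℤ.+ h ℤ.+ proj₁ (λᶻ-parity S)
    λ≡ : ∀ S → λᶻ S ≡ m S ℤ.* ℤ.+ 2
    λ≡ S = trans (proj₂ (λᶻ-parity S)) (trans (cong (λ x → x ℤ.+ proj₁ (λᶻ-parity S) ℤ.* ℤ.+ 2) (ℤₚ.pos-* h 2))
      (sym (ℤₚ.*-distribʳ-+ (ℤ.+ 2) (ℤ.+ h) (proj₁ (λᶻ-parity S)))))

  -- At time `π/2` the quarter turns are counted by `λᵏ` itself, which is congruent to `λ` modulo 4
  -- because both `λ` and `k` are odd.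
  phaseMatch-odd : ∀ h j → PhaseMatch (suc (h ℕ.* 2)) (suc (j ℕ.* 2)) ((π/2 + π/2) /2^ 1)
  phaseMatch-odd h j = phaseMatch {suc (h ℕ.* 2)} {suc (j ℕ.* 2)} {(π/2 + π/2) /2^ 1} (λ S → λᶻ S ^ᶻ suc (j ℕ.* 2))
    (λ S → let z , eq = odd-^ᶻ-odd≡[4] (q S) j in
      z , trans (cong (_^ᶻ suc (j ℕ.* 2)) (λ≡ S)) (trans eq (cong (λ x → x ℤ.+ z ℤ.* ℤ.+ 4) (sym (λ≡ S)))))
    (λ S → *-cong {(π/2 + π/2) /2^ 1} {π/2} {fromℚ (ι (λᶻ S ^ᶻ suc (j ℕ.* 2)))} {fromℚ (ι (λᶻ S ^ᶻ suc (j ℕ.* 2)))}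
      (≈-pointwise {(π/2 + π/2) /2^ 1} {π/2} λ n → solve 1 (λ p → (p :+ p) :* con ℚ.½ := p) refl (seq π/2 n))
      (≈-refl {fromℚ (ι (λᶻ S ^ᶻ suc (j ℕ.* 2)))}))
    where
    open +-*-Solver
    q : Word (suc (h ℕ.* 2)) → ℤ
    q S = ℤ.+ h ℤ.+ proj₁ (λᶻ-parity S)
    λ≡ : ∀ S → λᶻ S ≡ ℤ.+ 1 ℤ.+ q S ℤ.* ℤ.+ 2
    λ≡ S = trans (proj₂ (λᶻ-parity S)) (trans (cong (λ z → ℤ.+ 1 ℤ.+ z ℤ.+ proj₁ (λᶻ-parity S) ℤ.* ℤ.+ 2) (ℤₚ.pos-* h 2))
      (trans (ℤₚ.+-assoc (ℤ.+ 1) (ℤ.+ h ℤ.* ℤ.+ 2) _) (cong (λ x → ℤ.+ 1 ℤ.+ x) (sym (ℤₚ.*-distribʳ-+ (ℤ.+ 2) (ℤ.+ h) (proj₁ (λᶻ-parity S)))))))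

-- Passage between transfer times and spectral phases.

module CubeExponential where
  open import Algebra.Bundles using (CommutativeRing)
  open import Algebra.Bundles.Raw using (RawRing)
  open import Data.Bool using (if_then_else_)
  open import Data.Integer as ℤ using (ℤ)
  import Data.Integer.Properties as ℤₚ
  open import Data.List using (foldr)
  open import Data.List.Properties using (map-cong)
  open import Data.Nat as ℕ using (ℕ; zero; suc; _!)
  import Data.Nat.Properties as ℕₚ
  open import Data.Parity using (0ℙ; 1ℙ)
  open import Data.Product using (∃-syntax; _×_; _,_; proj₁; proj₂)
  open import Data.Rational as ℚ using (ℚ; 0ℚ; 1ℚ; ½)
  import Data.Rational.Properties as ℚₚ
  open import Data.Rational.Solver using (module +-*-Solver)
  open import Data.Vec using ([]; _∷_)
  open import Level using (0ℓ)
  open import Relation.Binary.PropositionalEquality using (_≡_; refl; sym; trans; cong; cong₂; subst)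
  open import Relation.Nullary using (¬_; does)
  open import Relation.Nullary.Negation using (contradiction)
  open import Defs
  open RationalArithmetic using (ι; ιₙ; ιₙ-mono; 1/-*)
  open TrigonometricPolynomials using (sinPoly-alternating)
  open RealAnalysis
  open LinearMaps
  open CubeCharacters
  open ComplexNumbers
  open CubeSpectrum
  open QuarterTurns

  open +-*-Solver using (solve; _:=_; _:+_; _:*_; _:-_; :-_; con)

  ½*2≈1 : CommutativeRing._≈_ ℝ-ring (CommutativeRing._*_ ℝ-ring (fromℚ ½)
    (CommutativeRing._+_ ℝ-ring (CommutativeRing.1# ℝ-ring) (CommutativeRing.1# ℝ-ring)))
    (CommutativeRing.1# ℝ-ring)
  ½*2≈1 = ≈-pointwise λ _ → refl {x = 1ℚ}

  -- ℂ-rawRing and the raw ring of ℂ-ring agree definitionally. The passage between them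
  -- is split into small steps to keep Agda from comparing Cauchy proofs.
  toRing : ∀ (Q : (ℕ → ℂ) → Set) (s t : ℕ → ℂ) → s ≡ t →
    Q (partialSum ℂ-rawRing (λ j → RawRing._*_ ℂ-rawRing (fromℝ (fromℚ (1/ j !))) (s j))) →
    Q (partialSum (raw ℂ-ring) (λ j → CommutativeRing._*_ ℂ-ring (fromℝ (fromℚ (1/ j !))) (t j)))
  toRing Q s .s refl p = p

  fromRing : ∀ (Q : (ℕ → ℂ) → Set) (s t : ℕ → ℂ) → s ≡ t →
    Q (partialSum (raw ℂ-ring) (λ j → CommutativeRing._*_ ℂ-ring (fromℝ (fromℚ (1/ j !))) (t j))) →
    Q (partialSum ℂ-rawRing (λ j → RawRing._*_ ℂ-rawRing (fromℝ (fromℚ (1/ j !))) (s j)))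
  fromRing Q s .s refl p = p

  module _ (V : FiniteSet) where
    open FiniteSet V using () renaming (Carrier to X)
    open PerfectStateTransfer V using (IsExp)

    ^ᴹ-raw : ∀ (M : X → X → ℂ) u v →
      (λ j → LinearAlgebra._^ᴹ_ ℂ-rawRing V M j u v) ≡ (λ j → LinearAlgebra._^ᴹ_ (raw ℂ-ring) V M j u v)
    ^ᴹ-raw M u v = refl

    IsExp-raw : ∀ (M E : X → X → ℂ) → IsExp M E → ∀ u v →
      partialSum ℂ-rawRing (λ j → RawRing._*_ ℂ-rawRing (fromℝ (fromℚ (1/ j !))) (LinearAlgebra._^ᴹ_ ℂ-rawRing V M j u v)) ⟶ᶜ E u v
    IsExp-raw M E isExp u v = isExp u v

    IsExp-raw⁻ : ∀ (M E : X → X → ℂ) → (∀ u v →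
      partialSum ℂ-rawRing (λ j → RawRing._*_ ℂ-rawRing (fromℝ (fromℚ (1/ j !))) (LinearAlgebra._^ᴹ_ ℂ-rawRing V M j u v)) ⟶ᶜ E u v) → IsExp M E
    IsExp-raw⁻ M E lim u v = lim u v

    IsExp⇒⟶ᶜ : ∀ (M E : X → X → ℂ) → IsExp M E → ∀ u v →
      partialSum (raw ℂ-ring) (λ j → CommutativeRing._*_ ℂ-ring (fromℝ (fromℚ (1/ j !)))
        (LinearAlgebra._^ᴹ_ (raw ℂ-ring) V M j u v)) ⟶ᶜ E u v
    IsExp⇒⟶ᶜ M E isExp u v = toRing (λ s → s ⟶ᶜ E u v)
      (λ j → LinearAlgebra._^ᴹ_ ℂ-rawRing V M j u v)
      (λ j → LinearAlgebra._^ᴹ_ (raw ℂ-ring) V M j u v) (^ᴹ-raw M u v) (IsExp-raw M E isExp u v)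

    ⟶ᶜ⇒IsExp : ∀ (M E : X → X → ℂ) → (∀ u v →
      partialSum (raw ℂ-ring) (λ j → CommutativeRing._*_ ℂ-ring (fromℝ (fromℚ (1/ j !)))
        (LinearAlgebra._^ᴹ_ (raw ℂ-ring) V M j u v)) ⟶ᶜ E u v) → IsExp M E
    ⟶ᶜ⇒IsExp M E lim = IsExp-raw⁻ M E λ u v → fromRing (λ s → s ⟶ᶜ E u v)
      (λ j → LinearAlgebra._^ᴹ_ ℂ-rawRing V M j u v)
      (λ j → LinearAlgebra._^ᴹ_ (raw ℂ-ring) V M j u v) (^ᴹ-raw M u v) (lim u v)

    IsExp-limit : ∀ (M N E : X → X → ℂ) → (∀ u v → M u v ≈ᶜ N u v) → IsExp M E → ∀ u v →
      partialSum (raw ℂ-ring) (λ j → CommutativeRing._*_ ℂ-ring (fromℝ (fromℚ (1/ j !)))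
        (LinearAlgebra._^ᴹ_ (raw ℂ-ring) V N j u v)) ⇝ᶜ E u v
    IsExp-limit M N E M≈N isExp u v = ⇝ᶜ-cong (partialSum (raw ℂ-ring) (λ j → CommutativeRing._*_ ℂ-ring (fromℝ (fromℚ (1/ j !)))
        (LinearAlgebra._^ᴹ_ (raw ℂ-ring) V M j u v)))
      (partialSum (raw ℂ-ring) (λ j → CommutativeRing._*_ ℂ-ring (fromℝ (fromℚ (1/ j !)))
        (LinearAlgebra._^ᴹ_ (raw ℂ-ring) V N j u v))) (E u v) (E u v)
      (λ n → MatrixSums.expSum-cong ℂ-ring V (λ j → fromℝ (fromℚ (1/ j !))) {M} {N} M≈N n u v)
      (CommutativeRing.refl ℂ-ring {E u v}) (⟶ᶜ⇒⇝ᶜ {_} {E u v} (IsExp⇒⟶ᶜ M E isExp u v))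

    limit-IsExp : ∀ (M N E : X → X → ℂ) → (∀ u v → M u v ≈ᶜ N u v) → (∀ u v →
      partialSum (raw ℂ-ring) (λ j → CommutativeRing._*_ ℂ-ring (fromℝ (fromℚ (1/ j !)))
        (LinearAlgebra._^ᴹ_ (raw ℂ-ring) V N j u v)) ⇝ᶜ E u v) → IsExp M E
    limit-IsExp M N E M≈N lim = ⟶ᶜ⇒IsExp M E λ u v → ⇝ᶜ⇒⟶ᶜ {_} {E u v} (⇝ᶜ-cong (partialSum (raw ℂ-ring) (λ j → CommutativeRing._*_ ℂ-ring (fromℝ (fromℚ (1/ j !)))
        (LinearAlgebra._^ᴹ_ (raw ℂ-ring) V N j u v)))
      (partialSum (raw ℂ-ring) (λ j → CommutativeRing._*_ ℂ-ring (fromℝ (fromℚ (1/ j !)))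
        (LinearAlgebra._^ᴹ_ (raw ℂ-ring) V M j u v))) (E u v) (E u v)
      (λ n → MatrixSums.expSum-cong ℂ-ring V (λ j → fromℝ (fromℚ (1/ j !))) {N} {M}
        (λ u v → CommutativeRing.sym ℂ-ring {M u v} {N u v} (M≈N u v)) n u v)
      (CommutativeRing.refl ℂ-ring {E u v}) (lim u v))

    e-raw : ∀ x → LinearAlgebra.e ℂ-rawRing V x ≡ LinearAlgebra.e (raw ℂ-ring) V x
    e-raw x = refl

    *ᵥ-raw : ∀ (U : X → X → ℂ) (f g : X → ℂ) → f ≡ g → ∀ u →
      LinearAlgebra._*ᵥ_ ℂ-rawRing V U f u ≡ LinearAlgebra._*ᵥ_ (raw ℂ-ring) V U g u
    *ᵥ-raw U f .f refl u = refl

    column-raw : ∀ (U : X → X → ℂ) x u → LinearAlgebra._*ᵥ_ ℂ-rawRing V U (LinearAlgebra.e ℂ-rawRing V x) u ≈ᶜ U u x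
    column-raw U x u = subst (λ z → z ≈ᶜ U u x)
      (sym (*ᵥ-raw U (LinearAlgebra.e ℂ-rawRing V x) (LinearAlgebra.e (raw ℂ-ring) V x) (e-raw x) u))
      (MatrixSums.column ℂ-ring V U x u)

  -- The entry is replaced by a variable `y` through an equation, so a matrix power can be exchanged
  -- for its ring version without being expanded.
  entry : ∀ (V : FiniteSet) τ (K : FiniteSet.Carrier V → FiniteSet.Carrier V → ℝ) u v y → K u v ≡ y →
    PerfectStateTransfer.-iτ_·_ V τ K u v ≈ᶜ CommutativeRing._*_ ℂ-ring (0ℝ +i - τ) (Embedding.h ℝ↪ℂ y)
  entry V τ K u v _ refl = pointwiseᶜ
    (λ n → solve 2 (λ t x → (:- (con 0ℚ :* t :- con 1ℚ :* con 0ℚ)) :* x :- (:- (con 0ℚ :* con 0ℚ :+ con 1ℚ :* t)) :* con 0ℚ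
      := con 0ℚ :* x :- (:- t) :* con 0ℚ) refl (seq τ n) (seq (K u v) n))
    (λ n → solve 2 (λ t x → (:- (con 0ℚ :* t :- con 1ℚ :* con 0ℚ)) :* con 0ℚ :+ (:- (con 0ℚ :* con 0ℚ :+ con 1ℚ :* t)) :* x
      := con 0ℚ :* con 0ℚ :+ (:- t) :* x) refl (seq τ n) (seq (K u v) n))

  e≈ : ∀ d (u v : Word d) → LinearAlgebra.e ℂ-rawRing (𝔽₂^ d) u v
    ≈ᶜ (if does (u ≟ᵂ v) then CommutativeRing.1# ℂ-ring else CommutativeRing.0# ℂ-ring)
  e≈ d u v = CommutativeRing.refl ℂ-ring {LinearAlgebra.e ℂ-rawRing (𝔽₂^ d) u v}

  -iτx : ∀ τ x → CommutativeRing._*_ ℂ-ring (0ℝ +i - τ) (Embedding.h ℝ↪ℂ x) ≈ᶜ (0ℝ +i - (τ * x))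
  -iτx τ x = pointwiseᶜ
    (λ n → solve 2 (λ t x → con 0ℚ :* x :- (:- t) :* con 0ℚ := con 0ℚ) refl (seq τ n) (seq x n))
    (λ n → solve 2 (λ t x → con 0ℚ :* con 0ℚ :+ (:- t) :* x := :- (t :* x)) refl (seq τ n) (seq x n))

  module _ (d k : ℕ) (τ : ℝ) where

    spectral-limit : ∀ S → Hypercubeᴿ.spectralSum ℝ-ring ℂ-ring ℝ↪ℂ ℂ-limits d k (fromℚ ½) ½*2≈1
        (0ℝ +i - τ) (λ j → fromℝ (fromℚ (1/ j !))) (LinearAlgebra.e ℂ-rawRing (𝔽₂^ d)) (e≈ d) S ⇝ᶜ (cos (τ * power ℝ-ring (eigenvalue ℝ-ring S) k) +i - sin (τ * power ℝ-ring (eigenvalue ℝ-ring S) k))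
    spectral-limit S = exp-limit
      {CommutativeRing._*_ ℂ-ring (0ℝ +i - τ) (Embedding.h ℝ↪ℂ (power ℝ-ring (eigenvalue ℝ-ring S) k))}
      {τ * power ℝ-ring (eigenvalue ℝ-ring S) k} (-iτx τ (power ℝ-ring (eigenvalue ℝ-ring S) k))

    module _ (K : Word d → Word d → ℝ)
      (K≡ : ∀ u v → K u v ≡ LinearAlgebra._^ᴹ_ (raw ℝ-ring) (𝔽₂^ d) (adjacency ℝ-ring) k u v) where

      entry-K : ∀ u v → PerfectStateTransfer.-iτ_·_ (𝔽₂^ d) τ K u v
        ≈ᶜ CommutativeRing._*_ ℂ-ring (0ℝ +i - τ) (Embedding.h ℝ↪ℂ (Hypercubeᴿ.K ℝ-ring ℂ-ring ℝ↪ℂ ℂ-limits d k (fromℚ ½) ½*2≈1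
        (0ℝ +i - τ) (λ j → fromℝ (fromℚ (1/ j !))) (LinearAlgebra.e ℂ-rawRing (𝔽₂^ d)) (e≈ d) u v))
      entry-K u v = entry (𝔽₂^ d) τ K u v (Hypercubeᴿ.K ℝ-ring ℂ-ring ℝ↪ℂ ℂ-limits d k (fromℚ ½) ½*2≈1
        (0ℝ +i - τ) (λ j → fromℝ (fromℚ (1/ j !))) (LinearAlgebra.e ℂ-rawRing (𝔽₂^ d)) (e≈ d) u v) (K≡ u v)

      -- The exponential is given outright as `a - ib` times the permutation matrix of the antipode,
      -- so a single phase condition serves all `x`.
      transferTime : 0ℝ < τ → ∀ a b → Modulus (a +i - b) 1ℝ →
        (∀ S → cos (τ * power ℝ-ring (eigenvalue ℝ-ring S) k) ≈ parity ℝ-ring S * a × sin (τ * power ℝ-ring (eigenvalue ℝ-ring S) k) ≈ parity ℝ-ring S * b) →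
        ∀ x → PerfectStateTransfer.IsTransferTime (𝔽₂^ d) K x (antipode x) τ
      transferTime 0<τ a b ∣γ∣≡1 phase x = 0<τ
        , (λ u w → CommutativeRing._*_ ℂ-ring (a +i - b) (LinearAlgebra.e ℂ-rawRing (𝔽₂^ d) (antipode w) u))
        , limit-IsExp (𝔽₂^ d) (PerfectStateTransfer.-iτ_·_ (𝔽₂^ d) τ K)
            (λ u v → CommutativeRing._*_ ℂ-ring (0ℝ +i - τ) (Embedding.h ℝ↪ℂ (Hypercubeᴿ.K ℝ-ring ℂ-ring ℝ↪ℂ ℂ-limits d k (fromℚ ½) ½*2≈1
        (0ℝ +i - τ) (λ j → fromℝ (fromℚ (1/ j !))) (LinearAlgebra.e ℂ-rawRing (𝔽₂^ d)) (e≈ d) u v)))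
            (λ u w → CommutativeRing._*_ ℂ-ring (a +i - b) (LinearAlgebra.e ℂ-rawRing (𝔽₂^ d) (antipode w) u))
            entry-K
            (Hypercubeᴿ.matrixSum-limit ℝ-ring ℂ-ring ℝ↪ℂ ℂ-limits d k (fromℚ ½) ½*2≈1
        (0ℝ +i - τ) (λ j → fromℝ (fromℚ (1/ j !))) (LinearAlgebra.e ℂ-rawRing (𝔽₂^ d)) (e≈ d) (a +i - b)
              (λ S → cos (τ * power ℝ-ring (eigenvalue ℝ-ring S) k) +i - sin (τ * power ℝ-ring (eigenvalue ℝ-ring S) k)) spectral-limit
              (λ S → ≈-trans (proj₁ (phase S)) (≈-pointwise {parity ℝ-ring S * a}
                       (λ n → solve 3 (λ p a b → p :* a := a :* p :- (:- b) :* con 0ℚ) refl (seq (parity ℝ-ring S) n) (seq a n) (seq b n)))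
                   , ≈-trans (neg-cong {sin (τ * power ℝ-ring (eigenvalue ℝ-ring S) k)} {parity ℝ-ring S * b} (proj₂ (phase S))) (≈-pointwise { - (parity ℝ-ring S * b)}
                       (λ n → solve 3 (λ p a b → :- (p :* b) := a :* con 0ℚ :+ (:- b) :* p) refl (seq (parity ℝ-ring S) n) (seq a n) (seq b n)))))
        , (a +i - b) , ∣γ∣≡1
        , column-raw (𝔽₂^ d) (λ u w → CommutativeRing._*_ ℂ-ring (a +i - b) (LinearAlgebra.e ℂ-rawRing (𝔽₂^ d) (antipode w) u)) x

      -- Transfer from one word `x` already constrains every character, since no character vanishes
      -- at `x`.
      opposite-phases : ∀ x → PerfectStateTransfer.IsTransferTime (𝔽₂^ d) K x (antipode x) τ →
        ∀ S T → CommutativeRing._≈_ ℝ-ring (parity ℝ-ring T) (CommutativeRing.-_ ℝ-ring (parity ℝ-ring S)) →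
        (cos (τ * power ℝ-ring (eigenvalue ℝ-ring T) k) +i - sin (τ * power ℝ-ring (eigenvalue ℝ-ring T) k))
          ≈ᶜ CommutativeRing.-_ ℂ-ring (cos (τ * power ℝ-ring (eigenvalue ℝ-ring S) k) +i - sin (τ * power ℝ-ring (eigenvalue ℝ-ring S) k))
      opposite-phases x (_ , U , isExp , γ , _ , col) = Hypercubeᴿ.limits-opposite ℝ-ring ℂ-ring ℝ↪ℂ ℂ-limits d k (fromℚ ½) ½*2≈1
        (0ℝ +i - τ) (λ j → fromℝ (fromℚ (1/ j !))) (LinearAlgebra.e ℂ-rawRing (𝔽₂^ d)) (e≈ d) γ x (λ u → U u x)
        (λ u → IsExp-limit (𝔽₂^ d) (PerfectStateTransfer.-iτ_·_ (𝔽₂^ d) τ K)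
          (λ u v → CommutativeRing._*_ ℂ-ring (0ℝ +i - τ) (Embedding.h ℝ↪ℂ (Hypercubeᴿ.K ℝ-ring ℂ-ring ℝ↪ℂ ℂ-limits d k (fromℚ ½) ½*2≈1
        (0ℝ +i - τ) (λ j → fromℝ (fromℚ (1/ j !))) (LinearAlgebra.e ℂ-rawRing (𝔽₂^ d)) (e≈ d) u v)))
          U entry-K isExp u x)
        (λ u → CommutativeRing.trans ℂ-ring
          {U u x} {LinearAlgebra._*ᵥ_ ℂ-rawRing (𝔽₂^ d) U (LinearAlgebra.e ℂ-rawRing (𝔽₂^ d) x) u}
          {CommutativeRing._*_ ℂ-ring γ (LinearAlgebra.e ℂ-rawRing (𝔽₂^ d) (antipode x) u)}
          (CommutativeRing.sym ℂ-ring {LinearAlgebra._*ᵥ_ ℂ-rawRing (𝔽₂^ d) U (LinearAlgebra.e ℂ-rawRing (𝔽₂^ d) x) u} {U u x}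
            (column-raw (𝔽₂^ d) U x u))
          (col u))
        (λ S → cos (τ * power ℝ-ring (eigenvalue ℝ-ring S) k) +i - sin (τ * power ℝ-ring (eigenvalue ℝ-ring S) k)) spectral-limit

-- Lower bounds for transfer times and the impossible exponents.

module TransferTimes where
  open import Algebra.Bundles using (CommutativeRing)
  open import Data.Empty using (⊥)
  open import Data.Integer as ℤ using (ℤ)
  import Data.Integer.Properties as ℤₚ
  open import Data.Nat as ℕ using (ℕ; zero; suc; NonZero)
  import Data.Nat.Properties as ℕₚ
  open import Data.Parity using (0ℙ; 1ℙ)
  open import Data.Product using (∃-syntax; _×_; _,_; proj₁; proj₂)
  open import Data.Rational as ℚ using (ℚ; 0ℚ; 1ℚ; ½)
  import Data.Rational.Properties as ℚₚ
  open import Data.Rational.Solver using (module +-*-Solver)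
  open import Data.Sum using (_⊎_; inj₁; inj₂)
  open import Data.Vec using ([]; _∷_; replicate)
  open import Function.Bundles using (_⇔_; mk⇔)
  open import Relation.Binary.PropositionalEquality using (_≡_; refl; sym; trans; cong; cong₂; subst)
  open import Relation.Nullary using (¬_)
  open import Relation.Nullary.Negation using (contradiction)
  open import Defs
  open RationalArithmetic using (ι; ιₙ; ιₙ-mono; 1/-*)
  open TrigonometricPolynomials using (alternating; sincCoeff; sinPoly-alternating)
  open RealAnalysis
  open LinearMaps
  open CubeCharacters
  open ComplexNumbers
  open CubeSpectrum
  open QuarterTurns
  open CubeExponential

  open +-*-Solver using (solve; _:=_; _:+_; _:*_; _:-_; :-_; con)

  0≤1 : 0ℝ ≤ 1ℝ
  0≤1 (ε , 0<ε , N , 1+ε<0) = ℚₚ.<-asym (1+ε<0 N ℕₚ.≤-refl) (ℚₚ.+-mono-< (ℚₚ.positive⁻¹ 1ℚ) 0<ε)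

  modulusᶻ : ∀ z → Modulus (cosᶻ z +i - sinᶻ z) 1ℝ
  modulusᶻ z = 0≤1 , ≈-trans (≈-pointwise {1ℝ * 1ℝ} {1ℝ} λ _ → refl {x = 1ℚ})
    (≈-trans (≈-sym (cos²+sin²≈1 (π/2 * fromℚ (ι z))))
      (≈-pointwise {cos (π/2 * fromℚ (ι z)) * cos (π/2 * fromℚ (ι z)) + sin (π/2 * fromℚ (ι z)) * sin (π/2 * fromℚ (ι z))} λ n →
        solve 2 (λ c s → c :* c :+ s :* s := c :* c :+ (:- s) :* (:- s)) refl (seq (cosᶻ z) n) (seq (sinᶻ z) n)))

  1/2^-pos : ∀ k → 0ℚ ℚ.< (ℤ.+ 1 ℚ./ (2 ℕ.^ k)) {{ℕₚ.m^n≢0 2 k}}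
  1/2^-pos k = ℚₚ.positive⁻¹ _ {{ℚₚ.normalize-pos 1 (2 ℕ.^ k) {{ℕₚ.m^n≢0 2 k}}}}

  0<π/2^ : ∀ k → 0ℝ < (π/2 + π/2) /2^ k
  0<π/2^ k = *-pos-ℝ {π/2 + π/2} {fromℚ ((ℤ.+ 1 ℚ./ (2 ℕ.^ k)) {{ℕₚ.m^n≢0 2 k}})}
    (+-pos-ℝ {π/2} {π/2} 0<π/2 0<π/2) (0<fromℚ (1/2^-pos k))

  x≈-x⇒x≈0 : ∀ x → x ≈ - x → x ≈ 0ℝ
  x≈-x⇒x≈0 x x≈-x = ≈-trans (≈-pointwise {x} {fromℚ ½ * (x + x)} λ n → solve 1 (λ x → x := con ½ :* (x :+ x)) refl (seq x n))
    (≈-trans (*-congˡ (fromℚ ½) {x + x} {x + - x} (+-congˡ x {x} { - x} x≈-x))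
      (≈-pointwise {fromℚ ½ * (x + - x)} {0ℝ} λ n → solve 1 (λ x → con ½ :* (x :- x) := con 0ℚ) refl (seq x n)))

  -x≈--y⇒x≈-y : ∀ x y → - x ≈ - (- y) → x ≈ - y
  -x≈--y⇒x≈-y x y eq = ≈-trans (≈-pointwise {x} { - (- x)} λ n → solve 1 (λ x → x := :- (:- x)) refl (seq x n))
    (≈-trans (neg-cong { - x} { - (- y)} eq) (≈-pointwise { - (- (- y))} { - y} λ n → solve 1 (λ y → :- (:- (:- y)) := :- y) refl (seq y n)))

  sin-0 : sin 0ℝ ≈ 0ℝ
  sin-0 = ≈-pointwise {sin 0ℝ} {0ℝ} λ n → trans (sinPoly-alternating n 0ℚ) (ℚₚ.*-zeroˡ (alternating (sincCoeff (0ℚ ℚ.* 0ℚ)) n))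

  1^ᶻ : ∀ k → ℤ.1ℤ ^ᶻ k ≡ ℤ.1ℤ
  1^ᶻ zero    = refl
  1^ᶻ (suc k) = trans (ℤₚ.*-identityˡ (ℤ.1ℤ ^ᶻ k)) (1^ᶻ k)

  -1^ᶻ-even : ∀ j → (ℤ.- ℤ.1ℤ) ^ᶻ (j ℕ.* 2) ≡ ℤ.1ℤ
  -1^ᶻ-even zero    = refl
  -1^ᶻ-even (suc j) = cong (λ z → ℤ.- ℤ.1ℤ ℤ.* (ℤ.- ℤ.1ℤ ℤ.* z)) (-1^ᶻ-even j)

  2^ᶻ : ∀ k → (ℤ.+ 2) ^ᶻ k ≡ ℤ.+ (2 ℕ.^ k)
  2^ᶻ k = trans (^ᶻ-*2 ℤ.1ℤ k) (trans (cong (λ z → ℤ.+ (2 ℕ.^ k) ℤ.* z) (1^ᶻ k)) (ℤₚ.*-identityʳ (ℤ.+ (2 ℕ.^ k))))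

  angle-eigenvalue : ∀ σ {d} (S : Word d) k m n → λᶻ S ≡ m → m ^ᶻ k ≡ n →
    σ * power ℝ-ring (eigenvalue ℝ-ring S) k ≈ σ * fromℚ (ι n)
  angle-eigenvalue σ S k _ _ refl refl = *-congˡ σ
    {power ℝ-ring (eigenvalue ℝ-ring S) k} {fromℚ (ι (λᶻ S ^ᶻ k))}
    (≈-sym (EmbeddingProperties.h-eigenvalue-power ℤ-ring ℝ-ring ℤ↪ℝ S k))

  opposite-components : ∀ a b c e → (a +i - b) ≈ᶜ CommutativeRing.-_ ℂ-ring (c +i - e) → a ≈ - c × b ≈ - e
  opposite-components a b c e (p , q) = p , -x≈--y⇒x≈-y b e q

  module _ (d k : ℕ) (σ : ℝ) (K : Word d → Word d → ℝ)
    (K≡ : ∀ u v → K u v ≡ LinearAlgebra._^ᴹ_ (raw ℝ-ring) (𝔽₂^ d) (adjacency ℝ-ring) k u v)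
    (x : Word d) (σ-time : PerfectStateTransfer.IsTransferTime (𝔽₂^ d) K x (antipode x) σ) where

    opposite-eigenvalues : ∀ (S T : Word d) →
      CommutativeRing._≈_ ℝ-ring (parity ℝ-ring T) (CommutativeRing.-_ ℝ-ring (parity ℝ-ring S)) →
      ∀ m n p q → λᶻ S ≡ m → m ^ᶻ k ≡ p → λᶻ T ≡ n → n ^ᶻ k ≡ q →
      cos (σ * fromℚ (ι q)) ≈ - cos (σ * fromℚ (ι p)) × sin (σ * fromℚ (ι q)) ≈ - sin (σ * fromℚ (ι p))
    opposite-eigenvalues S T T≈-S m n p q λS mᵏ λT nᵏ =
        ≈-trans (≈-sym (cos-cong {σ * power ℝ-ring (eigenvalue ℝ-ring T) k} {σ * fromℚ (ι q)} (angle-eigenvalue σ T k n q λT nᵏ)))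
          (≈-trans (proj₁ opposite) (neg-cong {cos (σ * power ℝ-ring (eigenvalue ℝ-ring S) k)} {cos (σ * fromℚ (ι p))}
            (cos-cong {σ * power ℝ-ring (eigenvalue ℝ-ring S) k} {σ * fromℚ (ι p)} (angle-eigenvalue σ S k m p λS mᵏ))))
      , ≈-trans (≈-sym (sin-cong {σ * power ℝ-ring (eigenvalue ℝ-ring T) k} {σ * fromℚ (ι q)} (angle-eigenvalue σ T k n q λT nᵏ)))
          (≈-trans (proj₂ opposite) (neg-cong {sin (σ * power ℝ-ring (eigenvalue ℝ-ring S) k)} {sin (σ * fromℚ (ι p))}
            (sin-cong {σ * power ℝ-ring (eigenvalue ℝ-ring S) k} {σ * fromℚ (ι p)} (angle-eigenvalue σ S k m p λS mᵏ))))
      where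
      opposite : cos (σ * power ℝ-ring (eigenvalue ℝ-ring T) k) ≈ - cos (σ * power ℝ-ring (eigenvalue ℝ-ring S) k) × sin (σ * power ℝ-ring (eigenvalue ℝ-ring T) k) ≈ - sin (σ * power ℝ-ring (eigenvalue ℝ-ring S) k)
      opposite = opposite-components (cos (σ * power ℝ-ring (eigenvalue ℝ-ring T) k)) (sin (σ * power ℝ-ring (eigenvalue ℝ-ring T) k)) (cos (σ * power ℝ-ring (eigenvalue ℝ-ring S) k)) (sin (σ * power ℝ-ring (eigenvalue ℝ-ring S) k))
        (opposite-phases d k σ K K≡ x σ-time S T T≈-S)

  angle-±1 : ∀ σ → (σ * fromℚ (ι ℤ.1ℤ) ≈ σ) × (σ * fromℚ (ι (ℤ.- ℤ.1ℤ)) ≈ - σ)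
  angle-±1 σ = ≈-pointwise {σ * fromℚ (ι ℤ.1ℤ)} {σ} (λ n → ℚₚ.*-identityʳ (seq σ n))
    , ≈-pointwise {σ * fromℚ (ι (ℤ.- ℤ.1ℤ))} { - σ} (λ n → solve 1 (λ x → x :* con (ι (ℤ.- ℤ.1ℤ)) := :- x) refl (seq σ n))

  -- A smaller `σ` would make `q σ` lie strictly between 0 and `π`, where sine is positive.
  sin-zero-bound : ∀ σ q r → 0ℚ ℚ.< q → r ℚ.* q ≡ 1ℚ → 0ℝ < σ → sin (σ * fromℚ q) ≈ 0ℝ → (π/2 + π/2) * fromℚ r ≤ σ
  sin-zero-bound σ q r 0<q rq≡1 0<σ sin≈0 σ<πr = <-irrefl {0ℝ} {sin (fromℚ q * σ)}
      (≈-sym (≈-trans (sin-cong {fromℚ q * σ} {σ * fromℚ q} (*-comm (fromℚ q) σ)) sin≈0))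
      (sin-pos-<π {fromℚ q * σ} (*-pos-ℝ {fromℚ q} {σ} (0<fromℚ 0<q) 0<σ)
        (<-resp-≈ {fromℚ q * σ} {fromℚ q * σ} {fromℚ q * ((π/2 + π/2) * fromℚ r)} {π/2 + π/2} (≈-refl {fromℚ q * σ})
          (≈-pointwise {fromℚ q * ((π/2 + π/2) * fromℚ r)} {π/2 + π/2} λ n → trans
            (solve 3 (λ q p r → q :* ((p :+ p) :* r) := (r :* q) :* (p :+ p)) refl q (seq π/2 n) r)
            (trans (cong (ℚ._* (seq π/2 n ℚ.+ seq π/2 n)) rq≡1) (ℚₚ.*-identityˡ _)))
          (*-monoʳ-< {q} {σ} {(π/2 + π/2) * fromℚ r} 0<q σ<πr)))

  -- A transfer time of the k-th power satisfies sin (2ᵏ σ) = 0 for even d, since e^(-iσ 2ᵏ) = -1.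
  module EvenDimension (d k : ℕ) (S T : Word d) (T≈-S : CommutativeRing._≈_ ℝ-ring (parity ℝ-ring T) (CommutativeRing.-_ ℝ-ring (parity ℝ-ring S)))
    (λS : λᶻ S ≡ ℤ.0ℤ) (λT : λᶻ T ≡ ℤ.+ 2) (phase : PhaseMatch d (suc k) ((π/2 + π/2) /2^ suc k)) (K : Word d → Word d → ℝ)
    (K≡ : ∀ u v → K u v ≡ LinearAlgebra._^ᴹ_ (raw ℝ-ring) (𝔽₂^ d) (adjacency ℝ-ring) (suc k) u v) where

    isTransferTime : ∀ x → PerfectStateTransfer.IsTransferTime (𝔽₂^ d) K x (antipode x) ((π/2 + π/2) /2^ suc k)
    isTransferTime = transferTime d (suc k) ((π/2 + π/2) /2^ suc k) K K≡ (0<π/2^ (suc k))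
      (cosᶻ (ℤ.+ d)) (sinᶻ (ℤ.+ d)) (modulusᶻ (ℤ.+ d)) phase

    sin≈0 : ∀ x σ → PerfectStateTransfer.IsTransferTime (𝔽₂^ d) K x (antipode x) σ →
      sin (σ * fromℚ (ι (ℤ.+ (2 ℕ.^ suc k)))) ≈ 0ℝ
    sin≈0 x σ σ-time = ≈-trans
      (proj₂ (opposite-eigenvalues d (suc k) σ K K≡ x σ-time S T T≈-S ℤ.0ℤ (ℤ.+ 2) ℤ.0ℤ (ℤ.+ (2 ℕ.^ suc k))
        -- The exponent is a successor, so the power of the eigenvalue 0 is 0 and its phase is 1.
        λS (ℤₚ.*-zeroˡ (ℤ.0ℤ ^ᶻ k))
        λT (2^ᶻ (suc k))))
      (≈-trans (neg-cong {sin (σ * fromℚ (ι ℤ.0ℤ))} {0ℝ}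
          (≈-trans (sin-cong {σ * fromℚ (ι ℤ.0ℤ)} {0ℝ} (≈-pointwise {σ * fromℚ (ι ℤ.0ℤ)} {0ℝ} λ n → ℚₚ.*-zeroʳ (seq σ n))) sin-0))
        (≈-pointwise { - 0ℝ} {0ℝ} λ _ → refl {x = 0ℚ}))

    minimal : ∀ x σ → PerfectStateTransfer.IsTransferTime (𝔽₂^ d) K x (antipode x) σ → (π/2 + π/2) /2^ suc k ≤ σ
    minimal x σ σ-time = sin-zero-bound σ (ι (ℤ.+ (2 ℕ.^ suc k))) ((ℤ.+ 1 ℚ./ (2 ℕ.^ suc k)) {{ℕₚ.m^n≢0 2 (suc k)}})
      (ℚₚ.<-≤-trans (ℚₚ.positive⁻¹ 1ℚ) (ιₙ-mono {1} {2 ℕ.^ suc k} (ℕₚ.m^n>0 2 (suc k))))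
      (1/-* (2 ℕ.^ suc k) {{ℕₚ.m^n≢0 2 (suc k)}}) (proj₁ σ-time) (sin≈0 x σ σ-time)

    isMin : ∀ x → PerfectStateTransfer.IsMinTransferTime (𝔽₂^ d) K x (antipode x) ((π/2 + π/2) /2^ suc k)
    isMin x = isTransferTime x , minimal x

  -- The eigenvalues 1 and -1 have opposite signs. For odd k this gives cos σ = 0 at a transfer time,
  -- for even k the impossible e^(-iσ) = -e^(-iσ).
  module OddDimension (d k : ℕ) (S T : Word d) (T≈-S : CommutativeRing._≈_ ℝ-ring (parity ℝ-ring T) (CommutativeRing.-_ ℝ-ring (parity ℝ-ring S)))
    (λS : λᶻ S ≡ ℤ.1ℤ) (λT : λᶻ T ≡ ℤ.- ℤ.1ℤ) (K : Word d → Word d → ℝ)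
    (K≡ : ∀ u v → K u v ≡ LinearAlgebra._^ᴹ_ (raw ℝ-ring) (𝔽₂^ d) (adjacency ℝ-ring) k u v) where

    opposite : ∀ x σ → PerfectStateTransfer.IsTransferTime (𝔽₂^ d) K x (antipode x) σ →
      ∀ n → (ℤ.- ℤ.1ℤ) ^ᶻ k ≡ n → cos (σ * fromℚ (ι n)) ≈ - cos σ × sin (σ * fromℚ (ι n)) ≈ - sin σ
    opposite x σ σ-time n eq =
        ≈-trans (proj₁ opp) (neg-cong {cos (σ * fromℚ (ι ℤ.1ℤ))} {cos σ} (cos-cong {σ * fromℚ (ι ℤ.1ℤ)} {σ} (proj₁ (angle-±1 σ))))
      , ≈-trans (proj₂ opp) (neg-cong {sin (σ * fromℚ (ι ℤ.1ℤ))} {sin σ} (sin-cong {σ * fromℚ (ι ℤ.1ℤ)} {σ} (proj₁ (angle-±1 σ))))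
      where
      opp : cos (σ * fromℚ (ι n)) ≈ - cos (σ * fromℚ (ι ℤ.1ℤ)) × sin (σ * fromℚ (ι n)) ≈ - sin (σ * fromℚ (ι ℤ.1ℤ))
      opp = opposite-eigenvalues d k σ K K≡ x σ-time S T T≈-S ℤ.1ℤ (ℤ.- ℤ.1ℤ) ℤ.1ℤ n
        λS (1^ᶻ k) λT eq

    -- Since `(-1)ᵏ = 1`, cosine and sine of `σ` each equal their own negative and vanish, against
    -- `cos² + sin² = 1`.
    even-impossible : ∀ j → k ≡ j ℕ.* 2 → ∀ x σ → ¬ PerfectStateTransfer.IsTransferTime (𝔽₂^ d) K x (antipode x) σ
    even-impossible j refl x σ σ-time = <-irrefl {0ℝ} {1ℝ}
        (≈-trans (≈-pointwise {0ℝ} {0ℝ * 0ℝ + 0ℝ * 0ℝ} λ _ → refl {x = 0ℚ})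
          (≈-trans (+-cong {0ℝ * 0ℝ} {cos σ * cos σ} {0ℝ * 0ℝ} {sin σ * sin σ}
              (*-cong {0ℝ} {cos σ} {0ℝ} {cos σ} (≈-sym cos≈0) (≈-sym cos≈0)) (*-cong {0ℝ} {sin σ} {0ℝ} {sin σ} (≈-sym sin≈0) (≈-sym sin≈0)))
            (cos²+sin²≈1 σ)))
        (0<fromℚ (ℚₚ.positive⁻¹ 1ℚ))
      where
      cos≈0 : cos σ ≈ 0ℝ
      cos≈0 = x≈-x⇒x≈0 (cos σ) (≈-trans (≈-sym (cos-cong {σ * fromℚ (ι ℤ.1ℤ)} {σ} (proj₁ (angle-±1 σ)))) (proj₁ (opposite x σ σ-time ℤ.1ℤ (-1^ᶻ-even j))))
      sin≈0 : sin σ ≈ 0ℝ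
      sin≈0 = x≈-x⇒x≈0 (sin σ) (≈-trans (≈-sym (sin-cong {σ * fromℚ (ι ℤ.1ℤ)} {σ} (proj₁ (angle-±1 σ)))) (proj₂ (opposite x σ σ-time ℤ.1ℤ (-1^ᶻ-even j))))

    module _ (j : ℕ) (k≡ : k ≡ suc (j ℕ.* 2)) (phase : PhaseMatch d k ((π/2 + π/2) /2^ 1)) where

      isTransferTime : ∀ x → PerfectStateTransfer.IsTransferTime (𝔽₂^ d) K x (antipode x) ((π/2 + π/2) /2^ 1)
      isTransferTime = transferTime d k ((π/2 + π/2) /2^ 1) K K≡ (0<π/2^ 1)
        (cosᶻ (ℤ.+ d)) (sinᶻ (ℤ.+ d)) (modulusᶻ (ℤ.+ d))
        phase

      -- Evenness of cosine and the opposite phases give `cos σ = cos (-σ) = - cos σ`, so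
      -- `cos σ = 0`, while cosine is positive strictly between 0 and `π/2`.
      minimal : ∀ x σ → PerfectStateTransfer.IsTransferTime (𝔽₂^ d) K x (antipode x) σ → (π/2 + π/2) /2^ 1 ≤ σ
      minimal x σ σ-time σ<π/2 = <-irrefl {0ℝ} {cos σ} (≈-sym cos≈0) (cos-pos {σ} (proj₁ σ-time)
          (<-resp-≈ {σ} {σ} {(π/2 + π/2) /2^ 1} {π/2} (≈-refl {σ})
            (≈-pointwise {(π/2 + π/2) /2^ 1} {π/2} λ n → solve 1 (λ p → (p :+ p) :* con ½ := p) refl (seq π/2 n)) σ<π/2))
        where
        odd-power : (ℤ.- ℤ.1ℤ) ^ᶻ k ≡ ℤ.- ℤ.1ℤ
        odd-power = trans (cong ((ℤ.- ℤ.1ℤ) ^ᶻ_) k≡) (cong (λ z → ℤ.- ℤ.1ℤ ℤ.* z) (-1^ᶻ-even j))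
        cos≈0 : cos σ ≈ 0ℝ
        cos≈0 = x≈-x⇒x≈0 (cos σ) (≈-trans (≈-sym (cos-neg σ))
          (≈-trans (≈-sym (cos-cong {σ * fromℚ (ι (ℤ.- ℤ.1ℤ))} { - σ} (proj₂ (angle-±1 σ)))) (proj₁ (opposite x σ σ-time (ℤ.- ℤ.1ℤ) odd-power))))

      isMin : ∀ x → PerfectStateTransfer.IsMinTransferTime (𝔽₂^ d) K x (antipode x) ((π/2 + π/2) /2^ 1)
      isMin x = isTransferTime x , minimal x

  -- Here `|S| = d/2` and `|T| = d/2 - 1`; the successor in `suc h` leaves room for the two leading
  -- zeros of `T`.
  even-words : ∀ h d → d ≡ suc h ℕ.* 2 →
    ∃[ S ] ∃[ T ] (CommutativeRing._≈_ ℝ-ring (parity ℝ-ring T) (CommutativeRing.-_ ℝ-ring (parity ℝ-ring S)) × λᶻ {d} S ≡ ℤ.0ℤ × λᶻ {d} T ≡ ℤ.+ 2)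
  even-words h _ refl = balanced (suc h) , 0ℙ ∷ 0ℙ ∷ balanced h
    , WitnessWords.parity-00 ℝ-ring h , WitnessWords.eigenvalue-balanced ℤ-ring (suc h) , WitnessWords.eigenvalue-00 ℤ-ring h

  -- The weights are `(d - 1)/2` and `(d + 1)/2`, so the eigenvalues are 1 and -1 and the signs
  -- differ.
  odd-words : ∀ h d → d ≡ suc (h ℕ.* 2) →
    ∃[ S ] ∃[ T ] (CommutativeRing._≈_ ℝ-ring (parity ℝ-ring T) (CommutativeRing.-_ ℝ-ring (parity ℝ-ring S)) × λᶻ {d} S ≡ ℤ.1ℤ × λᶻ {d} T ≡ ℤ.- ℤ.1ℤ)
  odd-words h _ refl = 0ℙ ∷ balanced h , 1ℙ ∷ balanced h
    , WitnessWords.parity-1 ℝ-ring h , WitnessWords.eigenvalue-0 ℤ-ring h , WitnessWords.eigenvalue-1 ℤ-ring h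

-- The classification by the parities of `d` and `k`.

open import Data.Nat as ℕ using (ℕ; zero; suc; NonZero)
open import Data.Nat.Divisibility using (divides)
open import Data.Parity using (0ℙ)
open import Data.Product using (∃-syntax; _×_; _,_; proj₁; proj₂)
open import Data.Sum using (_⊎_; inj₁; inj₂; [_,_]′)
open import Data.Vec using (replicate)
open import Function.Bundles using (_⇔_; mk⇔)
open import Relation.Binary.PropositionalEquality using (_≡_; refl; cong-app)
open import Relation.Nullary.Negation using (contradiction)
open import Defs
open RealAnalysis
open LinearMaps
open CubeCharacters
open QuarterTurns
open CubeExponential
open TransferTimes

even-phase : ∀ h k d → d ≡ suc h ℕ.* 2 → PhaseMatch d (suc k) ((π/2 + π/2) /2^ suc k)
even-phase h k _ refl = phaseMatch-even (suc h) k

odd-phase : ∀ h j d k → d ≡ suc (h ℕ.* 2) → k ≡ suc (j ℕ.* 2) → PhaseMatch d k ((π/2 + π/2) /2^ 1)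
odd-phase h j _ _ refl refl = phaseMatch-odd h j

even-isMin : ∀ d k .{{_ : NonZero d}} .{{_ : NonZero k}} → Even d → ∀ (K : Word d → Word d → ℝ) →
  (∀ u v → K u v ≡ LinearAlgebra._^ᴹ_ (raw ℝ-ring) (𝔽₂^ d) (adjacency ℝ-ring) k u v) →
  ∀ x → PerfectStateTransfer.IsMinTransferTime (𝔽₂^ d) K x (antipode x) ((π/2 + π/2) /2^ k)
even-isMin d (suc k) even K K≡ =
  let q , d≡q*2 = Even⇒ even
      h , d≡    = half-suc q d d≡q*2
      S , T , T≈-S , λS , λT = even-words h d d≡
  in EvenDimension.isMin d k S T T≈-S λS λT (even-phase h k d d≡) K K≡
  where
  half-suc : ∀ q d .{{_ : NonZero d}} → d ≡ q ℕ.* 2 → ∃[ h ] d ≡ suc h ℕ.* 2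
  -- Dimension 0 is even but has no eigenvalue 2; the instance `NonZero d` excludes it.
  half-suc zero    d d≡0 = contradiction d≡0 (ℕ.≢-nonZero⁻¹ d)
  half-suc (suc h) d d≡  = h , d≡

odd-isMin : ∀ d k → Odd d → Odd k → ∀ (K : Word d → Word d → ℝ) →
  (∀ u v → K u v ≡ LinearAlgebra._^ᴹ_ (raw ℝ-ring) (𝔽₂^ d) (adjacency ℝ-ring) k u v) →
  ∀ x → PerfectStateTransfer.IsMinTransferTime (𝔽₂^ d) K x (antipode x) ((π/2 + π/2) /2^ 1)
odd-isMin d k odd-d odd-k K K≡ =
  let h , d≡ = Odd⇒ odd-d
      j , k≡ = Odd⇒ odd-k
      S , T , T≈-S , λS , λT = odd-words h d d≡
  in OddDimension.isMin d k S T T≈-S λS λT K K≡ j k≡ (odd-phase h j d k d≡ k≡)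

odd-only : ∀ d k → Odd d → ∀ (K : Word d → Word d → ℝ) →
  (∀ u v → K u v ≡ LinearAlgebra._^ᴹ_ (raw ℝ-ring) (𝔽₂^ d) (adjacency ℝ-ring) k u v) →
  ∀ x → PerfectStateTransfer.HasPST (𝔽₂^ d) K x (antipode x) → Odd k
odd-only d k odd-d K K≡ x (σ , σ-time) even-k =
  let h , d≡ = Odd⇒ odd-d
      j , k≡ = Even⇒ even-k
      S , T , T≈-S , λS , λT = odd-words h d d≡
  in OddDimension.even-impossible d k S T T≈-S λS λT K K≡ j k≡ x σ σ-time

even? : ∀ n → Even n ⊎ Odd n
even? n with even-or-odd n
... | inj₁ (q , eq)   = inj₁ (divides q eq)
... | inj₂ (q , refl) = inj₂ (suc-Odd q)

-- The matrix `K` stays a variable, known only through its entries, until the power in the statement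
-- replaces it at the very end.
classification : ∀ d k .{{_ : NonZero d}} .{{_ : NonZero k}} → ∀ (K : Word d → Word d → ℝ) →
  (∀ u v → K u v ≡ LinearAlgebra._^ᴹ_ (raw ℝ-ring) (𝔽₂^ d) (adjacency ℝ-ring) k u v) →
  ((∀ (x : Word d) → Hypercube.HasPST d K x (antipode x)) ⇔ (Even d ⊎ Odd k))
  × (Even d → ∀ (x : Word d) → Hypercube.IsMinTransferTime d K x (antipode x) ((π/2 + π/2) /2^ k))
  × (Odd d →
      (∀ (x : Word d) → Hypercube.HasPST d K x (antipode x) ⇔ Odd k)
      × (Odd k → ∀ (x : Word d) → Hypercube.IsMinTransferTime d K x (antipode x) ((π/2 + π/2) /2^ 1)))
classification d k K K≡ =
    -- For odd `d` a single antipodal pair decides the parity of `k`; the pair of the zero word is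
    -- taken.
    mk⇔ (λ pst → [ inj₁ , (λ odd-d → inj₂ (odd-only d k odd-d K K≡ (replicate d 0ℙ) (pst (replicate d 0ℙ)))) ]′ (even? d))
        [ from-even , (λ odd-k x → [ (λ even-d → from-even even-d x) , (λ odd-d → from-odd odd-d odd-k x) ]′ (even? d)) ]′
  , (λ even-d → even-isMin d k even-d K K≡)
  , (λ odd-d → (λ x → mk⇔ (odd-only d k odd-d K K≡ x) (λ odd-k → from-odd odd-d odd-k x)) , λ odd-k → odd-isMin d k odd-d odd-k K K≡)
  where
  from-even : Even d → ∀ x → PerfectStateTransfer.HasPST (𝔽₂^ d) K x (antipode x)
  from-even even-d x = (π/2 + π/2) /2^ k , proj₁ (even-isMin d k even-d K K≡ x)
  from-odd : Odd d → Odd k → ∀ x → PerfectStateTransfer.HasPST (𝔽₂^ d) K x (antipode x)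
  from-odd odd-d odd-k x = (π/2 + π/2) /2^ 1 , proj₁ (odd-isMin d k odd-d odd-k K K≡ x)

transport : ∀ d k .{{_ : NonZero d}} .{{_ : NonZero k}} (K : Word d → Word d → ℝ) → K ≡ (LinearAlgebra._^ᴹ_ ℝ-rawRing (𝔽₂^ d) (Hypercube.A d) k) → ((∀ (x : Word d) → PerfectStateTransfer.HasPST (𝔽₂^ d) K x (antipode x)) ⇔ (Even d ⊎ Odd k))
    × (Even d → ∀ (x : Word d) → PerfectStateTransfer.IsMinTransferTime (𝔽₂^ d) K x (antipode x) ((π/2 + π/2) /2^ k))
    × (Odd d →
      (∀ (x : Word d) → PerfectStateTransfer.HasPST (𝔽₂^ d) K x (antipode x) ⇔ Odd k)
      × (Odd k → ∀ (x : Word d) → PerfectStateTransfer.IsMinTransferTime (𝔽₂^ d) K x (antipode x) ((π/2 + π/2) /2^ 1))) → ((∀ (x : Word d) → PerfectStateTransfer.HasPST (𝔽₂^ d) (LinearAlgebra._^ᴹ_ ℝ-rawRing (𝔽₂^ d) (Hypercube.A d) k) x (antipode x)) ⇔ (Even d ⊎ Odd k))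
    × (Even d → ∀ (x : Word d) → PerfectStateTransfer.IsMinTransferTime (𝔽₂^ d) (LinearAlgebra._^ᴹ_ ℝ-rawRing (𝔽₂^ d) (Hypercube.A d) k) x (antipode x) ((π/2 + π/2) /2^ k))
    × (Odd d →
      (∀ (x : Word d) → PerfectStateTransfer.HasPST (𝔽₂^ d) (LinearAlgebra._^ᴹ_ ℝ-rawRing (𝔽₂^ d) (Hypercube.A d) k) x (antipode x) ⇔ Odd k)
      × (Odd k → ∀ (x : Word d) → PerfectStateTransfer.IsMinTransferTime (𝔽₂^ d) (LinearAlgebra._^ᴹ_ ℝ-rawRing (𝔽₂^ d) (Hypercube.A d) k) x (antipode x) ((π/2 + π/2) /2^ 1)))
transport d k _ refl p = p

for-power : ∀ d k .{{_ : NonZero d}} .{{_ : NonZero k}} (K : Word d → Word d → ℝ) → K ≡ LinearAlgebra._^ᴹ_ (raw ℝ-ring) (𝔽₂^ d) (adjacency ℝ-ring) k → K ≡ (LinearAlgebra._^ᴹ_ ℝ-rawRing (𝔽₂^ d) (Hypercube.A d) k) → ((∀ (x : Word d) → PerfectStateTransfer.HasPST (𝔽₂^ d) (LinearAlgebra._^ᴹ_ ℝ-rawRing (𝔽₂^ d) (Hypercube.A d) k) x (antipode x)) ⇔ (Even d ⊎ Odd k))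
    × (Even d → ∀ (x : Word d) → PerfectStateTransfer.IsMinTransferTime (𝔽₂^ d) (LinearAlgebra._^ᴹ_ ℝ-rawRing (𝔽₂^ d) (Hypercube.A d) k) x (antipode x) ((π/2 + π/2) /2^ k))
    × (Odd d →
      (∀ (x : Word d) → PerfectStateTransfer.HasPST (𝔽₂^ d) (LinearAlgebra._^ᴹ_ ℝ-rawRing (𝔽₂^ d) (Hypercube.A d) k) x (antipode x) ⇔ Odd k)
      × (Odd k → ∀ (x : Word d) → PerfectStateTransfer.IsMinTransferTime (𝔽₂^ d) (LinearAlgebra._^ᴹ_ ℝ-rawRing (𝔽₂^ d) (Hypercube.A d) k) x (antipode x) ((π/2 + π/2) /2^ 1)))
for-power d k K e₁ e₂ = transport d k K e₂ (classification d k K (λ u v → cong-app (cong-app e₁ u) v))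

theorem5p3 : ∃[ π ] (IsPi π ×
    (∀ (d k : ℕ) .{{_ : NonZero d}} .{{_ : NonZero k}} →
    ((∀ (x : Word d) → PerfectStateTransfer.HasPST (𝔽₂^ d) (LinearAlgebra._^ᴹ_ ℝ-rawRing (𝔽₂^ d) (Hypercube.A d) k) x (antipode x)) ⇔ (Even d ⊎ Odd k))
    × (Even d → ∀ (x : Word d) → PerfectStateTransfer.IsMinTransferTime (𝔽₂^ d) (LinearAlgebra._^ᴹ_ ℝ-rawRing (𝔽₂^ d) (Hypercube.A d) k) x (antipode x) (π /2^ k))
    × (Odd d →
    (∀ (x : Word d) → PerfectStateTransfer.HasPST (𝔽₂^ d) (LinearAlgebra._^ᴹ_ ℝ-rawRing (𝔽₂^ d) (Hypercube.A d) k) x (antipode x) ⇔ Odd k)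
    × (Odd k → ∀ (x : Word d) → PerfectStateTransfer.IsMinTransferTime (𝔽₂^ d) (LinearAlgebra._^ᴹ_ ℝ-rawRing (𝔽₂^ d) (Hypercube.A d) k) x (antipode x) (π /2^ 1)))))
-- The second `refl` identifies the power over the raw ring of `ℝ-ring` with the power in the
-- statement: both use the same operations and the same adjacency test.
theorem5p3 = π/2 + π/2 , isPi , λ d k → for-power d k (LinearAlgebra._^ᴹ_ (raw ℝ-ring) (𝔽₂^ d) (adjacency ℝ-ring) k) refl refl
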